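{- Let $N,S$ be positive integers and let $e_n(s)\in\{ -1,+1\}$ ($1\le n\le N$, $1\le s\le S$) be chosen independently and uniformly at random; put $G_{N,S}(s)=(e_1(s),\dots,e_N(s))$. For any fixed constant $\varepsilon>0$ and any integer function $k=k(N)$ with $2\le k\le (\log N+\log S)/\log\log N$, there is a constant $N_0\ge 12\log_2 S$ such that for all $N\ge N_0$ the probability that \[ 1-\varepsilon<\frac{\Phi_k(G_{N,S})}{\mathbb{E}[\Phi_k(G_{N,S})]}<1+\varepsilon \] holds is at least $1-\varepsilon$.
   Context: For a map $G_{N,S}:\{1,\dots,S\}\to\{ -1,+1\}^N$, $G_{N,S}(s)=(e_1(s),\dots,e_N(s))$, the cross-correlation measure of order $k$ is \[ \Phi_k(G_{N,S})=\max\left|\sum_{n=1}^M e_{n+d_1}(s_1)\cdots e_{n+d_k}(s_k)\right|, \] the maximum taken over all integers $M,d_1,\dots,d_k$ and $1\le s_1,\dots,s_k\le S$ with $0\le d_1\le d_2\le\dots\le d_k<M+d_k\le N$ and $d_i\ne d_j$ whenever $s_i=s_j$. $\log$ denotes the natural logarithm. -}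

module Defs where

open import Data.Fin.Base using (Fin)
import Data.Fin.Properties as Fin
import Data.Integer.Base as ℤ
open import Data.Integer.Base using (ℤ; +_)
open import Data.List.Base as List using (List; []; _∷_; map; upTo; allFin; filter; cartesianProduct; cartesianProductWith)
open import Data.List.Extrema.Nat using (max)
open import Data.List.Membership.Propositional using (_∈_)
open import Data.List.Relation.Unary.All as ListAll using ()
open import Data.List.Relation.Unary.Unique.Propositional using (Unique)
import Data.Nat.Base as ℕ
open import Data.Nat.Base using (ℕ; zero; suc)
import Data.Nat.Properties as ℕ
open import Data.Nat.ListAction using (sum)
open import Data.Product using (∃; ∃₂; _×_; _,_; proj₁)
import Data.Rational.Base as ℚ
open import Data.Rational.Base using (ℚ; 0ℚ; 1ℚ)
open import Data.Sign.Base using (Sign)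
open import Data.Sum.Base using (_⊎_)
open import Data.Vec.Base as Vec using (Vec; []; _∷_; lookup)
open import Data.Vec.Relation.Unary.All as All using (All)
open import Data.Vec.Relation.Unary.AllPairs as AllPairs using (AllPairs)
open import Function.Bundles using (_⇔_)
open import Relation.Binary.PropositionalEquality using (_≡_; _≢_)
open import Relation.Nullary using (Dec; ¬_; ¬?)
open import Relation.Nullary.Decidable using (_×-dec_; _→-dec_)

-- Real numbers are two-sided Dedekind cuts of ℚ: L x q means q < x and U x q
-- means x < q.  The operations below are defined on raw cuts; `IsReal` says
-- that a raw cut is a real number.
record Cut : Set₁ where
  field
    L U : ℚ → Set

open Cut public

record IsReal (x : Cut) : Set where
  field
    inhabitedˡ : ∃ (L x)
    inhabitedᵘ : ∃ (U x)
    roundedˡ   : ∀ q → L x q ⇔ ∃ λ r → q ℚ.< r × L x r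
    roundedᵘ   : ∀ q → U x q ⇔ ∃ λ r → r ℚ.< q × U x r
    disjoint   : ∀ q → ¬ (L x q × U x q)
    located    : ∀ {q r} → q ℚ.< r → L x q ⊎ U x r

infix  4 _<_ _≤_
infixl 6 _+_ _-_
infixl 7 _/_ _·_
infix  8 -_

_<_ : Cut → Cut → Set
x < y = ∃ λ q → U x q × L y q

_≤_ : Cut → Cut → Set
x ≤ y = ∀ q → L x q → L y q

fromℚ : ℚ → Cut
fromℚ p .L q = q ℚ.< p
fromℚ p .U q = p ℚ.< q

fromℕ : ℕ → Cut
fromℕ n = fromℚ (+ n ℚ./ 1)

_+_ : Cut → Cut → Cut
(x + y) .L q = ∃₂ λ r s → L x r × L y s × q ≡ r ℚ.+ s
(x + y) .U q = ∃₂ λ r s → U x r × U y s × q ≡ r ℚ.+ s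

-_ : Cut → Cut
(- x) .L q = U x (ℚ.- q)
(- x) .U q = L x (ℚ.- q)

_-_ : Cut → Cut → Cut
x - y = x + - y

_·_ : ℕ → Cut → Cut
zero  · x = fromℚ 0ℚ
suc n · x = x + n · x

-- The quotient for y > 0 and x of any sign: q < x / y iff q * y < x, and
-- q * y always lies between q * s and q * t when s < y < t.
_/_ : Cut → Cut → Cut
(x / y) .L q = ∃₂ λ s t → L y s × U y t × L x (q ℚ.* s) × L x (q ℚ.* t)
(x / y) .U q = ∃₂ λ s t → L y s × U y t × U x (q ℚ.* s) × U x (q ℚ.* t)

-- Only meaningful for convergent sequences.
lim : (ℕ → ℚ) → Cut
lim a .L q = ∃ λ r → q ℚ.< r × ∃ λ m → ∀ n → m ℕ.≤ n → r ℚ.≤ a n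
lim a .U q = ∃ λ r → r ℚ.< q × ∃ λ m → ∀ n → m ℕ.≤ n → a n ℚ.≤ r

-- expTerm q i = qⁱ / i!
expTerm : ℚ → ℕ → ℚ
expTerm q zero    = 1ℚ
expTerm q (suc i) = expTerm q i ℚ.* q ℚ.* (+ 1 ℚ./ suc i)

expSum : ℚ → ℕ → ℚ
expSum q zero    = 0ℚ
expSum q (suc n) = expSum q n ℚ.+ expTerm q n

exp : ℚ → Cut
exp q = lim (expSum q)

-- The natural logarithm of x > 0, as the inverse of exp.
log : Cut → Cut
log x .L q = exp q < x
log x .U q = x < exp q

log₂ : Cut → Cut
log₂ x = log x / log (fromℕ 2)

Family : ℕ → ℕ → Set
Family N S = Vec (Vec Sign N) S

vecsOver : {A : Set} → List A → ∀ n → List (Vec A n)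
vecsOver xs zero    = [] ∷ []
vecsOver xs (suc n) = cartesianProductWith _∷_ xs (vecsOver xs n)

families : ∀ N S → List (Family N S)
families N S = vecsOver (vecsOver (Sign.- ∷ Sign.+ ∷ []) N) S

mean : ∀ N S → ℕ → ℚ
mean N S n = ℚ._/_ (+ n) (2 ℕ.^ (N ℕ.* S)) {{ℕ.m^n≢0 2 (N ℕ.* S)}}

𝔼 : ∀ {N S} → (Family N S → ℕ) → ℚ
𝔼 {N} {S} X = mean N S (sum (map X (families N S)))

-- The events of interest involve a real parameter and so are not decidable;
-- their probability is the cut given by the finite sets of outcomes inside
-- and around the event.
ℙ : ∀ {N S} → (Family N S → Set) → Cut
ℙ {N} {S} P .L q = ∃ λ xs → Unique xs × ListAll.All P xs × q ℚ.< mean N S (List.length xs)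
ℙ {N} {S} P .U q = ∃ λ xs → (∀ e → P e → e ∈ xs) × mean N S (List.length xs) ℚ.< q

-- The entry at a position counted from 0; the value 0 outside the sequence
-- is never used for admissible parameters.
entry : ∀ {N} → Vec Sign N → ℕ → ℤ
entry []       _       = + 0
entry (x ∷ xs) zero    = x ℤ.◃ 1
entry (x ∷ xs) (suc n) = entry xs n

-- The parameters (d₁ , s₁) , … , (d_k , s_k).
Params : ℕ → ℕ → Set
Params S k = Vec (ℕ × Fin S) k

-- Required of the i-th and j-th parameters for i < j.
Compatible : ∀ {S} → ℕ × Fin S → ℕ × Fin S → Set
Compatible (d , s) (d′ , s′) = d ℕ.≤ d′ × (s ≡ s′ → d ≢ d′)

-- As the d's are increasing, M + d_k ≤ N amounts to M + d_i ≤ N for all i.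
Admissible : ∀ {S k} → ℕ → ℕ → Params S k → Set
Admissible N M ps =
  0 ℕ.< M × AllPairs Compatible ps × All (λ p → M ℕ.+ proj₁ p ℕ.≤ N) ps

admissible? : ∀ {S k} N M (ps : Params S k) → Dec (Admissible N M ps)
admissible? N M ps =
  0 ℕ.<? M
  ×-dec AllPairs.allPairs? (λ (d , s) (d′ , s′) →
          d ℕ.≤? d′ ×-dec (s Fin.≟ s′ →-dec ¬? (d ℕ.≟ d′))) ps
  ×-dec All.all? (λ p → M ℕ.+ proj₁ p ℕ.≤? N) ps

correlation : ∀ {N S k} → Family N S → ℕ → Params S k → ℤ
correlation e M ps = List.foldr ℤ._+_ (+ 0) (map term (upTo M))
  where
  term : ℕ → ℤ
  term n = Vec.foldr′ ℤ._*_ (+ 1) (Vec.map (λ (d , s) → entry (lookup e s) (n ℕ.+ d)) ps)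

-- The candidates include all admissible parameters, which satisfy M ≤ N and
-- d_i < N.  The maximum over the empty set is taken to be 0.
Φ : ∀ {N S} → ℕ → Family N S → ℕ
Φ {N} {S} k e =
  max 0 (map (λ (M , ps) → ℤ.∣ correlation e M ps ∣)
    (filter (λ (M , ps) → admissible? N M ps)
      (cartesianProduct (upTo (suc N))
        (vecsOver (cartesianProduct (upTo N) (allFin S)) k))))

{-# OPTIONS --safe #-}

-- Concentration: changing one sign changes Φ_k by at most 2k, so by the Efron–Stein inequality the
-- variance of Φ_k is at most 4 N S k², and by Chebyshev's inequality it suffices that 𝔼 Φ_k is a
-- large multiple of k √N (ε and S being fixed).
--
-- Lower bound for the mean: use a single sequence with d₁ = 0 and all other dᵢ ≥ M, where M is
-- proportional to N.  As polynomials over 𝔽₂, A (1 + x^M D) = A′ (1 + x^M D′) with deg A, deg A′ < M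
-- forces A = A′ and then D = D′, so the product sequences belonging to two different choices of the
-- dᵢ are independent and uniform on {±1}^M.  A uniform sequence, cut into T ≈ C k² blocks, has a sum
-- of order √(M/T) in every block, hence total of order √(M T), with probability at least 16^(-T).
-- By the second moment method this happens for one of the choices with probability at least 1/2 as
-- soon as there are 2 · 16^T of them, which holds because k = o(log N).

module Submission where

open import Data.Fin.Base using (Fin; zero; suc; toℕ)
import Data.Fin.Properties as Fin
import Data.Integer.Base as ℤ
open import Data.Integer.Base using (ℤ; +_; -[1+_])
import Data.Integer.Properties as ℤ
import Data.Integer.Tactic.RingSolver as ℤ-Solver
open import Data.List.Base as List using (List; []; _∷_; _++_; length; map; upTo; applyUpTo; allFin; filter; cartesianProductWith; cartesianProduct)
open import Data.List.Extrema.Nat using (max; max≤v⁺; xs≤max)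
open import Data.List.Membership.Propositional using (_∈_)
open import Data.List.Membership.Propositional.Properties using (∈-map⁺; ∈-filter⁺; ∈-cartesianProductWith⁺; ∈-cartesianProduct⁺; ∈-upTo⁺; ∈-allFin)
import Data.List.Properties as List
open import Data.List.Relation.Unary.All as ListAll using ([]; _∷_)
import Data.List.Relation.Unary.All.Properties as ListAll
open import Data.List.Relation.Unary.AllPairs using ([]; _∷_)
import Data.List.Relation.Unary.Any as Any
open import Data.List.Relation.Unary.Unique.Propositional using (Unique)
import Data.List.Relation.Unary.Unique.Propositional.Properties as Unique
import Data.Nat.Base as ℕ
open import Data.Nat.Base using (ℕ; zero; suc; z≤n; s≤s)
open import Data.Nat.ListAction using (sum)
import Data.Nat.Properties as ℕ
import Data.Nat.Tactic.RingSolver as ℕ-Solver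
open import Data.Product using (∃; ∃₂; _×_; _,_; proj₁; proj₂)
import Data.Rational.Base as ℚ
open import Data.Rational.Base using (ℚ; 0ℚ; 1ℚ; ½; toℚᵘ)
import Data.Rational.Properties as ℚ
import Data.Rational.Unnormalised.Base as ℚᵘ
open import Data.Rational.Unnormalised.Base using (mkℚᵘ; *≡*; *≤*)
import Data.Rational.Unnormalised.Properties as ℚᵘ
import Data.Sign.Base as Sign
open import Data.Sign.Base using (Sign)
import Data.Sign.Properties as Sign
open import Data.Sum.Base using (inj₁; inj₂)
open import Data.Vec.Base as Vec using (Vec; []; _∷_; lookup; zipWith)
import Data.Vec.Properties as Vec
open import Data.Vec.Relation.Unary.All as All using (All; []; _∷_)
import Data.Vec.Relation.Unary.All.Properties as All
open import Data.Vec.Relation.Unary.AllPairs as AllPairs using (AllPairs; []; _∷_)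
import Data.Vec.Relation.Unary.AllPairs.Properties as AllPairs
open import Defs using (vecsOver; Family; families; Params; Admissible; admissible?; entry; correlation; Φ; expTerm; expSum)
open import Function.Bundles using (Equivalence)
open import Level using (0ℓ)
open import Relation.Binary.Definitions using (tri<; tri≈; tri>)
open import Relation.Binary.PropositionalEquality using (_≡_; _≢_; refl; sym; trans; cong; cong₂; subst; subst₂; module ≡-Reasoning)
open import Relation.Nullary using (Dec; yes; no; ¬_; ¬?)
open import Relation.Nullary.Decidable using (dec⇒maybe; _×-dec_)
open import Relation.Nullary.Negation using (contradiction)
import Tactic.RingSolver as RingSolver
open import Tactic.RingSolver.Core.AlmostCommutativeRing using (AlmostCommutativeRing; fromCommutativeRing)

-- The Lipschitz constant grows with k, so the order √N of a single correlation does not suffice: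
-- the mean must gain a further factor of order k. A window whose T blocks are all large gains √T,
-- which forces T of order k² and a probability as small as 16^(-T). The k - 1 free offsets have to
-- compensate for this, so each gets about 2^(8Ck) values, and k = o(log N) provides the room for
-- them; k ≥ 2 ensures that there is a free offset. Independence of two windows comes from
-- solvability: both can be prescribed at will, so a homomorphism of sign groups is onto and
-- therefore takes all its values equally often. Probabilities are counts over all families with
-- denominators cleared, so the combinatorial estimates are inequalities between integers; rationals
-- and cuts enter only with exp, log and the final quotient. The obstacle there is that upper bounds
-- on exp must hold uniformly for all arguments below a given one, including very negative ones,
-- whose partial sums oscillate.

-- Finite sums, variance on product spaces, equidistribution

module Sums where
  open import Data.Integer.Base using (_+_; _*_; _-_; -_; _≤_)
  open ℤ-Solver using (solve-∀)

  private variable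
    A B C : Set

  ∑ : List A → (A → ℤ) → ℤ
  ∑ []       f = + 0
  ∑ (x ∷ xs) f = f x + ∑ xs f

  ∑-cong : ∀ (xs : List A) {f g : A → ℤ} → (∀ x → f x ≡ g x) → ∑ xs f ≡ ∑ xs g
  ∑-cong []       f≡g = refl
  ∑-cong (x ∷ xs) f≡g = cong₂ _+_ (f≡g x) (∑-cong xs f≡g)

  ∑-mono : ∀ (xs : List A) {f g : A → ℤ} → (∀ x → f x ≤ g x) → ∑ xs f ≤ ∑ xs g
  ∑-mono []       f≤g = ℤ.≤-refl
  ∑-mono (x ∷ xs) f≤g = ℤ.+-mono-≤ (f≤g x) (∑-mono xs f≤g)

  private
    interchange : ∀ a b c d → (a + b) + (c + d) ≡ (a + c) + (b + d)
    interchange = solve-∀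

  ∑-+ : ∀ (xs : List A) (f g : A → ℤ) → ∑ xs (λ x → f x + g x) ≡ ∑ xs f + ∑ xs g
  ∑-+ []       f g = refl
  ∑-+ (x ∷ xs) f g =
    trans (cong (_+_ (f x + g x)) (∑-+ xs f g)) (interchange (f x) (g x) (∑ xs f) (∑ xs g))

  ∑-* : ∀ (xs : List A) c (f : A → ℤ) → ∑ xs (λ x → c * f x) ≡ c * ∑ xs f
  ∑-* []       c f = sym (ℤ.*-zeroʳ c)
  ∑-* (x ∷ xs) c f =
    trans (cong (_+_ (c * f x)) (∑-* xs c f)) (sym (ℤ.*-distribˡ-+ c (f x) (∑ xs f)))

  ∑-const : ∀ (xs : List A) c → ∑ xs (λ _ → c) ≡ + length xs * c
  ∑-const []       c = refl
  ∑-const (x ∷ xs) c = trans (cong (_+_ c) (∑-const xs c)) (sym (ℤ.suc-* (+ length xs) c))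

  ∑-++ : ∀ (xs ys : List A) (f : A → ℤ) → ∑ (xs ++ ys) f ≡ ∑ xs f + ∑ ys f
  ∑-++ []       ys f = sym (ℤ.+-identityˡ _)
  ∑-++ (x ∷ xs) ys f = trans (cong (_+_ (f x)) (∑-++ xs ys f)) (sym (ℤ.+-assoc (f x) _ _))

  ∑-map : ∀ (g : A → B) xs (f : B → ℤ) → ∑ (map g xs) f ≡ ∑ xs (λ x → f (g x))
  ∑-map g []       f = refl
  ∑-map g (x ∷ xs) f = cong (_+_ (f (g x))) (∑-map g xs f)

  ∑-× : ∀ (h : A → B → C) xs ys (f : C → ℤ) →
    ∑ (cartesianProductWith h xs ys) f ≡ ∑ xs (λ x → ∑ ys (λ y → f (h x y)))
  ∑-× h []       ys f = refl
  ∑-× h (x ∷ xs) ys f =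
    trans (∑-++ (map (h x) ys) _ f) (cong₂ _+_ (∑-map (h x) ys f) (∑-× h xs ys f))

  ∑-swap : ∀ (xs : List A) (ys : List B) (f : A → B → ℤ) →
    ∑ xs (λ x → ∑ ys (f x)) ≡ ∑ ys (λ y → ∑ xs (λ x → f x y))
  ∑-swap []       ys f = sym (trans (∑-const ys (+ 0)) (ℤ.*-zeroʳ (+ length ys)))
  ∑-swap (x ∷ xs) ys f =
    trans (cong (_+_ (∑ ys (f x))) (∑-swap xs ys f)) (sym (∑-+ ys (f x) _))

  length-× : ∀ (h : A → B → C) xs ys →
    + length (cartesianProductWith h xs ys) ≡ + length xs * + length ys
  length-× h xs ys = begin
    + length zs                    ≡⟨ sym (ℤ.*-identityʳ (+ length zs)) ⟩
    + length zs * + 1              ≡⟨ sym (∑-const zs (+ 1)) ⟩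
    ∑ zs (λ _ → + 1)               ≡⟨ ∑-× h xs ys (λ _ → + 1) ⟩
    ∑ xs (λ _ → ∑ ys (λ _ → + 1))  ≡⟨ ∑-const xs _ ⟩
    + length xs * ∑ ys (λ _ → + 1) ≡⟨ cong (+ length xs *_) (trans (∑-const ys (+ 1)) (ℤ.*-identityʳ _)) ⟩
    + length xs * + length ys      ∎
    where
    open ≡-Reasoning
    zs = cartesianProductWith h xs ys

  ∑-sum : ∀ (xs : List A) (f : A → ℕ) → ∑ xs (λ x → + f x) ≡ + sum (map f xs)
  ∑-sum []       f = refl
  ∑-sum (x ∷ xs) f = trans (cong (_+_ (+ f x)) (∑-sum xs f)) (sym (ℤ.pos-+ (f x) _))

  0≤i² : ∀ i → + 0 ≤ i * i
  0≤i² (+ n)    = subst (+ 0 ≤_) (ℤ.pos-* n n) (ℤ.+≤+ ℕ.z≤n)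
  0≤i² -[1+ n ] = ℤ.+≤+ ℕ.z≤n

  0≤* : ∀ {i j} → + 0 ≤ i → + 0 ≤ j → + 0 ≤ i * j
  0≤* {+ m} {+ n} _ _ = subst (+ 0 ≤_) (ℤ.pos-* m n) (ℤ.+≤+ ℕ.z≤n)

  *-mono-≤ : ∀ {i j k l} → + 0 ≤ i → + 0 ≤ k → i ≤ j → k ≤ l → i * k ≤ j * l
  *-mono-≤ {+ i} {+ j} {+ k} {+ l} _ _ (ℤ.+≤+ p) (ℤ.+≤+ q) =
    subst₂ _≤_ (ℤ.pos-* i k) (ℤ.pos-* j l) (ℤ.+≤+ (ℕ.*-mono-≤ p q))

  ≤-by : ∀ {i j} d → + 0 ≤ d → i + d ≡ j → i ≤ j
  ≤-by {i} d 0≤d eq = subst₂ _≤_ (ℤ.+-identityʳ i) eq (ℤ.+-monoʳ-≤ i 0≤d)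

  Lipschitz : (A → A → Set) → ℤ → (A → ℤ) → Set
  Lipschitz _~_ c f = ∀ x y → x ~ y → f x ≤ f y + c × f y ≤ f x + c

  -- Var f ≤ v c², multiplied by |xs|².
  VarianceBound : List A → (A → A → Set) → ℤ → Set
  VarianceBound {A} xs _~_ v = ∀ c → + 0 ≤ c → (f : A → ℤ) → Lipschitz _~_ c f →
    + length xs * ∑ xs (λ x → f x * f x) ≤ ∑ xs f * ∑ xs f + v * (c * c) * (+ length xs * + length xs)

  data Neighbour {A : Set} (_~_ : A → A → Set) : ∀ {n} → Vec A n → Vec A n → Set where
    here  : ∀ {n x y} {u : Vec A n} → x ~ y → Neighbour _~_ (x ∷ u) (y ∷ u)
    there : ∀ {n x} {u v : Vec A n} → Neighbour _~_ u v → Neighbour _~_ (x ∷ u) (x ∷ v)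

  -- Tensorisation of the variance: Var f ≤ 𝔼 Var(f | first coordinate) + Var 𝔼(f | first coordinate).
  varianceBound-vecsOver : ∀ {xs : List A} {_~_ v} → + 0 ≤ v → VarianceBound xs _~_ v →
    ∀ n → VarianceBound (vecsOver xs n) (Neighbour _~_) (+ n * v)
  varianceBound-vecsOver {xs = xs} {_~_} {v} 0≤v bound zero c 0≤c f lip =
    ≤-by (+ 0) ℤ.≤-refl (identity (f []) v c)
    where
    identity : ∀ a v c → + 1 * (a * a + + 0) + + 0 ≡ (a + + 0) * (a + + 0) + + 0 * v * (c * c) * (+ 1 * + 1)
    identity = solve-∀
  varianceBound-vecsOver {A} {xs = xs} {_~_} {v} 0≤v bound (suc n) c 0≤c f lip = begin
    + length zs * ∑ zs (λ z → f z * f z)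
      ≡⟨ cong₂ _*_ (length-× _∷_ xs us) (∑-× _∷_ xs us _) ⟩
    (X * U) * ∑ xs (λ x → ∑ us (λ u → f (x ∷ u) * f (x ∷ u)))
      ≡⟨ ℤ.*-assoc X U _ ⟩
    X * (U * ∑ xs (λ x → ∑ us (λ u → f (x ∷ u) * f (x ∷ u))))
      ≡⟨ cong (X *_) (sym (∑-* xs U _)) ⟩
    X * ∑ xs (λ x → U * ∑ us (λ u → f (x ∷ u) * f (x ∷ u)))
      ≤⟨ ℤ.*-monoˡ-≤-nonNeg X (∑-mono xs inner) ⟩
    X * ∑ xs (λ x → F x * F x + N * (c * c) * (U * U))
      ≡⟨ cong (X *_) (trans (∑-+ xs (λ x → F x * F x) (λ _ → N * (c * c) * (U * U))) (cong (_+_ (∑ xs (λ x → F x * F x))) (∑-const xs _))) ⟩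
    X * (∑ xs (λ x → F x * F x) + X * (N * (c * c) * (U * U)))
      ≡⟨ ℤ.*-distribˡ-+ X _ _ ⟩
    X * ∑ xs (λ x → F x * F x) + X * (X * (N * (c * c) * (U * U)))
      ≤⟨ ℤ.+-monoˡ-≤ _ (bound (U * c) (0≤* {U} (ℤ.+≤+ ℕ.z≤n) 0≤c) F outer) ⟩
    ∑ xs F * ∑ xs F + v * ((U * c) * (U * c)) * (X * X) + X * (X * (N * (c * c) * (U * U)))
      ≡⟨ identity (∑ xs F) v U c X (+ n) ⟩
    ∑ xs F * ∑ xs F + (ℤ.suc (+ n) * v) * (c * c) * ((X * U) * (X * U))
      ≡⟨ cong₂ _+_ (cong₂ _*_ (sym (∑-× _∷_ xs us f)) (sym (∑-× _∷_ xs us f)))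
                   (cong ((+ suc n * v) * (c * c) *_) (cong₂ _*_ (sym (length-× _∷_ xs us)) (sym (length-× _∷_ xs us)))) ⟩
    ∑ zs f * ∑ zs f + (+ suc n * v) * (c * c) * (+ length zs * + length zs) ∎
    where
    open ℤ.≤-Reasoning
    us = vecsOver xs n
    zs = vecsOver xs (suc n)
    X U N : ℤ
    X = + length xs
    U = + length us
    N = + n * v
    F : A → ℤ
    F x = ∑ us (λ u → f (x ∷ u))
    inner : ∀ x → U * ∑ us (λ u → f (x ∷ u) * f (x ∷ u)) ≤ F x * F x + N * (c * c) * (U * U)
    inner x = varianceBound-vecsOver 0≤v bound n c 0≤c (λ u → f (x ∷ u)) (λ u w u~w → lip _ _ (there u~w))
    sum≤ : ∀ x y → (∀ u → f (x ∷ u) ≤ f (y ∷ u) + c) → F x ≤ F y + U * c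
    sum≤ x y p = ℤ.≤-trans (∑-mono us p) (ℤ.≤-reflexive (trans (∑-+ us _ _) (cong (_+_ (F y)) (∑-const us c))))
    -- `F` is a conditional sum and not a conditional mean, so its Lipschitz constant carries the
    -- factor `U`. This is why `VarianceBound` quantifies over c.
    outer : Lipschitz _~_ (U * c) F
    outer x y x~y = sum≤ x y (λ u → proj₁ (lip _ _ (here x~y))) , sum≤ y x (λ u → proj₂ (lip _ _ (here x~y)))
    identity : ∀ a v U c X n → a * a + v * ((U * c) * (U * c)) * (X * X) + X * (X * (n * v * (c * c) * (U * U)))
      ≡ a * a + ((+ 1 + n) * v) * (c * c) * ((X * U) * (X * U))
    identity = solve-∀

  signs : List Sign
  signs = Sign.- ∷ Sign.+ ∷ []

  -- Relates all pairs of signs, so that `Neighbour Any²` means differing in at most one entry.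
  data Any² : Sign → Sign → Set where
    any² : ∀ {s t} → Any² s t

  -- With denominators cleared the claim is (a - b)² ≤ 4c². The product of the two Lipschitz gaps
  -- gives c² - (a - b)² ≥ 0; the 3c² is the slack from the integer 1 in place of the optimal
  -- constant 1/4.
  varianceBound-signs : VarianceBound signs Any² (+ 1)
  varianceBound-signs c 0≤c f lip with lip Sign.- Sign.+ any²
  ... | p , q = ≤-by ((c - (a - b)) * (c - (b - a)) + + 3 * (c * c))
    (ℤ.+-mono-≤ (0≤* (≤⇒0≤ a b p) (≤⇒0≤ b a q)) (0≤* {+ 3} (ℤ.+≤+ ℕ.z≤n) (0≤i² c))) (identity a b c)
    where
    a b : ℤ
    a = f Sign.-
    b = f Sign.+
    ≤⇒0≤ : ∀ i j → i ≤ j + c → + 0 ≤ c - (i - j)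
    ≤⇒0≤ i j i≤j+c = subst (+ 0 ≤_) (eq i j c) (ℤ.i≤j⇒0≤j-i i≤j+c)
      where
      eq : ∀ i j c → (j + c) - i ≡ c - (i - j)
      eq = solve-∀
    identity : ∀ a b c → + 2 * (a * a + (b * b + + 0)) + ((c - (a - b)) * (c - (b - a)) + + 3 * (c * c))
      ≡ (a + (b + + 0)) * (a + (b + + 0)) + + 1 * (c * c) * (+ 2 * + 2)
    identity = solve-∀

  -- Uniform distribution, expressed as invariance of counting measure under translations. It stands
  -- in for the group axioms and passes to vectors and pairs coordinatewise.
  record Invariant (_∙_ : A → A → A) (xs : List A) : Set where
    constructor invariant
    field
      ∑-shift : ∀ a (f : A → ℤ) → ∑ xs (λ x → f (a ∙ x)) ≡ ∑ xs f

  open Invariant public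

  invariant-signs : Invariant Sign._*_ signs
  invariant-signs = invariant λ
    { Sign.+ f → refl
    ; Sign.- f → swap (f Sign.+) (f Sign.-)
    }
    where
    swap : ∀ a b → a + (b + + 0) ≡ b + (a + + 0)
    swap = solve-∀

  invariant-vecsOver : ∀ {_∙_ : A → A → A} {xs} → Invariant _∙_ xs →
    ∀ n → Invariant (zipWith {n = n} _∙_) (vecsOver xs n)
  invariant-vecsOver inv zero .∑-shift [] f = refl
  invariant-vecsOver {_∙_ = _∙_} {xs} inv (suc n) .∑-shift (a ∷ as) f = begin
    ∑ (vecsOver xs (suc n)) (λ z → f (zipWith _∙_ (a ∷ as) z))
      ≡⟨ ∑-× _∷_ xs us _ ⟩
    ∑ xs (λ x → ∑ us (λ u → f ((a ∙ x) ∷ zipWith _∙_ as u)))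
      ≡⟨ ∑-cong xs (λ x → invariant-vecsOver inv n .∑-shift as (λ u → f ((a ∙ x) ∷ u))) ⟩
    ∑ xs (λ x → ∑ us (λ u → f ((a ∙ x) ∷ u)))
      ≡⟨ inv .∑-shift a (λ x → ∑ us (λ u → f (x ∷ u))) ⟩
    ∑ xs (λ x → ∑ us (λ u → f (x ∷ u)))
      ≡⟨ sym (∑-× _∷_ xs us f) ⟩
    ∑ (vecsOver xs (suc n)) f ∎
    where
    open ≡-Reasoning
    us = vecsOver xs n

  _⊗_ : (A → A → A) → (B → B → B) → A × B → A × B → A × B
  (_∙_ ⊗ _⋆_) (a , b) (x , y) = a ∙ x , b ⋆ y

  invariant-× : ∀ {_∙_ : A → A → A} {_⋆_ : B → B → B} {xs ys} →
    Invariant _∙_ xs → Invariant _⋆_ ys → Invariant (_∙_ ⊗ _⋆_) (cartesianProduct xs ys)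
  invariant-× {xs = xs} {ys} inv inv′ .∑-shift (a , b) f =
    trans (∑-× _,_ xs ys _)
   (trans (∑-cong xs (λ x → inv′ .∑-shift b _))
   (trans (inv .∑-shift a _) (sym (∑-× _,_ xs ys f))))

  -- Translating by a preimage of y shows that the left sum does not change when f is replaced by
  -- its translate by y; then average over y.
  equidistribution : ∀ {_∙_ : A → A → A} {_⋆_ : B → B → B} {xs ys} →
    Invariant _∙_ xs → Invariant _⋆_ ys → (∀ x y → x ⋆ y ≡ y ⋆ x) →
    (φ : A → B) → (∀ x y → φ (x ∙ y) ≡ φ x ⋆ φ y) → (∀ b → ∃ λ a → φ a ≡ b) →
    ∀ f → + length ys * ∑ xs (λ x → f (φ x)) ≡ + length xs * ∑ ys f
  equidistribution {_∙_ = _∙_} {_⋆_} {xs} {ys} inv inv′ comm φ hom onto f = begin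
    + length ys * ∑ xs (λ x → f (φ x))            ≡⟨ sym (∑-const ys _) ⟩
    ∑ ys (λ _ → ∑ xs (λ x → f (φ x)))              ≡⟨ ∑-cong ys shift ⟩
    ∑ ys (λ y → ∑ xs (λ x → f (φ x ⋆ y)))          ≡⟨ ∑-swap ys xs _ ⟩
    ∑ xs (λ x → ∑ ys (λ y → f (φ x ⋆ y)))          ≡⟨ ∑-cong xs (λ x → inv′ .∑-shift (φ x) f) ⟩
    ∑ xs (λ _ → ∑ ys f)                            ≡⟨ ∑-const xs _ ⟩
    + length xs * ∑ ys f                           ∎
    where
    open ≡-Reasoning
    shift : ∀ y → ∑ xs (λ x → f (φ x)) ≡ ∑ xs (λ x → f (φ x ⋆ y))
    shift y with onto y
    ... | a , refl = trans (sym (inv .∑-shift a (λ x → f (φ x)))) (∑-cong xs (λ x → cong f (trans (hom a x) (comm _ _))))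

-- Moments and one-sided tails of a sum of random signs

module Tails where
  open import Data.Integer.Base using (_+_; _*_; _-_; -_; _≤_; _◃_)
  open ℤ-Solver using (solve-∀)
  open Sums

  signVecs : ∀ n → List (Vec Sign n)
  signVecs = vecsOver signs

  ∑-signVecs : ∀ n (f : Vec Sign (suc n) → ℤ) →
    ∑ (signVecs (suc n)) f ≡ ∑ (signVecs n) (λ u → f (Sign.- ∷ u) + f (Sign.+ ∷ u))
  ∑-signVecs n f = trans (∑-× _∷_ signs (signVecs n) f)
    (trans (cong (_+_ (∑ (signVecs n) (λ u → f (Sign.- ∷ u)))) (ℤ.+-identityʳ _)) (sym (∑-+ (signVecs n) _ _)))

  ∑-signVecs-++ : ∀ m n (f : Vec Sign (m ℕ.+ n) → ℤ) →
    ∑ (signVecs (m ℕ.+ n)) f ≡ ∑ (signVecs m) (λ u → ∑ (signVecs n) (λ v → f (u Vec.++ v)))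
  ∑-signVecs-++ zero    n f = sym (ℤ.+-identityʳ _)
  ∑-signVecs-++ (suc m) n f =
    trans (∑-signVecs (m ℕ.+ n) f)
   (trans (∑-signVecs-++ m n _)
   (trans (∑-cong (signVecs m) (λ u → ∑-+ (signVecs n) _ _))
   (sym (∑-signVecs m _))))

  #signVecs : ℕ → ℤ
  #signVecs n = + length (signVecs n)

  #signVecs-suc : ∀ n → #signVecs (suc n) ≡ + 2 * #signVecs n
  #signVecs-suc n = length-× _∷_ signs (signVecs n)

  #signVecs-+ : ∀ m n → #signVecs (m ℕ.+ n) ≡ #signVecs m * #signVecs n
  #signVecs-+ zero    n = sym (ℤ.*-identityˡ _)
  #signVecs-+ (suc m) n = begin
    #signVecs (suc m ℕ.+ n)          ≡⟨ #signVecs-suc (m ℕ.+ n) ⟩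
    + 2 * #signVecs (m ℕ.+ n)        ≡⟨ cong (+ 2 *_) (#signVecs-+ m n) ⟩
    + 2 * (#signVecs m * #signVecs n) ≡⟨ sym (ℤ.*-assoc (+ 2) (#signVecs m) (#signVecs n)) ⟩
    (+ 2 * #signVecs m) * #signVecs n ≡⟨ cong (_* #signVecs n) (sym (#signVecs-suc m)) ⟩
    #signVecs (suc m) * #signVecs n  ∎
    where open ≡-Reasoning

  total : ∀ {n} → Vec Sign n → ℤ
  total []      = + 0
  total (s ∷ v) = (s ◃ 1) + total v

  total-++ : ∀ {m n} (u : Vec Sign m) (v : Vec Sign n) → total (u Vec.++ v) ≡ total u + total v
  total-++ []      v = sym (ℤ.+-identityˡ _)
  total-++ (s ∷ u) v = trans (cong (_+_ (s ◃ 1)) (total-++ u v)) (sym (ℤ.+-assoc (s ◃ 1) (total u) (total v)))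

  -- Even moments control only the two-sided tail. Symmetry halves it into the one-sided tail, which
  -- is the one that multiplies over blocks, because lower bounds for totals add up.
  ∑-symmetric : ∀ n (h : ℤ → ℤ) → ∑ (signVecs n) (λ u → h (total u)) ≡ ∑ (signVecs n) (λ u → h (- total u))
  ∑-symmetric zero    h = refl
  ∑-symmetric (suc n) h = begin
    ∑ (signVecs (suc n)) (λ u → h (total u))
      ≡⟨ ∑-signVecs n _ ⟩
    ∑ us (λ u → h (-[1+ 0 ] + total u) + h (+ 1 + total u))
      ≡⟨ ∑-symmetric n (λ t → h (-[1+ 0 ] + t) + h (+ 1 + t)) ⟩
    ∑ us (λ u → h (-[1+ 0 ] - total u) + h (+ 1 - total u))
      ≡⟨ ∑-cong us (λ u → trans (ℤ.+-comm (h (-[1+ 0 ] - total u)) (h (+ 1 - total u))) (cong₂ (λ s t → h s + h t) (eq₁ (total u)) (eq₂ (total u)))) ⟩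
    ∑ us (λ u → h (- (-[1+ 0 ] + total u)) + h (- (+ 1 + total u)))
      ≡⟨ sym (∑-signVecs n _) ⟩
    ∑ (signVecs (suc n)) (λ u → h (- total u)) ∎
    where
    open ≡-Reasoning
    us = signVecs n
    eq₁ : ∀ t → + 1 - t ≡ - (-[1+ 0 ] + t)
    eq₁ = solve-∀
    eq₂ : ∀ t → -[1+ 0 ] - t ≡ - (+ 1 + t)
    eq₂ = solve-∀

  secondMoment : ∀ n → ∑ (signVecs n) (λ u → total u * total u) ≡ + n * #signVecs n
  secondMoment zero    = refl
  secondMoment (suc n) = begin
    ∑ (signVecs (suc n)) (λ u → total u * total u)
      ≡⟨ ∑-signVecs n _ ⟩
    ∑ us (λ u → (-[1+ 0 ] + total u) * (-[1+ 0 ] + total u) + (+ 1 + total u) * (+ 1 + total u))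
      ≡⟨ ∑-cong us (λ u → eq (total u)) ⟩
    ∑ us (λ u → + 2 * (total u * total u) + + 2)
      ≡⟨ trans (∑-+ us _ _) (cong₂ _+_ (trans (∑-* us (+ 2) _) (cong (+ 2 *_) (secondMoment n))) (∑-const us (+ 2))) ⟩
    + 2 * (+ n * #signVecs n) + #signVecs n * + 2
      ≡⟨ eq′ (+ n) (#signVecs n) ⟩
    ℤ.suc (+ n) * (+ 2 * #signVecs n)
      ≡⟨ cong (+ suc n *_) (sym (#signVecs-suc n)) ⟩
    + suc n * #signVecs (suc n) ∎
    where
    open ≡-Reasoning
    us = signVecs n
    eq : ∀ t → (-[1+ 0 ] + t) * (-[1+ 0 ] + t) + (+ 1 + t) * (+ 1 + t) ≡ + 2 * (t * t) + + 2
    eq = solve-∀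
    eq′ : ∀ n p → + 2 * (n * p) + p * + 2 ≡ (+ 1 + n) * (+ 2 * p)
    eq′ = solve-∀

  -- Averaging (t ± 1)⁴ over the sign gives t⁴ + 6t² + 1, a recursion in n through the second
  -- moment.
  fourthMoment : ∀ n → ∑ (signVecs n) (λ u → (total u * total u) * (total u * total u))
    ≡ (+ 3 * (+ n * + n) - + 2 * + n) * #signVecs n
  fourthMoment zero    = refl
  fourthMoment (suc n) = begin
    ∑ (signVecs (suc n)) (λ u → (total u * total u) * (total u * total u))
      ≡⟨ ∑-signVecs n _ ⟩
    ∑ us (λ u → q (-[1+ 0 ] + total u) + q (+ 1 + total u))
      ≡⟨ ∑-cong us (λ u → eq (total u)) ⟩
    ∑ us (λ u → + 2 * q (total u) + (+ 12 * (total u * total u) + + 2))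
      ≡⟨ trans (∑-+ us _ _) (cong₂ _+_ (trans (∑-* us (+ 2) _) (cong (+ 2 *_) (fourthMoment n)))
           (trans (∑-+ us _ _) (cong₂ _+_ (trans (∑-* us (+ 12) _) (cong (+ 12 *_) (secondMoment n))) (∑-const us (+ 2))))) ⟩
    + 2 * ((+ 3 * (+ n * + n) - + 2 * + n) * #signVecs n) + (+ 12 * (+ n * #signVecs n) + #signVecs n * + 2)
      ≡⟨ eq′ (+ n) (#signVecs n) ⟩
    (+ 3 * (ℤ.suc (+ n) * ℤ.suc (+ n)) - + 2 * ℤ.suc (+ n)) * (+ 2 * #signVecs n)
      ≡⟨ cong ((+ 3 * (+ suc n * + suc n) - + 2 * + suc n) *_) (sym (#signVecs-suc n)) ⟩
    (+ 3 * (+ suc n * + suc n) - + 2 * + suc n) * #signVecs (suc n) ∎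
    where
    open ≡-Reasoning
    us = signVecs n
    q : ℤ → ℤ
    q t = (t * t) * (t * t)
    eq : ∀ t → ((-[1+ 0 ] + t) * (-[1+ 0 ] + t)) * ((-[1+ 0 ] + t) * (-[1+ 0 ] + t))
             + ((+ 1 + t) * (+ 1 + t)) * ((+ 1 + t) * (+ 1 + t))
             ≡ + 2 * ((t * t) * (t * t)) + (+ 12 * (t * t) + + 2)
    eq = solve-∀
    eq′ : ∀ n p → + 2 * ((+ 3 * (n * n) - + 2 * n) * p) + (+ 12 * (n * p) + p * + 2)
      ≡ (+ 3 * ((+ 1 + n) * (+ 1 + n)) - + 2 * (+ 1 + n)) * (+ 2 * p)
    eq′ = solve-∀

  𝟙 : {P : Set} → Dec P → ℤ
  𝟙 (yes _) = + 1
  𝟙 (no _)  = + 0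

  0≤𝟙 : {P : Set} (d : Dec P) → + 0 ≤ 𝟙 d
  0≤𝟙 (yes _) = ℤ.+≤+ ℕ.z≤n
  0≤𝟙 (no _)  = ℤ.+≤+ ℕ.z≤n

  tail : ∀ n → ℤ → ℤ
  tail n τ = ∑ (signVecs n) (λ u → 𝟙 (τ ℤ.≤? total u))

  0≤∑ : ∀ {A : Set} (xs : List A) {f} → (∀ x → + 0 ≤ f x) → + 0 ≤ ∑ xs f
  0≤∑ []       0≤f = ℤ.≤-refl
  0≤∑ (x ∷ xs) 0≤f = ℤ.+-mono-≤ (0≤f x) (0≤∑ xs 0≤f)

  0≤tail : ∀ n τ → + 0 ≤ tail n τ
  0≤tail n τ = 0≤∑ (signVecs n) (λ u → 0≤𝟙 (τ ℤ.≤? total u))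

  tail-+ : ∀ m n σ τ → tail m σ * tail n τ ≤ tail (m ℕ.+ n) (σ + τ)
  tail-+ m n σ τ = begin
    tail m σ * tail n τ
      ≡⟨ ℤ.*-comm (tail m σ) (tail n τ) ⟩
    tail n τ * tail m σ
      ≡⟨ sym (∑-* (signVecs m) (tail n τ) _) ⟩
    ∑ (signVecs m) (λ u → tail n τ * 𝟙 (σ ℤ.≤? total u))
      ≡⟨ ∑-cong (signVecs m) (λ u → trans (ℤ.*-comm (tail n τ) _) (sym (∑-* (signVecs n) (𝟙 (σ ℤ.≤? total u)) _))) ⟩
    ∑ (signVecs m) (λ u → ∑ (signVecs n) (λ v → 𝟙 (σ ℤ.≤? total u) * 𝟙 (τ ℤ.≤? total v)))
      ≤⟨ ∑-mono (signVecs m) (λ u → ∑-mono (signVecs n) (λ v → pointwise u v)) ⟩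
    ∑ (signVecs m) (λ u → ∑ (signVecs n) (λ v → 𝟙 (σ + τ ℤ.≤? total (u Vec.++ v))))
      ≡⟨ sym (∑-signVecs-++ m n _) ⟩
    tail (m ℕ.+ n) (σ + τ) ∎
    where
    open ℤ.≤-Reasoning
    pointwise : ∀ (u : Vec Sign m) (v : Vec Sign n) →
      𝟙 (σ ℤ.≤? total u) * 𝟙 (τ ℤ.≤? total v) ≤ 𝟙 (σ + τ ℤ.≤? total (u Vec.++ v))
    pointwise u v with σ ℤ.≤? total u | τ ℤ.≤? total v | σ + τ ℤ.≤? total (u Vec.++ v)
    ... | yes p | yes q | yes r = ℤ.≤-refl
    ... | yes p | yes q | no ¬r = contradiction (subst (σ + τ ≤_) (sym (total-++ u v)) (ℤ.+-mono-≤ p q)) ¬r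
    ... | yes p | no _  | d     = 0≤𝟙 d
    ... | no _  | _     | d     = 0≤𝟙 d

  module _ (ℓ : ℕ) (1≤ℓ : 1 ℕ.≤ ℓ) where
    private
      l = + ℓ
      -- A total of this length has standard deviation 2ℓ, so the threshold ℓ is half a standard
      -- deviation and everything stays an integer.
      N = 4 ℕ.* (ℓ ℕ.* ℓ)
      us = signVecs N
      P = #signVecs N

      +N : + N ≡ + 4 * (l * l)
      +N = trans (ℤ.pos-* 4 (ℓ ℕ.* ℓ)) (cong (+ 4 *_) (ℤ.pos-* ℓ ℓ))

      0≤l⁴ : + 0 ≤ (l * l) * (l * l)
      0≤l⁴ = 0≤i² (l * l)

      -- The left-hand side is negative for |t| < ℓ and has maximum 144 ℓ⁴.  Its mean needs only the
      -- second and fourth moments, as in the Paley–Zygmund inequality.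
      minorant : ∀ t → (t * t - l * l) * (+ 25 * (l * l) - t * t)
        ≤ + 144 * ((l * l) * (l * l)) * (𝟙 (l ℤ.≤? t) + 𝟙 (l ℤ.≤? - t))
      minorant t with l ℤ.≤? t | l ℤ.≤? - t
      -- Here |t| < ℓ, so ℓ² - t² ≥ 0, and 25ℓ² - t² is written as 24ℓ² plus the same quantity.
      ... | no p | no q = ≤-by ((l - t) * (l + t) * (+ 24 * (l * l) + (l - t) * (l + t)))
              (0≤* 0≤d (ℤ.+-mono-≤ (0≤* {+ 24} (ℤ.+≤+ ℕ.z≤n) (0≤i² l)) 0≤d)) (eq t l)
        where
        0≤d : + 0 ≤ (l - t) * (l + t)
        0≤d = 0≤* (ℤ.i≤j⇒0≤j-i (ℤ.<⇒≤ (ℤ.≰⇒> p)))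
                  (subst (λ s → + 0 ≤ l + s) (ℤ.neg-involutive t) (ℤ.i≤j⇒0≤j-i (ℤ.<⇒≤ (ℤ.≰⇒> q))))
        eq : ∀ t l → (t * t - l * l) * (+ 25 * (l * l) - t * t) + (l - t) * (l + t) * (+ 24 * (l * l) + (l - t) * (l + t))
          ≡ + 144 * ((l * l) * (l * l)) * (+ 0 + + 0)
        eq = solve-∀
      -- Completing the square: 144ℓ⁴ minus the left-hand side is (t² - 13ℓ²)², where 13 is the
      -- midpoint and 12 half the distance of the roots 1 and 25.
      ... | yes _ | no _ = ≤-by ((t * t - + 13 * (l * l)) * (t * t - + 13 * (l * l))) (0≤i² (t * t - + 13 * (l * l))) (eq t l)
        where
        eq : ∀ t l → (t * t - l * l) * (+ 25 * (l * l) - t * t) + (t * t - + 13 * (l * l)) * (t * t - + 13 * (l * l))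
          ≡ + 144 * ((l * l) * (l * l)) * (+ 1 + + 0)
        eq = solve-∀
      ... | no _ | yes _ = ≤-by ((t * t - + 13 * (l * l)) * (t * t - + 13 * (l * l))) (0≤i² (t * t - + 13 * (l * l))) (eq t l)
        where
        eq : ∀ t l → (t * t - l * l) * (+ 25 * (l * l) - t * t) + (t * t - + 13 * (l * l)) * (t * t - + 13 * (l * l))
          ≡ + 144 * ((l * l) * (l * l)) * (+ 0 + + 1)
        eq = solve-∀
      ... | yes _ | yes _ = ≤-by ((t * t - + 13 * (l * l)) * (t * t - + 13 * (l * l)) + + 144 * ((l * l) * (l * l)))
              (ℤ.+-mono-≤ (0≤i² (t * t - + 13 * (l * l))) (0≤* {+ 144} (ℤ.+≤+ ℕ.z≤n) 0≤l⁴)) (eq t l)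
        where
        eq : ∀ t l → (t * t - l * l) * (+ 25 * (l * l) - t * t)
          + ((t * t - + 13 * (l * l)) * (t * t - + 13 * (l * l)) + + 144 * ((l * l) * (l * l)))
          ≡ + 144 * ((l * l) * (l * l)) * (+ 1 + + 1)
        eq = solve-∀

      minorant-sum : ∑ us (λ u → (total u * total u - l * l) * (+ 25 * (l * l) - total u * total u))
        ≡ (+ 31 * ((l * l) * (l * l)) + + 8 * (l * l)) * P
      minorant-sum = begin
        ∑ us (λ u → (total u * total u - l * l) * (+ 25 * (l * l) - total u * total u))
          ≡⟨ ∑-cong us (λ u → expand (total u * total u) (l * l)) ⟩
        ∑ us (λ u → (+ 26 * (l * l)) * (total u * total u) + (- + 1 * ((total u * total u) * (total u * total u)) + - + 25 * ((l * l) * (l * l))))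
          ≡⟨ trans (∑-+ us _ _) (cong₂ _+_ (trans (∑-* us (+ 26 * (l * l)) _) (cong (+ 26 * (l * l) *_) (secondMoment N)))
               (trans (∑-+ us _ _) (cong₂ _+_ (trans (∑-* us (- + 1) _) (cong (- + 1 *_) (fourthMoment N))) (∑-const us _)))) ⟩
        + 26 * (l * l) * (+ N * P) + (- + 1 * ((+ 3 * (+ N * + N) - + 2 * + N) * P) + P * (- + 25 * ((l * l) * (l * l))))
          ≡⟨ cong (λ n → + 26 * (l * l) * (n * P) + (- + 1 * ((+ 3 * (n * n) - + 2 * n) * P) + P * (- + 25 * ((l * l) * (l * l))))) +N ⟩
        + 26 * (l * l) * (+ 4 * (l * l) * P) + (- + 1 * ((+ 3 * (+ 4 * (l * l) * (+ 4 * (l * l))) - + 2 * (+ 4 * (l * l))) * P) + P * (- + 25 * ((l * l) * (l * l))))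
          ≡⟨ collect (l * l) P ⟩
        (+ 31 * ((l * l) * (l * l)) + + 8 * (l * l)) * P ∎
        where
        open ≡-Reasoning
        expand : ∀ s m → (s - m) * (+ 25 * m - s) ≡ (+ 26 * m) * s + (- + 1 * (s * s) + - + 25 * (m * m))
        expand = solve-∀
        collect : ∀ m p → + 26 * m * (+ 4 * m * p) + (- + 1 * ((+ 3 * (+ 4 * m * (+ 4 * m)) - + 2 * (+ 4 * m)) * p) + p * (- + 25 * (m * m)))
          ≡ (+ 31 * (m * m) + + 8 * m) * p
        collect = solve-∀

    -- The mean of the minorant is at least 31ℓ⁴, so the two-sided tail has probability at least
    -- 31/144 and each side at least 31/288. This is weakened to 18/288 = 1/16, a power of 2, so
    -- that numbers of windows can later be compared through exponents.
    tail-lowerBound : P ≤ + 16 * tail N l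
    tail-lowerBound = ℤ.*-cancelˡ-≤-pos _ _ ((+ 18 * ((l * l) * (l * l)))) {{positive ℓ 1≤ℓ}} (begin
      + 18 * ((l * l) * (l * l)) * P
        ≤⟨ ≤-by ((+ 13 * ((l * l) * (l * l)) + + 8 * (l * l)) * P)
             (0≤* (ℤ.+-mono-≤ (0≤* {+ 13} (ℤ.+≤+ ℕ.z≤n) 0≤l⁴) (0≤* {+ 8} (ℤ.+≤+ ℕ.z≤n) (0≤i² l))) (ℤ.+≤+ ℕ.z≤n)) (eq (l * l) P) ⟩
      (+ 31 * ((l * l) * (l * l)) + + 8 * (l * l)) * P
        ≡⟨ sym minorant-sum ⟩
      ∑ us (λ u → (total u * total u - l * l) * (+ 25 * (l * l) - total u * total u))
        ≤⟨ ∑-mono us (λ u → minorant (total u)) ⟩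
      ∑ us (λ u → + 144 * ((l * l) * (l * l)) * (𝟙 (l ℤ.≤? total u) + 𝟙 (l ℤ.≤? - total u)))
        ≡⟨ trans (∑-* us (+ 144 * ((l * l) * (l * l))) _) (cong (+ 144 * ((l * l) * (l * l)) *_) (trans (∑-+ us _ _)
             (cong (_+_ (tail N l)) (sym (∑-symmetric N (λ t → 𝟙 (l ℤ.≤? t))))))) ⟩
      + 144 * ((l * l) * (l * l)) * (tail N l + tail N l)
        ≡⟨ eq′ ((l * l) * (l * l)) (tail N l) ⟩
      + 18 * ((l * l) * (l * l)) * (+ 16 * tail N l) ∎)
      where
      open ℤ.≤-Reasoning
      positive : ∀ m → 1 ℕ.≤ m → ℤ.Positive (+ 18 * ((+ m * + m) * (+ m * + m)))
      positive (suc _) _ = _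
      eq : ∀ m p → + 18 * (m * m) * p + (+ 13 * (m * m) + + 8 * m) * p ≡ (+ 31 * (m * m) + + 8 * m) * p
      eq = solve-∀
      eq′ : ∀ m t → + 144 * m * (t + t) ≡ + 18 * m * (+ 16 * t)
      eq′ = solve-∀

    -- It suffices that each of T blocks of length 4ℓ² has total at least ℓ.
    blocks-lowerBound : ∀ T → #signVecs (T ℕ.* N) ≤ + (16 ℕ.^ T) * tail (T ℕ.* N) (+ (T ℕ.* ℓ))
    blocks-lowerBound zero    = ℤ.≤-refl
    blocks-lowerBound (suc T) = begin
      #signVecs (N ℕ.+ T ℕ.* N)
        ≡⟨ #signVecs-+ N (T ℕ.* N) ⟩
      P * #signVecs (T ℕ.* N)
        ≤⟨ *-mono-≤ {P} (ℤ.+≤+ ℕ.z≤n) (ℤ.+≤+ ℕ.z≤n) tail-lowerBound (blocks-lowerBound T) ⟩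
      + 16 * tail N l * (+ (16 ℕ.^ T) * tail (T ℕ.* N) (+ (T ℕ.* ℓ)))
        ≡⟨ eq (tail N l) (+ (16 ℕ.^ T)) _ ⟩
      (+ 16 * + (16 ℕ.^ T)) * (tail N l * tail (T ℕ.* N) (+ (T ℕ.* ℓ)))
        ≡⟨ cong (_* (tail N l * tail (T ℕ.* N) (+ (T ℕ.* ℓ)))) (sym (ℤ.pos-* 16 (16 ℕ.^ T))) ⟩
      + (16 ℕ.^ suc T) * (tail N l * tail (T ℕ.* N) (+ (T ℕ.* ℓ)))
        ≤⟨ ℤ.*-monoˡ-≤-nonNeg (+ (16 ℕ.^ suc T)) (tail-+ N (T ℕ.* N) l (+ (T ℕ.* ℓ))) ⟩
      + (16 ℕ.^ suc T) * tail (N ℕ.+ T ℕ.* N) (l + + (T ℕ.* ℓ)) ∎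
      where
      open ℤ.≤-Reasoning
      eq : ∀ a b c → + 16 * a * (b * c) ≡ (+ 16 * b) * (a * c)
      eq = solve-∀

-- The effect of one sign on Φ

module Correlations where
  open import Data.Nat.Base using (_+_; _*_; _≤_)
  open import Data.Integer.Base using (∣_∣)
  open ℤ-Solver using (solve-∀)
  open import Algebra.Properties.CommutativeSemigroup ℕ.+-commutativeSemigroup using (interchange)
  open Sums

  Σ< : ℕ → (ℕ → ℕ) → ℕ
  Σ< zero    f = 0
  Σ< (suc n) f = f 0 + Σ< n (λ i → f (suc i))

  Σ<-mono : ∀ n {f g : ℕ → ℕ} → (∀ i → f i ≤ g i) → Σ< n f ≤ Σ< n g
  Σ<-mono zero    f≤g = z≤n
  Σ<-mono (suc n) f≤g = ℕ.+-mono-≤ (f≤g 0) (Σ<-mono n (λ i → f≤g (suc i)))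

  Σ<-+ : ∀ n f g → Σ< n (λ i → f i + g i) ≡ Σ< n f + Σ< n g
  Σ<-+ zero    f g = refl
  Σ<-+ (suc n) f g = trans (cong (ℕ._+_ (f 0 + g 0)) (Σ<-+ n _ _)) (interchange (f 0) (g 0) _ _)

  Σ<-zero : ∀ n {f : ℕ → ℕ} → (∀ i → f i ≡ 0) → Σ< n f ≡ 0
  Σ<-zero zero    f≡0 = refl
  Σ<-zero (suc n) f≡0 = cong₂ _+_ (f≡0 0) (Σ<-zero n (λ i → f≡0 (suc i)))

  foldr-map : ∀ {A : Set} (xs : List A) (f : A → ℤ) → List.foldr ℤ._+_ (+ 0) (map f xs) ≡ ∑ xs f
  foldr-map []       f = refl
  foldr-map (x ∷ xs) f = cong (ℤ._+_ (f x)) (foldr-map xs f)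

  ∣∑-∑∣≤ : ∀ (h : ℕ → ℕ) n (f g : ℕ → ℤ) →
    ∣ ∑ (applyUpTo h n) f ℤ.- ∑ (applyUpTo h n) g ∣ ≤ Σ< n (λ i → ∣ f (h i) ℤ.- g (h i) ∣)
  ∣∑-∑∣≤ h zero    f g = z≤n
  ∣∑-∑∣≤ h (suc n) f g = begin
    ∣ (f (h 0) ℤ.+ F) ℤ.- (g (h 0) ℤ.+ G) ∣   ≡⟨ cong ∣_∣ (eq (f (h 0)) F (g (h 0)) G) ⟩
    ∣ (f (h 0) ℤ.- g (h 0)) ℤ.+ (F ℤ.- G) ∣   ≤⟨ ℤ.∣i+j∣≤∣i∣+∣j∣ (f (h 0) ℤ.- g (h 0)) (F ℤ.- G) ⟩
    ∣ f (h 0) ℤ.- g (h 0) ∣ + ∣ F ℤ.- G ∣      ≤⟨ ℕ.+-monoʳ-≤ _ (∣∑-∑∣≤ (λ i → h (suc i)) n f g) ⟩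
    _                                           ∎
    where
    open ℕ.≤-Reasoning
    F = ∑ (applyUpTo (λ i → h (suc i)) n) f
    G = ∑ (applyUpTo (λ i → h (suc i)) n) g
    eq : ∀ a b c d → (a ℤ.+ b) ℤ.- (c ℤ.+ d) ≡ (a ℤ.- c) ℤ.+ (b ℤ.- d)
    eq = solve-∀

  term : ∀ {N S k} → Family N S → Params S k → ℕ → ℤ
  term e ps n = Vec.foldr′ ℤ._*_ (+ 1) (Vec.map (λ (d , s) → entry (lookup e s) (n ℕ.+ d)) ps)

  correlation-∑ : ∀ {N S k} (e : Family N S) M (ps : Params S k) → correlation e M ps ≡ ∑ (upTo M) (term e ps)
  correlation-∑ e M ps = foldr-map (upTo M) _

  ∣entry∣≤1 : ∀ {N} (v : Vec Sign N) n → ∣ entry v n ∣ ≤ 1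
  ∣entry∣≤1 []      n       = z≤n
  ∣entry∣≤1 (s ∷ v) zero    = ℕ.≤-reflexive (ℤ.abs-◃ s 1)
  ∣entry∣≤1 (s ∷ v) (suc n) = ∣entry∣≤1 v n

  ∣term∣≤1 : ∀ {N S k} (e : Family N S) (ps : Params S k) n → ∣ term e ps n ∣ ≤ 1
  ∣term∣≤1 e []             n = ℕ.≤-refl
  ∣term∣≤1 e ((d , s) ∷ ps) n = subst (_≤ 1) (sym (ℤ.abs-* (entry (lookup e s) (n + d)) (term e ps n)))
    (ℕ.*-mono-≤ (∣entry∣≤1 (lookup e s) (n + d)) (∣term∣≤1 e ps n))

  -- Exchanging the factors of a product one at a time turns a change of the product into a sum of
  -- changes of its factors.
  ∣ab-cd∣≤ : ∀ a b c d → ∣ b ∣ ≤ 1 → ∣ c ∣ ≤ 1 → ∣ a ℤ.* b ℤ.- c ℤ.* d ∣ ≤ ∣ a ℤ.- c ∣ + ∣ b ℤ.- d ∣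
  ∣ab-cd∣≤ a b c d ∣b∣≤1 ∣c∣≤1 = begin
    ∣ a ℤ.* b ℤ.- c ℤ.* d ∣                            ≡⟨ cong ∣_∣ (eq a b c d) ⟩
    ∣ (a ℤ.- c) ℤ.* b ℤ.+ c ℤ.* (b ℤ.- d) ∣            ≤⟨ ℤ.∣i+j∣≤∣i∣+∣j∣ ((a ℤ.- c) ℤ.* b) (c ℤ.* (b ℤ.- d)) ⟩
    ∣ (a ℤ.- c) ℤ.* b ∣ + ∣ c ℤ.* (b ℤ.- d) ∣          ≡⟨ cong₂ _+_ (ℤ.abs-* (a ℤ.- c) b) (ℤ.abs-* c (b ℤ.- d)) ⟩
    ∣ a ℤ.- c ∣ * ∣ b ∣ + ∣ c ∣ * ∣ b ℤ.- d ∣          ≤⟨ ℕ.+-mono-≤ (ℕ.*-monoʳ-≤ ∣ a ℤ.- c ∣ ∣b∣≤1) (ℕ.*-monoˡ-≤ ∣ b ℤ.- d ∣ ∣c∣≤1) ⟩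
    ∣ a ℤ.- c ∣ * 1 + 1 * ∣ b ℤ.- d ∣                  ≡⟨ cong₂ _+_ (ℕ.*-identityʳ ∣ a ℤ.- c ∣) (ℕ.*-identityˡ ∣ b ℤ.- d ∣) ⟩
    ∣ a ℤ.- c ∣ + ∣ b ℤ.- d ∣                          ∎
    where
    open ℕ.≤-Reasoning
    eq : ∀ a b c d → a ℤ.* b ℤ.- c ℤ.* d ≡ (a ℤ.- c) ℤ.* b ℤ.+ c ℤ.* (b ℤ.- d)
    eq = solve-∀

  entryGap : ∀ {N} → Vec Sign N → Vec Sign N → ℕ → ℕ
  entryGap u v n = ∣ entry u n ℤ.- entry v n ∣

  entryGap-refl : ∀ {N} (u : Vec Sign N) n → entryGap u u n ≡ 0
  entryGap-refl u n = cong ∣_∣ (ℤ.+-inverseʳ (entry u n))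

  entryGap≤2 : ∀ {N} (u v : Vec Sign N) n → entryGap u v n ≤ 2
  entryGap≤2 u v n = ℕ.≤-trans (ℤ.∣i-j∣≤∣i∣+∣j∣ (entry u n) (entry v n)) (ℕ.+-mono-≤ (∣entry∣≤1 u n) (∣entry∣≤1 v n))

  -- The index n + d meets the altered position for at most one n, and there the entry changes by at
  -- most 2.
  Σ<-entryGap : ∀ {N} {u v : Vec Sign N} → Neighbour Any² u v → ∀ M d → Σ< M (λ n → entryGap u v (n + d)) ≤ 2
  Σ<-entryGap u~v zero d = z≤n
  Σ<-entryGap {v = v} (here {x = s} {y = t} {u = u} s~t) (suc M) zero =
    ℕ.≤-trans (ℕ.+-mono-≤ (entryGap≤2 (s ∷ u) (t ∷ u) 0) (ℕ.≤-reflexive (Σ<-zero M (λ n → entryGap-refl u (n + 0)))))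
              (ℕ.≤-refl)
  Σ<-entryGap (there {x = s} {u} {v} u~v) (suc M) zero =
    subst (λ g → g + Σ< M (λ n → entryGap u v (n + 0)) ≤ 2) (sym (entryGap-refl (s ∷ u) 0)) (Σ<-entryGap u~v M zero)
  Σ<-entryGap {u = s ∷ u} {t ∷ v} u~v M@(suc _) (suc d) =
    ℕ.≤-trans (Σ<-mono M (λ n → ℕ.≤-reflexive (cong (entryGap (s ∷ u) (t ∷ v)) (ℕ.+-suc n d)))) (tails u~v)
    where
    tails : Neighbour Any² (s ∷ u) (t ∷ v) → Σ< M (λ n → entryGap u v (n + d)) ≤ 2
    tails (here _)    = ℕ.≤-trans (ℕ.≤-reflexive (Σ<-zero M (λ n → entryGap-refl u (n + d)))) z≤n
    tails (there u~v) = Σ<-entryGap u~v M d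

  Neighbours : ∀ {N S} → Family N S → Family N S → Set
  Neighbours = Neighbour (Neighbour Any²)

  Σ<-entryGap-lookup : ∀ {N S} {e f : Family N S} → Neighbours e f → ∀ s M d →
    Σ< M (λ n → entryGap (lookup e s) (lookup f s) (n + d)) ≤ 2
  Σ<-entryGap-lookup (here u~v)          zero    M d = Σ<-entryGap u~v M d
  Σ<-entryGap-lookup (here {u = e} u~v)  (suc s) M d =
    ℕ.≤-trans (ℕ.≤-reflexive (Σ<-zero M (λ n → entryGap-refl (lookup e s) (n + d)))) z≤n
  Σ<-entryGap-lookup (there {x = u} e~f) zero    M d =
    ℕ.≤-trans (ℕ.≤-reflexive (Σ<-zero M (λ n → entryGap-refl u (n + d)))) z≤n
  Σ<-entryGap-lookup (there e~f)         (suc s) M d = Σ<-entryGap-lookup e~f s M d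

  -- Each of the k factors is responsible for a change of at most 2 in the whole sum over n,
  -- whatever M is; this is the origin of the Lipschitz constant 2k.
  Σ<-termGap : ∀ {N S k} {e f : Family N S} → Neighbours e f → ∀ (ps : Params S k) M →
    Σ< M (λ n → ∣ term e ps n ℤ.- term f ps n ∣) ≤ k * 2
  Σ<-termGap e~f [] M = ℕ.≤-reflexive (Σ<-zero M (λ _ → refl))
  Σ<-termGap {k = suc k} {e} {f} e~f ((d , s) ∷ ps) M = begin
    Σ< M (λ n → ∣ term e ((d , s) ∷ ps) n ℤ.- term f ((d , s) ∷ ps) n ∣)
      ≤⟨ Σ<-mono M (λ n → ∣ab-cd∣≤ (entry (lookup e s) (n + d)) (term e ps n) (entry (lookup f s) (n + d)) (term f ps n)
           (∣term∣≤1 e ps n) (∣entry∣≤1 (lookup f s) (n + d))) ⟩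
    Σ< M (λ n → entryGap (lookup e s) (lookup f s) (n + d) + ∣ term e ps n ℤ.- term f ps n ∣)
      ≡⟨ Σ<-+ M _ _ ⟩
    Σ< M (λ n → entryGap (lookup e s) (lookup f s) (n + d)) + Σ< M (λ n → ∣ term e ps n ℤ.- term f ps n ∣)
      ≤⟨ ℕ.+-mono-≤ (Σ<-entryGap-lookup e~f s M d) (Σ<-termGap e~f ps M) ⟩
    2 + k * 2 ∎
    where open ℕ.≤-Reasoning

  ∣i∣≤∣j∣+∣i-j∣ : ∀ i j → ∣ i ∣ ≤ ∣ j ∣ + ∣ i ℤ.- j ∣
  ∣i∣≤∣j∣+∣i-j∣ i j = subst (λ h → ∣ h ∣ ≤ ∣ j ∣ + ∣ i ℤ.- j ∣) (eq i j) (ℤ.∣i+j∣≤∣i∣+∣j∣ j (i ℤ.- j))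
    where
    eq : ∀ i j → j ℤ.+ (i ℤ.- j) ≡ i
    eq = solve-∀

  ∣correlation∣-Lipschitz : ∀ {N S k} {e f : Family N S} → Neighbours e f → ∀ M (ps : Params S k) →
    ∣ correlation e M ps ∣ ≤ ∣ correlation f M ps ∣ + k * 2
  ∣correlation∣-Lipschitz {e = e} {f} e~f M ps = ℕ.≤-trans (∣i∣≤∣j∣+∣i-j∣ (correlation e M ps) (correlation f M ps))
    (ℕ.+-monoʳ-≤ _ (ℕ.≤-trans
      (subst₂ (λ i j → ∣ i ℤ.- j ∣ ≤ Σ< M (λ n → ∣ term e ps n ℤ.- term f ps n ∣))
        (sym (correlation-∑ e M ps)) (sym (correlation-∑ f M ps)) (∣∑-∑∣≤ (λ i → i) M (term e ps) (term f ps)))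
      (Σ<-termGap e~f ps M)))

  max-map-≤ : ∀ {A : Set} {f g : A → ℕ} c → (∀ x → f x ≤ g x + c) → ∀ xs → max 0 (map f xs) ≤ max 0 (map g xs) + c
  max-map-≤ {f = f} {g} c f≤g xs = max≤v⁺ z≤n (ListAll.map⁺ (ListAll.map (λ {x} gx≤ → ℕ.≤-trans (f≤g x) (ℕ.+-monoˡ-≤ c gx≤))
    (ListAll.map⁻ (xs≤max 0 (map g xs)))))

  admissibles : ∀ N S k → List (ℕ × Params S k)
  admissibles N S k = filter (λ (M , ps) → admissible? N M ps)
    (cartesianProduct (upTo (suc N)) (vecsOver (cartesianProduct (upTo N) (allFin S)) k))

  Φ-Lipschitz : ∀ {N S} k {e f : Family N S} → Neighbours e f → Φ k e ≤ Φ k f + k * 2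
  Φ-Lipschitz {N} {S} k {e} {f} e~f = max-map-≤ {f = λ (M , ps) → ∣ correlation e M ps ∣} {λ (M , ps) → ∣ correlation f M ps ∣}
    (k * 2) (λ (M , ps) → ∣correlation∣-Lipschitz e~f M ps) (admissibles N S k)

  ∈-vecsOver : ∀ {A : Set} {xs : List A} {n} {v : Vec A n} → All (_∈ xs) v → v ∈ vecsOver xs n
  ∈-vecsOver []         = Any.here refl
  ∈-vecsOver (x∈ ∷ v∈) = ∈-cartesianProductWith⁺ _∷_ x∈ (∈-vecsOver v∈)

  ∣correlation∣≤Φ : ∀ {N S} k (e : Family N S) M (ps : Params S k) → Admissible N M ps → M ≤ N →
    ∣ correlation e M ps ∣ ≤ Φ k e
  ∣correlation∣≤Φ {N} {S} k e M ps adm@(0<M , _ , M+d≤N) M≤N =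
    ListAll.lookup (xs≤max 0 _) (∈-map⁺ (λ (M , ps) → ∣ correlation e M ps ∣)
      (∈-filter⁺ (λ (M , ps) → admissible? N M ps)
        (∈-cartesianProduct⁺ (∈-upTo⁺ (s≤s M≤N))
          (∈-vecsOver (All.map (λ {(d , s)} M+d≤N → ∈-cartesianProduct⁺ (∈-upTo⁺ (ℕ.≤-trans (ℕ.+-monoˡ-≤ d 0<M) M+d≤N)) (∈-allFin s)) M+d≤N)))
        adm))

-- Product sequences of one sign sequence and their joint surjectivity

module Windows where
  open import Data.Nat.Base using (_+_; _∸_; _≤_; _<_)
  open import Data.Integer.Base using (∣_∣; _◃_)
  open import Data.Sign.Base using (_*_)
  open import Algebra.Properties.CommutativeSemigroup Sign.*-commutativeSemigroup using (interchange)
  open Sums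
  open Tails
  open Correlations

  private variable
    k M N R : ℕ

  -- The counterpart of `entry` with values in the group of signs. The default is the unit of this
  -- group, so that `at-zipWith` holds at every index.
  at : Vec Sign N → ℕ → Sign
  at []      n       = Sign.+
  at (s ∷ v) zero    = s
  at (s ∷ v) (suc n) = at v n

  at-zipWith : ∀ (u v : Vec Sign N) n → at (zipWith _*_ u v) n ≡ at u n * at v n
  at-zipWith []      []      n       = refl
  at-zipWith (s ∷ u) (t ∷ v) zero    = refl
  at-zipWith (s ∷ u) (t ∷ v) (suc n) = at-zipWith u v n

  entry-at : ∀ (v : Vec Sign N) {n} → n < N → entry v n ≡ at v n ◃ 1
  entry-at (s ∷ v) {zero}  n<N       = refl
  entry-at (s ∷ v) {suc n} (s≤s n<N) = entry-at v n<N

  prefix : ∀ n → (ℕ → Sign) → Vec Sign n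
  prefix zero    b = []
  prefix (suc n) b = b 0 ∷ prefix n (λ i → b (suc i))

  at-prefix : ∀ {n i} b → i < n → at (prefix n b) i ≡ b i
  at-prefix {suc n} {zero}  b i<n       = refl
  at-prefix {suc n} {suc i} b (s≤s i<n) = at-prefix (λ i → b (suc i)) i<n

  prefix-cong : ∀ n {b c : ℕ → Sign} → (∀ i → i < n → b i ≡ c i) → prefix n b ≡ prefix n c
  prefix-cong zero    b≡c = refl
  prefix-cong (suc n) b≡c = cong₂ _∷_ (b≡c 0 (s≤s z≤n)) (prefix-cong n (λ i i<n → b≡c (suc i) (s≤s i<n)))

  prefix-at : ∀ (v : Vec Sign N) → prefix N (at v) ≡ v
  prefix-at []      = refl
  prefix-at (s ∷ v) = cong (s ∷_) (prefix-at v)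

  prefix-* : ∀ n (b c : ℕ → Sign) → prefix n (λ i → b i * c i) ≡ zipWith _*_ (prefix n b) (prefix n c)
  prefix-* zero    b c = refl
  prefix-* (suc n) b c = cong (b 0 * c 0 ∷_) (prefix-* n _ _)

  ∑-prefix : ∀ n (h : ℕ → ℕ) (f : ℕ → ℤ) (b : ℕ → Sign) → (∀ i → i < n → f (h i) ≡ b i ◃ 1) →
    ∑ (applyUpTo h n) f ≡ total (prefix n b)
  ∑-prefix zero    h f b f≡b = refl
  ∑-prefix (suc n) h f b f≡b = cong₂ ℤ._+_ (f≡b 0 (s≤s z≤n))
    (∑-prefix n (λ i → h (suc i)) f (λ i → b (suc i)) (λ i i<n → f≡b (suc i) (s≤s i<n)))

  ∏ : (ℕ → Sign) → ℕ → Vec ℕ k → Sign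
  ∏ b n []       = Sign.+
  ∏ b n (d ∷ ds) = b (n + d) * ∏ b n ds

  ∏-* : ∀ b c n (ds : Vec ℕ k) → ∏ (λ i → b i * c i) n ds ≡ ∏ b n ds * ∏ c n ds
  ∏-* b c n []       = refl
  ∏-* b c n (d ∷ ds) = trans (cong (b (n + d) * c (n + d) *_) (∏-* b c n ds)) (interchange (b (n + d)) (c (n + d)) _ _)

  ∏-cong : ∀ (b c : ℕ → Sign) n {ds : Vec ℕ k} → All (λ d → b (n + d) ≡ c (n + d)) ds → ∏ b n ds ≡ ∏ c n ds
  ∏-cong b c n []       = refl
  ∏-cong b c n (p ∷ ps) = cong₂ _*_ p (∏-cong b c n ps)

  ∏-++ : ∀ {l} b n (ds : Vec ℕ k) (cs : Vec ℕ l) → ∏ b n (ds Vec.++ cs) ≡ ∏ b n ds * ∏ b n cs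
  ∏-++ b n []       cs = refl
  ∏-++ b n (d ∷ ds) cs = trans (cong (b (n + d) *_) (∏-++ b n ds cs)) (sym (Sign.*-assoc (b (n + d)) (∏ b n ds) (∏ b n cs)))

  cancelʳ : ∀ s t → (s * t) * t ≡ s
  cancelʳ s t = trans (Sign.*-assoc s t t) (trans (cong (s *_) (Sign.s*s≡+ t)) (Sign.*-identityʳ s))

  private
    infixr 5 _∷ₛ_
    _∷ₛ_ : Sign → (ℕ → Sign) → ℕ → Sign
    (x ∷ₛ b) zero    = x
    (x ∷ₛ b) (suc i) = b i

    ∏-∷ₛ : ∀ x b n (cs : Vec ℕ k) → ∏ (x ∷ₛ b) n (Vec.map suc cs) ≡ ∏ b n cs
    ∏-∷ₛ x b n []       = refl
    ∏-∷ₛ x b n (c ∷ cs) = cong₂ _*_ (cong (x ∷ₛ b) (ℕ.+-suc n c)) (∏-∷ₛ x b n cs)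

    ∏-suc : ∀ b n (cs : Vec ℕ k) → ∏ b (suc n) cs ≡ ∏ b n (Vec.map suc cs)
    ∏-suc b n []       = refl
    ∏-suc b n (c ∷ cs) = cong₂ _*_ (cong b (sym (ℕ.+-suc n c))) (∏-suc b n cs)

    -- The system is triangular, since all other indices in an equation exceed n. Prepending a value
    -- to a solution of the later equations only shifts them, and `t 0 * ∏ b 0 cs` solves the first
    -- one because every sign is its own inverse.
    solve₀ : ∀ (cs : Vec ℕ k) M (t : ℕ → Sign) → ∃ λ b → ∀ n → n < M → b n * ∏ b n (Vec.map suc cs) ≡ t n
    solve₀ cs zero    t = (λ _ → Sign.+) , λ n ()
    solve₀ cs (suc M) t with solve₀ cs M (λ n → t (suc n))
    ... | b , solves = x ∷ₛ b , solves′
      where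
      x = t 0 * ∏ b 0 cs
      solves′ : ∀ n → n < suc M → (x ∷ₛ b) n * ∏ (x ∷ₛ b) n (Vec.map suc cs) ≡ t n
      solves′ zero    _         = trans (cong (x *_) (∏-∷ₛ x b 0 cs)) (cancelʳ (t 0) (∏ b 0 cs))
      solves′ (suc n) (s≤s n<M) =
        trans (cong (b n *_) (trans (∏-∷ₛ x b (suc n) cs) (∏-suc b n cs))) (solves n n<M)

  -- The equations determine b (n + m) one after the other, for n = M - 1, …, 0.
  solve : ∀ m {cs : Vec ℕ k} → All (m <_) cs → ∀ M (t : ℕ → Sign) →
    ∃ λ b → ∀ n → n < M → b (n + m) * ∏ b n cs ≡ t n
  solve m {cs} m<cs M t with solve₀ (Vec.map (_∸ suc m) cs) M t
  -- Only indices at least m occur in the equations, so the subtraction is exact wherever it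
  -- matters.
  ... | b , solves = (λ i → b (i ∸ m)) , λ n n<M →
    trans (cong₂ _*_ (cong b (ℕ.m+n∸n≡m n m)) (shift n m<cs)) (solves n n<M)
    where
    shift : ∀ n {l} {cs : Vec ℕ l} → All (m <_) cs →
      ∏ (λ i → b (i ∸ m)) n cs ≡ ∏ b n (Vec.map suc (Vec.map (_∸ suc m) cs))
    shift n []                       = refl
    shift n (_∷_ {x = c} m<c m<cs) = cong₂ _*_
      (cong b (trans (ℕ.+-∸-assoc n (ℕ.<⇒≤ m<c)) (cong (ℕ._+_ n) (ℕ.+-∸-assoc 1 m<c)))) (shift n m<cs)

  -- One offset in each of k consecutive intervals of length R, so that every choice is
  -- automatically increasing and different choices are different sets of offsets.
  offsets : ℕ → Vec (Fin R) k → Vec ℕ k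
  offsets     base []      = []
  offsets {R} base (r ∷ ρ) = base + toℕ r ∷ offsets (base + R) ρ

  offsets-≥ : ∀ base (ρ : Vec (Fin R) k) → All (base ≤_) (offsets base ρ)
  offsets-≥     base []      = []
  offsets-≥ {R} base (r ∷ ρ) = ℕ.m≤m+n base (toℕ r) ∷ All.map (ℕ.≤-trans (ℕ.m≤m+n base R)) (offsets-≥ (base + R) ρ)

  offsets-> : ∀ base (r : Fin R) (ρ : Vec (Fin R) k) → All (base + toℕ r <_) (offsets (base + R) ρ)
  offsets-> {R} base r ρ = All.map (ℕ.<-≤-trans (ℕ.+-monoʳ-< base (Fin.toℕ<n r))) (offsets-≥ (base + R) ρ)

  offsets-< : ∀ base (ρ : Vec (Fin R) k) → All (_< base + k ℕ.* R) (offsets base ρ)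
  offsets-< base []      = []
  offsets-< {R} {suc k} base (r ∷ ρ) =
    ℕ.+-monoʳ-< base (ℕ.<-≤-trans (Fin.toℕ<n r) (ℕ.m≤m+n R (k ℕ.* R)))
    ∷ All.map (λ {d} → subst (d <_) (ℕ.+-assoc base R (k ℕ.* R))) (offsets-< (base + R) ρ)

  offsets-increasing : ∀ base (ρ : Vec (Fin R) k) → AllPairs _<_ (offsets base ρ)
  offsets-increasing     base []      = []
  offsets-increasing {R} base (r ∷ ρ) = offsets-> base r ρ ∷ offsets-increasing (base + R) ρ

  -- After cancelling common offsets, the smallest remaining one occurs only once.
  solve-offsets : ∀ base {ρ σ : Vec (Fin R) k} → ρ ≢ σ → ∀ M (t : ℕ → Sign) →
    ∃ λ b → ∀ n → n < M → ∏ b n (offsets base ρ) * ∏ b n (offsets base σ) ≡ t n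
  solve-offsets base {[]} {[]} ρ≢σ M t = contradiction refl ρ≢σ
  solve-offsets {R} base {r ∷ ρ} {s ∷ σ} ρ≢σ M t with ℕ.<-cmp (toℕ r) (toℕ s)
  ... | tri< r<s _ _ = proj₁ sol , λ n n<M → trans (eq (proj₁ sol) n) (proj₂ sol n n<M)
    where
    -- The offset `base + toℕ r` lies below all the others: the remaining ones are in later
    -- intervals, except `base + toℕ s` in the same interval.
    sol = solve (base + toℕ r) (All.++⁺ (offsets-> base r ρ) (ℕ.+-monoʳ-< base r<s ∷ offsets-> base r σ)) M t
    eq : ∀ b n → ∏ b n (offsets base (r ∷ ρ)) * ∏ b n (offsets base (s ∷ σ))
      ≡ b (n + (base + toℕ r)) * ∏ b n (offsets (base + R) ρ Vec.++ offsets base (s ∷ σ))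
    eq b n = trans (Sign.*-assoc (b (n + (base + toℕ r))) (∏ b n (offsets (base + R) ρ)) (∏ b n (offsets base (s ∷ σ))))
      (cong (b (n + (base + toℕ r)) *_) (sym (∏-++ b n (offsets (base + R) ρ) (offsets base (s ∷ σ)))))
  ... | tri> _ _ s<r = proj₁ sol , λ n n<M → trans (eq (proj₁ sol) n) (proj₂ sol n n<M)
    where
    sol = solve (base + toℕ s) (All.++⁺ (offsets-> base s σ) (ℕ.+-monoʳ-< base s<r ∷ offsets-> base s ρ)) M t
    eq : ∀ b n → ∏ b n (offsets base (r ∷ ρ)) * ∏ b n (offsets base (s ∷ σ))
      ≡ b (n + (base + toℕ s)) * ∏ b n (offsets (base + R) σ Vec.++ offsets base (r ∷ ρ))
    eq b n = trans (Sign.*-comm (∏ b n (offsets base (r ∷ ρ))) (∏ b n (offsets base (s ∷ σ))))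
      (trans (Sign.*-assoc (b (n + (base + toℕ s))) (∏ b n (offsets (base + R) σ)) (∏ b n (offsets base (r ∷ ρ))))
      (cong (b (n + (base + toℕ s)) *_) (sym (∏-++ b n (offsets (base + R) σ) (offsets base (r ∷ ρ))))))
  ... | tri≈ _ r≡s _ with Fin.toℕ-injective r≡s
  ... | refl with solve-offsets (base + R) {ρ} {σ} (λ ρ≡σ → ρ≢σ (cong (r ∷_) ρ≡σ)) M t
  ... | b , solves = b , λ n n<M → trans (interchange (b (n + (base + toℕ r))) _ (b (n + (base + toℕ r))) _)
    (trans (cong (_* (∏ b n (offsets (base + R) ρ) * ∏ b n (offsets (base + R) σ))) (Sign.s*s≡+ (b (n + (base + toℕ r))))) (solves n n<M))

  window : ∀ M → Vec Sign N → Vec (Fin R) k → Vec Sign M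
  window M v ρ = prefix M (λ n → ∏ (at v) n (0 ∷ offsets M ρ))

  window-* : ∀ M (u v : Vec Sign N) (ρ : Vec (Fin R) k) → window M (zipWith _*_ u v) ρ ≡ zipWith _*_ (window M u ρ) (window M v ρ)
  window-* M u v ρ = trans
    (prefix-cong M (λ n _ → trans (∏-cong (at (zipWith _*_ u v)) (λ i → at u i * at v i) n {ds = 0 ∷ offsets M ρ} (All.universal (λ d → at-zipWith u v (n + d)) _)) (∏-* (at u) (at v) n (0 ∷ offsets M ρ))))
    (prefix-* M _ _)

  module _ {M N R k} (fits : M + (M + k ℕ.* R) ≤ N) where

    in-range : ∀ {n} → n < M → (ρ : Vec (Fin R) k) → All (λ d → n + d < N) (0 ∷ offsets M ρ)
    in-range n<M ρ = ℕ.<-≤-trans (ℕ.+-mono-<-≤ n<M z≤n) fits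
      ∷ All.map (λ d<  → ℕ.<-≤-trans (ℕ.+-mono-< n<M d<) fits) (offsets-< M ρ)

    -- The first M signs enter every window exactly once, so they can be used to prescribe one window.
    private
      glue : Vec Sign M → Vec (Fin R) k → (ℕ → Sign) → ℕ → Sign
      glue t ρ b n with n ℕ.<? M
      ... | yes _ = at t n * ∏ b n (offsets M ρ)
      ... | no _  = b n

      glue-< : ∀ t ρ b {n} → n < M → glue t ρ b n ≡ at t n * ∏ b n (offsets M ρ)
      glue-< t ρ b {n} n<M with n ℕ.<? M
      ... | yes _  = refl
      ... | no n≮M = contradiction n<M n≮M

      glue-≥ : ∀ t ρ b {n} → M ≤ n → glue t ρ b n ≡ b n
      glue-≥ t ρ b {n} M≤n with n ℕ.<? M
      ... | yes n<M = contradiction n<M (ℕ.≤⇒≯ M≤n)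
      ... | no _    = refl

      ∏-glue : ∀ t ρ b {n} → n < M → (σ : Vec (Fin R) k) →
        ∏ (at (prefix N (glue t ρ b))) n (0 ∷ offsets M σ) ≡ (at t n * ∏ b n (offsets M ρ)) * ∏ b n (offsets M σ)
      ∏-glue t ρ b {n} n<M σ = trans (∏-cong (at (prefix N (glue t ρ b))) (glue t ρ b) n (All.map (at-prefix (glue t ρ b)) (in-range n<M σ)))
        (cong₂ _*_ (trans (cong (glue t ρ b) (ℕ.+-identityʳ n)) (glue-< t ρ b n<M))
          (∏-cong (glue t ρ b) b n (All.map (λ {d} M≤d → glue-≥ t ρ b (ℕ.≤-trans M≤d (ℕ.m≤n+m d n))) (offsets-≥ M σ))))

    window-onto : ∀ ρ (t : Vec Sign M) → ∃ λ (v : Vec Sign N) → window M v ρ ≡ t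
    window-onto ρ t = prefix N (glue t ρ (λ _ → Sign.+)) , trans
      (prefix-cong M (λ n n<M → trans (∏-glue t ρ _ n<M ρ) (cancelʳ (at t n) _))) (prefix-at t)

    -- Once the first M signs force the window of ρ to be t, the window of σ is t times the product
    -- of the contributions of both offset vectors, so that product has to be `t * u`. Through
    -- `equidistribution` this makes the two windows independent.
    windows-onto : ∀ {ρ σ} → ρ ≢ σ → (t u : Vec Sign M) →
      ∃ λ (v : Vec Sign N) → window M v ρ ≡ t × window M v σ ≡ u
    windows-onto {ρ} {σ} ρ≢σ t u with solve-offsets M ρ≢σ M (λ n → at t n * at u n)
    ... | b , solves = prefix N (glue t ρ b) ,
      trans (prefix-cong M (λ n n<M → trans (∏-glue t ρ b n<M ρ) (cancelʳ (at t n) _))) (prefix-at t) ,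
      trans (prefix-cong M second) (prefix-at u)
      where
      second : ∀ n → n < M → ∏ (at (prefix N (glue t ρ b))) n (0 ∷ offsets M σ) ≡ at u n
      second n n<M = trans (∏-glue t ρ b n<M σ)
        (trans (Sign.*-assoc (at t n) _ _) (trans (cong (at t n *_) (solves n n<M))
        (trans (sym (Sign.*-assoc (at t n) (at t n) (at u n))) (cong (_* at u n) (Sign.s*s≡+ (at t n))))))

    params : ∀ {S} → Vec (Fin R) k → Params (suc S) (suc k)
    params ρ = Vec.map (λ d → d , zero) (0 ∷ offsets M ρ)

    params-admissible : ∀ {S} → 0 < M → ∀ ρ → Admissible N M (params {S} ρ)
    params-admissible 0<M ρ = 0<M ,
      AllPairs.map⁺ (AllPairs.map (λ d<d′ → ℕ.<⇒≤ d<d′ , λ _ → ℕ.<⇒≢ d<d′) (All.map (ℕ.<-≤-trans 0<M) (offsets-≥ M ρ) ∷ offsets-increasing M ρ)) ,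
      All.map⁺ (subst (_≤ N) (sym (ℕ.+-identityʳ M)) (ℕ.≤-trans (ℕ.m≤m+n M _) fits)
        ∷ All.map (λ d< → ℕ.≤-trans (ℕ.+-monoʳ-≤ M (ℕ.<⇒≤ d<)) fits) (offsets-< M ρ))

    correlation-params : ∀ {S} (e : Family N (suc S)) ρ → correlation e M (params ρ) ≡ total (window M (lookup e zero) ρ)
    correlation-params e ρ = trans (correlation-∑ e M (params ρ)) (∑-prefix M (λ i → i) _ _ (λ n n<M → term≡ (in-range n<M ρ)))
      where
      v = lookup e zero
      term≡ : ∀ {l n} {ds : Vec ℕ l} → All (λ d → n + d < N) ds →
        term e (Vec.map (λ d → d , zero) ds) n ≡ ∏ (at v) n ds ◃ 1
      term≡ []                 = refl
      term≡ {n = n} (_∷_ {x = d} {xs = ds} n+d<N ps) = trans (cong₂ ℤ._*_ (entry-at v n+d<N) (term≡ ps)) (◃-* (at v (n + d)) (∏ (at v) n ds))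
        where
        ◃-* : ∀ s t → (s ◃ 1) ℤ.* (t ◃ 1) ≡ (s * t) ◃ 1
        ◃-* Sign.+ Sign.+ = refl
        ◃-* Sign.+ Sign.- = refl
        ◃-* Sign.- Sign.+ = refl
        ◃-* Sign.- Sign.- = refl

    total≤Φ : ∀ {S} (e : Family N (suc S)) → 0 < M → ∀ ρ → ∣ total (window M (lookup e zero) ρ) ∣ ≤ Φ (suc k) e
    total≤Φ e 0<M ρ = subst (λ i → ∣ i ∣ ≤ Φ (suc k) e) (correlation-params e ρ)
      (∣correlation∣≤Φ (suc k) e M (params ρ) (params-admissible 0<M ρ) (ℕ.≤-trans (ℕ.m≤m+n M _) fits))

-- Second moment method for the mean, Chebyshev's inequality for Φ

module Moments where
  open import Data.Integer.Base using (_+_; _*_; _-_; -_; _≤_; _<_; ∣_∣)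
  open ℤ-Solver using (solve-∀)
  open Sums
  open Tails
  open Correlations using (Φ-Lipschitz)
  open Windows

  unique-vecsOver : ∀ {A : Set} {xs : List A} → Unique xs → ∀ n → Unique (vecsOver xs n)
  unique-vecsOver u zero    = [] ∷ []
  unique-vecsOver u (suc n) = Unique.cartesianProductWith⁺ _∷_ Vec.∷-injective u (unique-vecsOver u n)

  -- For second moments: the diagonal term occurs at most once in a list without repetitions.
  -- Counting b for the diagonal as well lets the squares of the means cancel exactly in `Z*m²`.
  ∑-diagonal : ∀ {A : Set} (_≟_ : (x y : A) → Dec (x ≡ y)) {ys} → Unique ys → ∀ x (h : A → ℤ) {a b} →
    + 0 ≤ a → + 0 ≤ b → h x ≤ a → (∀ y → x ≢ y → h y ≤ b) → ∑ ys h ≤ a + + length ys * b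
  ∑-diagonal _≟_ [] x h {a} {b} 0≤a 0≤b hx≤a hy≤b = ℤ.≤-trans 0≤a (ℤ.≤-reflexive (sym (eq a b)))
    where
    eq : ∀ a b → a + + 0 * b ≡ a
    eq = solve-∀
  ∑-diagonal _≟_ {y ∷ ys} (y∉ys ∷ u) x h {a} {b} 0≤a 0≤b hx≤a hy≤b with x ≟ y
  ... | yes refl = ℤ.+-mono-≤ hx≤a (ℤ.≤-trans (∑≤ ys y∉ys)
          (ℤ.*-monoʳ-≤-nonNeg b {{ℤ.nonNegative 0≤b}} (ℤ.+≤+ (ℕ.n≤1+n (length ys)))))
    where
    ∑≤ : ∀ zs → ListAll.All (x ≢_) zs → ∑ zs h ≤ + length zs * b
    ∑≤ []       []         = ℤ.≤-refl
    ∑≤ (z ∷ zs) (x≢z ∷ ps) = ℤ.≤-trans (ℤ.+-mono-≤ (hy≤b z x≢z) (∑≤ zs ps)) (ℤ.≤-reflexive (sym (ℤ.suc-* (+ length zs) b)))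
  ... | no x≢y = ℤ.≤-trans (ℤ.+-mono-≤ (hy≤b y x≢y) (∑-diagonal _≟_ u x h 0≤a 0≤b hx≤a hy≤b)) (ℤ.≤-reflexive (eq a b (+ length ys)))
    where
    eq : ∀ a b n → b + (a + n * b) ≡ a + (+ 1 + n) * b
    eq = solve-∀

  ∑-𝟙≢0 : ∀ {A : Set} {P : A → Set} (P? : ∀ x → Dec (P x)) xs → ∑ xs (λ x → 𝟙 (P? x)) ≢ + 0 → ∃ P
  ∑-𝟙≢0 P? []       ≢0 = contradiction refl ≢0
  ∑-𝟙≢0 P? (x ∷ xs) ≢0 with P? x
  ... | yes p = x , p
  ... | no _  = ∑-𝟙≢0 P? xs (λ ≡0 → ≢0 (trans (ℤ.+-identityˡ _) ≡0))

  ∑-filter : ∀ {A : Set} {P : A → Set} (P? : ∀ x → Dec (P x)) xs →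
    + length (filter P? xs) + ∑ xs (λ x → 𝟙 (¬? (P? x))) ≡ + length xs
  ∑-filter P? []       = refl
  ∑-filter P? (x ∷ xs) with P? x
  ... | yes _ = trans (eq (+ length (filter P? xs)) (∑ xs (λ x → 𝟙 (¬? (P? x))))) (cong ℤ.suc (∑-filter P? xs))
    where
    eq : ∀ a b → (+ 1 + a) + (+ 0 + b) ≡ + 1 + (a + b)
    eq = solve-∀
  ... | no _  = trans (eq (+ length (filter P? xs)) (∑ xs (λ x → 𝟙 (¬? (P? x))))) (cong ℤ.suc (∑-filter P? xs))
    where
    eq : ∀ a b → a + (+ 1 + b) ≡ + 1 + (a + b)
    eq = solve-∀

  ∑-quadratic : ∀ {A : Set} (xs : List A) (f : A → ℤ) a b →
    ∑ xs (λ x → (a * f x - b) * (a * f x - b))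
      ≡ (a * a) * ∑ xs (λ x → f x * f x) + (- + 2 * (a * b) * ∑ xs f + + length xs * (b * b))
  ∑-quadratic xs f a b = trans (∑-cong xs (λ x → eq (f x) a b))
    (trans (∑-+ xs _ _) (cong₂ _+_ (∑-* xs (a * a) _) (trans (∑-+ xs _ _) (cong₂ _+_ (∑-* xs (- + 2 * (a * b)) _) (∑-const xs (b * b))))))
    where
    eq : ∀ x a b → (a * x - b) * (a * x - b) ≡ (a * a) * (x * x) + (- + 2 * (a * b) * x + b * b)
    eq = solve-∀

  0≤length : ∀ {A : Set} (xs : List A) → + 0 ≤ + length xs
  0≤length xs = ℤ.+≤+ ℕ.z≤n

  0<#signVecs : ∀ n → + 0 < #signVecs n
  0<#signVecs zero    = ℤ.+<+ (ℕ.s≤s ℕ.z≤n)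
  0<#signVecs (suc n) = subst (+ 0 <_) (sym (#signVecs-suc n)) (ℤ.*-monoˡ-<-pos (+ 2) (0<#signVecs n))

  invariant-families : ∀ N S → Invariant (zipWith (zipWith Sign._*_)) (families N S)
  invariant-families N S = invariant-vecsOver (invariant-vecsOver invariant-signs N) S

  signVec-comm : ∀ {M} (u v : Vec Sign M) → zipWith Sign._*_ u v ≡ zipWith Sign._*_ v u
  signVec-comm = Vec.zipWith-comm Sign.*-comm

  module _ {M N R k S : ℕ} (fits : M ℕ.+ (M ℕ.+ k ℕ.* R) ℕ.≤ N) (0<M : 0 ℕ.< M) (τ : ℤ) where
    private
      fs = families N (suc S)
      ρs = vecsOver (allFin R) k
      Ω P K g : ℤ
      Ω = + length fs
      P = #signVecs M
      K = + length ρs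
      g = tail M τ

      win : Vec (Fin R) k → Family N (suc S) → Vec Sign M
      win ρ e = window M (lookup e zero) ρ

      win-* : ∀ ρ e f → win ρ (zipWith (zipWith Sign._*_) e f) ≡ zipWith Sign._*_ (win ρ e) (win ρ f)
      win-* ρ e f = trans (cong (λ v → window M v ρ) (Vec.lookup-zipWith (zipWith Sign._*_) zero e f)) (window-* M (lookup e zero) (lookup f zero) ρ)

      large : Vec Sign M → ℤ
      large u = 𝟙 (τ ℤ.≤? total u)

      one : ∀ ρ → P * ∑ fs (λ e → large (win ρ e)) ≡ Ω * g
      one ρ = equidistribution (invariant-families N (suc S)) (invariant-vecsOver invariant-signs M) signVec-comm
        (win ρ) (win-* ρ) onto large
        where
        onto : ∀ t → ∃ λ e → win ρ e ≡ t
        onto t with window-onto fits ρ t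
        ... | v , eq = v ∷ Vec.replicate S v , eq

      -- Equidistribution of the pair of windows over all pairs of sign vectors, that is, pairwise
      -- independence.
      two : ∀ {ρ σ} → ρ ≢ σ → (P * P) * ∑ fs (λ e → large (win ρ e) * large (win σ e)) ≡ Ω * (g * g)
      two {ρ} {σ} ρ≢σ = trans (cong (_* ∑ fs (λ e → large (win ρ e) * large (win σ e))) (sym (length-× _,_ us us)))
        (trans (equidistribution (invariant-families N (suc S)) (invariant-× inv inv) (λ (t , u) (t′ , u′) → cong₂ _,_ (signVec-comm t t′) (signVec-comm u u′))
          (λ e → win ρ e , win σ e) (λ e f → cong₂ _,_ (win-* ρ e f) (win-* σ e f)) onto (λ (t , u) → large t * large u))
        (cong (Ω *_) (trans (∑-× _,_ us us (λ (t , u) → large t * large u)) (trans (∑-cong us (λ t → trans (∑-* us (large t) large) (ℤ.*-comm (large t) g))) (∑-* us g large)))))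
        where
        us = signVecs M
        inv = invariant-vecsOver invariant-signs M
        onto : ∀ tu → ∃ λ e → (win ρ e , win σ e) ≡ tu
        onto (t , u) with windows-onto fits ρ≢σ t u
        ... | v , eq , eq′ = v ∷ Vec.replicate S v , cong₂ _,_ eq eq′

      X : Family N (suc S) → ℤ
      X e = ∑ ρs (λ ρ → large (win ρ e))

      ∑X : P * ∑ fs X ≡ K * (Ω * g)
      ∑X = trans (cong (P *_) (∑-swap fs ρs _)) (trans (sym (∑-* ρs P _)) (trans (∑-cong ρs one) (∑-const ρs (Ω * g))))

      0≤g : + 0 ≤ g
      0≤g = 0≤tail M τ

      0≤Ω : + 0 ≤ Ω
      0≤Ω = 0≤length fs

      large² : ∀ u → large u * large u ≡ large u
      large² u with τ ℤ.≤? total u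
      ... | yes _ = refl
      ... | no _  = refl

      ∑X² : (P * P) * ∑ fs (λ e → X e * X e) ≤ K * ((Ω * g) * P + K * (Ω * (g * g)))
      ∑X² = begin
        (P * P) * ∑ fs (λ e → X e * X e)
          ≡⟨ cong ((P * P) *_) (∑-cong fs (λ e → trans (sym (∑-* ρs (X e) _)) (∑-cong ρs (λ ρ → trans (ℤ.*-comm (X e) _) (sym (∑-* ρs (large (win ρ e)) _)))))) ⟩
        (P * P) * ∑ fs (λ e → ∑ ρs (λ ρ → ∑ ρs (λ σ → large (win ρ e) * large (win σ e))))
          ≡⟨ cong ((P * P) *_) (trans (∑-swap fs ρs _) (∑-cong ρs (λ ρ → ∑-swap fs ρs _))) ⟩
        (P * P) * ∑ ρs (λ ρ → ∑ ρs (λ σ → ∑ fs (λ e → large (win ρ e) * large (win σ e))))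
          ≡⟨ trans (sym (∑-* ρs (P * P) _)) (∑-cong ρs (λ ρ → sym (∑-* ρs (P * P) _))) ⟩
        ∑ ρs (λ ρ → ∑ ρs (λ σ → (P * P) * ∑ fs (λ e → large (win ρ e) * large (win σ e))))
          ≤⟨ ∑-mono ρs (λ ρ → ∑-diagonal (Vec.≡-dec Fin._≟_) (unique-vecsOver (Unique.allFin⁺ R) k) ρ _
               (0≤* (0≤* 0≤Ω 0≤g) (ℤ.+≤+ ℕ.z≤n)) (0≤* 0≤Ω (0≤* 0≤g 0≤g)) (ℤ.≤-reflexive (diagonal ρ)) (λ σ ρ≢σ → ℤ.≤-reflexive (two ρ≢σ))) ⟩
        ∑ ρs (λ ρ → (Ω * g) * P + K * (Ω * (g * g)))
          ≡⟨ ∑-const ρs _ ⟩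
        K * ((Ω * g) * P + K * (Ω * (g * g))) ∎
        where
        open ℤ.≤-Reasoning
        diagonal : ∀ ρ → (P * P) * ∑ fs (λ e → large (win ρ e) * large (win ρ e)) ≡ (Ω * g) * P
        diagonal ρ = trans (cong ((P * P) *_) (∑-cong fs (λ e → large² (win ρ e))))
          (trans (ℤ.*-assoc P P _) (trans (cong (P *_) (one ρ)) (ℤ.*-comm P (Ω * g))))

      -- The mean of `X` is `m` divided by `P`, and `Z` counts the families without any large
      -- window.
      m Z : ℤ
      m = K * g
      Z = ∑ fs (λ e → 𝟙 (X e ℤ.≟ + 0))

      0≤Z : + 0 ≤ Z
      0≤Z = 0≤∑ fs (λ e → 0≤𝟙 (X e ℤ.≟ + 0))

      -- Chebyshev's inequality at X = 0: by pairwise independence the variance of `X` is at most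
      -- its mean. The common factor `m` is left in place until it is known to be positive.
      Z*m² : m * (Z * m) ≤ m * (Ω * P)
      Z*m² = begin
        m * (Z * m)                              ≡⟨ eq₀ m Z ⟩
        (m * m) * Z                              ≡⟨ sym (∑-* fs (m * m) _) ⟩
        ∑ fs (λ e → (m * m) * 𝟙 (X e ℤ.≟ + 0))   ≤⟨ ∑-mono fs pointwise ⟩
        ∑ fs (λ e → (P * X e - m) * (P * X e - m)) ≡⟨ ∑-quadratic fs X P m ⟩
        (P * P) * ∑ fs (λ e → X e * X e) + (- + 2 * (P * m) * ∑ fs X + Ω * (m * m))
          ≤⟨ ℤ.+-monoˡ-≤ _ ∑X² ⟩
        K * ((Ω * g) * P + K * (Ω * (g * g))) + (- + 2 * (P * m) * ∑ fs X + Ω * (m * m))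
          ≡⟨ cong (λ x → K * ((Ω * g) * P + K * (Ω * (g * g))) + (x + Ω * (m * m)))
               (trans (eq₁ P m (∑ fs X)) (cong (- + 2 * m *_) ∑X)) ⟩
        K * ((Ω * g) * P + K * (Ω * (g * g))) + (- + 2 * m * (K * (Ω * g)) + Ω * (m * m))
          ≡⟨ eq₂ K Ω g P ⟩
        m * (Ω * P) ∎
        where
        open ℤ.≤-Reasoning
        pointwise : ∀ e → (m * m) * 𝟙 (X e ℤ.≟ + 0) ≤ (P * X e - m) * (P * X e - m)
        pointwise e with X e ℤ.≟ + 0
        ... | yes X≡0 = ℤ.≤-reflexive (trans (eq m P) (cong (λ x → (P * x - m) * (P * x - m)) (sym X≡0)))
          where
          eq : ∀ m p → (m * m) * + 1 ≡ (p * + 0 - m) * (p * + 0 - m)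
          eq = solve-∀
        ... | no _    = subst (_≤ (P * X e - m) * (P * X e - m)) (sym (ℤ.*-zeroʳ (m * m))) (0≤i² (P * X e - m))
        eq₀ : ∀ m z → m * (z * m) ≡ (m * m) * z
        eq₀ = solve-∀
        eq₁ : ∀ p m x → - + 2 * (p * m) * x ≡ - + 2 * m * (p * x)
        eq₁ = solve-∀
        eq₂ : ∀ k o g p → k * ((o * g) * p + k * (o * (g * g))) + (- + 2 * (k * g) * (k * (o * g)) + o * ((k * g) * (k * g))) ≡ (k * g) * (o * p)
        eq₂ = solve-∀

      2Z≤Ω : + 2 * P ≤ m → + 2 * Z ≤ Ω
      2Z≤Ω 2P≤m = ℤ.*-cancelˡ-≤-pos (+ 2 * Z) Ω P {{ℤ.positive (0<#signVecs M)}} (begin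
        P * (+ 2 * Z)   ≡⟨ eq P Z ⟩
        Z * (+ 2 * P)   ≤⟨ ℤ.*-monoˡ-≤-nonNeg Z {{ℤ.nonNegative 0≤Z}} 2P≤m ⟩
        Z * m           ≤⟨ ℤ.*-cancelˡ-≤-pos (Z * m) (Ω * P) m {{ℤ.positive 0<m}} Z*m² ⟩
        Ω * P           ≡⟨ ℤ.*-comm Ω P ⟩
        P * Ω           ∎)
        where
        open ℤ.≤-Reasoning
        0<m : + 0 < m
        0<m = ℤ.<-≤-trans (ℤ.*-monoˡ-<-pos (+ 2) (0<#signVecs M)) 2P≤m
        eq : ∀ p z → p * (+ 2 * z) ≡ z * (+ 2 * p)
        eq = solve-∀

    -- The second hypothesis says that at least two large windows are expected, so at most half of
    -- the families have none. All the others satisfy Φ ≥ τ, whence the mean is at least τ/2.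
    Φ-mean-≥ : + 0 ≤ τ → + 2 * #signVecs M ≤ + length (vecsOver (allFin R) k) * tail M τ →
      τ * + length (families N (suc S)) ≤ + 2 * ∑ (families N (suc S)) (λ e → + Φ (suc k) e)
    Φ-mean-≥ 0≤τ 2P≤m = begin
      τ * Ω                            ≡⟨ eq τ Ω ⟩
      + 2 * (τ * Ω) - τ * Ω            ≤⟨ ℤ.+-monoʳ-≤ (+ 2 * (τ * Ω)) (ℤ.neg-mono-≤ (ℤ.*-monoˡ-≤-nonNeg τ {{ℤ.nonNegative 0≤τ}} (2Z≤Ω 2P≤m))) ⟩
      + 2 * (τ * Ω) - τ * (+ 2 * Z)    ≡⟨ eq′ τ Ω Z ⟩
      + 2 * (τ * (Ω * + 1 + - + 1 * Z)) ≡⟨ cong (λ x → + 2 * (τ * x)) (trans (cong₂ _+_ (sym (∑-const fs (+ 1))) (sym (∑-* fs (- + 1) _))) (sym (∑-+ fs _ _))) ⟩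
      + 2 * (τ * ∑ fs (λ e → + 1 + - + 1 * 𝟙 (X e ℤ.≟ + 0))) ≡⟨ cong (+ 2 *_) (sym (∑-* fs τ _)) ⟩
      + 2 * ∑ fs (λ e → τ * (+ 1 + - + 1 * 𝟙 (X e ℤ.≟ + 0))) ≤⟨ ℤ.*-monoˡ-≤-nonNeg (+ 2) (∑-mono fs pointwise) ⟩
      + 2 * ∑ fs (λ e → + Φ (suc k) e) ∎
      where
      open ℤ.≤-Reasoning
      eq : ∀ t o → t * o ≡ + 2 * (t * o) - t * o
      eq = solve-∀
      eq′ : ∀ t o z → + 2 * (t * o) - t * (+ 2 * z) ≡ + 2 * (t * (o * + 1 + - + 1 * z))
      eq′ = solve-∀
      i≤∣i∣ : ∀ i → i ≤ + ∣ i ∣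
      i≤∣i∣ (+ n)       = ℤ.≤-refl
      i≤∣i∣ ℤ.-[1+ n ] = ℤ.-≤+
      pointwise : ∀ e → τ * (+ 1 + - + 1 * 𝟙 (X e ℤ.≟ + 0)) ≤ + Φ (suc k) e
      pointwise e with X e ℤ.≟ + 0
      ... | yes _  = subst (_≤ + Φ (suc k) e) (sym (ℤ.*-zeroʳ τ)) (ℤ.+≤+ ℕ.z≤n)
      ... | no X≢0 with ∑-𝟙≢0 (λ ρ → τ ℤ.≤? total (win ρ e)) ρs X≢0
      ... | ρ , τ≤ = ℤ.≤-trans (ℤ.≤-reflexive (ℤ.*-identityʳ τ)) (ℤ.≤-trans τ≤ (ℤ.≤-trans (i≤∣i∣ (total (win ρ e)))
              (ℤ.+≤+ (total≤Φ fits e 0<M ρ))))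

  -- |f x - mean| < mean / (2H), with the denominators cleared.
  Concentrated : ∀ {A : Set} → List A → (A → ℤ) → ℕ → A → Set
  Concentrated xs f H x =
    + (2 ℕ.* H) * (+ length xs * f x - ∑ xs f) < ∑ xs f × + (2 ℕ.* H) * (∑ xs f - + length xs * f x) < ∑ xs f

  concentrated? : ∀ {A : Set} (xs : List A) f H x → Dec (Concentrated xs f H x)
  concentrated? xs f H x = (_ ℤ.<? _) ×-dec (_ ℤ.<? _)

  chebyshev : ∀ {A : Set} (xs : List A) (f : A → ℤ) H → + 0 ≤ ∑ xs f →
    (∑ xs f * ∑ xs f) * ∑ xs (λ x → 𝟙 (¬? (concentrated? xs f H x)))
      ≤ (+ (2 ℕ.* H) * + (2 ℕ.* H)) * (+ length xs * (+ length xs * ∑ xs (λ x → f x * f x) - ∑ xs f * ∑ xs f))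
  chebyshev {A} xs f H 0≤a = begin
    (a * a) * ∑ xs (λ x → 𝟙 (¬? (concentrated? xs f H x)))    ≡⟨ sym (∑-* xs (a * a) _) ⟩
    ∑ xs (λ x → (a * a) * 𝟙 (¬? (concentrated? xs f H x)))    ≤⟨ ∑-mono xs pointwise ⟩
    ∑ xs (λ x → (h * h) * ((n * f x - a) * (n * f x - a)))    ≡⟨ trans (∑-* xs (h * h) _) (cong ((h * h) *_) (trans (∑-quadratic xs f n a) (eq n a _))) ⟩
    (h * h) * (n * (n * ∑ xs (λ x → f x * f x) - a * a))      ∎
    where
    open ℤ.≤-Reasoning
    n a h : ℤ
    n = + length xs
    a = ∑ xs f
    h = + (2 ℕ.* H)
    eq : ∀ n a q → (n * n) * q + (- + 2 * (n * a) * a + n * (a * a)) ≡ n * (n * q - a * a)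
    eq = solve-∀
    sq : ∀ x → a ≤ h * x → (a * a) * + 1 ≤ (h * h) * (x * x)
    sq x a≤hx = ℤ.≤-trans (ℤ.≤-reflexive (ℤ.*-identityʳ (a * a))) (ℤ.≤-trans (*-mono-≤ 0≤a 0≤a a≤hx a≤hx) (ℤ.≤-reflexive (eq′ h x)))
      where
      eq′ : ∀ h x → (h * x) * (h * x) ≡ (h * h) * (x * x)
      eq′ = solve-∀
    flip : ∀ n y a → (a - n * y) * (a - n * y) ≡ (n * y - a) * (n * y - a)
    flip = solve-∀
    pointwise : ∀ x → (a * a) * 𝟙 (¬? (concentrated? xs f H x)) ≤ (h * h) * ((n * f x - a) * (n * f x - a))
    pointwise x with h * (n * f x - a) ℤ.<? a | h * (a - n * f x) ℤ.<? a
    ... | yes _ | yes _ = subst (_≤ (h * h) * ((n * f x - a) * (n * f x - a))) (sym (ℤ.*-zeroʳ (a * a))) (0≤* (0≤i² h) (0≤i² (n * f x - a)))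
    ... | no p  | _     = sq (n * f x - a) (ℤ.≮⇒≥ p)
    ... | yes _ | no q  = subst (λ y → (a * a) * + 1 ≤ (h * h) * y) (flip n (f x) a) (sq (a - n * f x) (ℤ.≮⇒≥ q))

  varianceBound-families : ∀ N S → VarianceBound (families N S) (Neighbour (Neighbour Any²)) (+ (N ℕ.* S))
  varianceBound-families N S = subst (VarianceBound (families N S) (Neighbour (Neighbour Any²))) eq
    (varianceBound-vecsOver (0≤* {+ N} {+ 1} (ℤ.+≤+ ℕ.z≤n) (ℤ.+≤+ ℕ.z≤n)) (varianceBound-vecsOver {v = + 1} (ℤ.+≤+ ℕ.z≤n) varianceBound-signs N) S)
    where
    eq : + S * (+ N * + 1) ≡ + (N ℕ.* S)
    eq = trans (cong (+ S *_) (ℤ.*-identityʳ (+ N))) (trans (ℤ.*-comm (+ S) (+ N)) (sym (ℤ.pos-* N S)))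

  neighbours-sym : ∀ {A : Set} {_~_ : A → A → Set} → (∀ {x y} → x ~ y → y ~ x) → ∀ {n} {u v : Vec A n} → Neighbour _~_ u v → Neighbour _~_ v u
  neighbours-sym ~-sym (here x~y)  = here (~-sym x~y)
  neighbours-sym ~-sym (there u~v) = there (neighbours-sym ~-sym u~v)

  Φ-variance : ∀ N S k → let fs = families N S in
    + length fs * ∑ fs (λ e → + Φ k e * + Φ k e) - ∑ fs (λ e → + Φ k e) * ∑ fs (λ e → + Φ k e)
      ≤ + (N ℕ.* S) * (+ (k ℕ.* 2) * + (k ℕ.* 2)) * (+ length fs * + length fs)
  Φ-variance N S k = ℤ.≤-trans (ℤ.+-monoˡ-≤ _ (varianceBound-families N S (+ (k ℕ.* 2)) (ℤ.+≤+ ℕ.z≤n) (λ e → + Φ k e) lipschitz))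
    (ℤ.≤-reflexive (eq (∑ fs (λ e → + Φ k e) * ∑ fs (λ e → + Φ k e)) (+ (N ℕ.* S) * (+ (k ℕ.* 2) * + (k ℕ.* 2)) * (+ length fs * + length fs))))
    where
    fs = families N S
    ~-sym : ∀ {x y : Vec Sign N} → Neighbour Any² x y → Neighbour Any² y x
    ~-sym = neighbours-sym λ { any² → any² }
    lipschitz : Lipschitz (Neighbour (Neighbour Any²)) (+ (k ℕ.* 2)) (λ e → + Φ k e)
    lipschitz e f e~f = ℤ.+≤+ (Φ-Lipschitz k e~f) , ℤ.+≤+ (Φ-Lipschitz k (neighbours-sym ~-sym e~f))
    eq : ∀ a b → (a + b) - a ≡ b
    eq = solve-∀

  -- Chebyshev's inequality at deviation mean/(2H) bounds the share of bad families by (2H)² ·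
  -- NS(2k)² / mean², and mean ≥ τ/2. The three squares of 2 give the constant 64, and the third
  -- factor H brings the share down to 1/H.
  Φ-concentrated : ∀ N S k H τ → let fs = families N S ; Ω = + length fs in
    + 0 < Ω → + 0 ≤ τ → 1 ℕ.≤ N ℕ.* S → 1 ℕ.≤ k → 1 ℕ.≤ H →
    τ * Ω ≤ + 2 * ∑ fs (λ e → + Φ k e) →
    + 64 * (+ (N ℕ.* S) * (+ k * + k)) * (+ H * + H * + H) ≤ τ * τ →
    + H * ∑ fs (λ e → 𝟙 (¬? (concentrated? fs (λ e → + Φ k e) H e))) ≤ Ω
  Φ-concentrated N S k H τ 0<Ω 0≤τ 1≤NS 1≤k 1≤H τΩ≤2a τ²-large =
    ℤ.*-cancelˡ-≤-pos (+ H * B) Ω (c * (Ω * Ω)) {{ℤ.positive (0<* 0<c (0<* 0<Ω 0<Ω))}} (begin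
      c * (Ω * Ω) * (+ H * B)
        ≡⟨ cong₂ (λ h k2 → + 4 * ((h * h) * (+ (N ℕ.* S) * (k2 * k2))) * (Ω * Ω) * (+ H * B)) (ℤ.pos-* 2 H) (ℤ.pos-* k 2) ⟩
      + 4 * ((+ 2 * + H) * (+ 2 * + H) * (+ (N ℕ.* S) * ((+ k * + 2) * (+ k * + 2)))) * (Ω * Ω) * (+ H * B)
        ≡⟨ eq₁ (+ H) (+ (N ℕ.* S)) (+ k) Ω B ⟩
      + 64 * (+ (N ℕ.* S) * (+ k * + k)) * (+ H * + H * + H) * (Ω * Ω * B)
        ≤⟨ ℤ.*-monoʳ-≤-nonNeg (Ω * Ω * B) {{ℤ.nonNegative (0≤* (0≤i² Ω) 0≤B)}} τ²-large ⟩
      τ * τ * (Ω * Ω * B)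
        ≡⟨ eq₂ τ Ω B ⟩
      (τ * Ω) * (τ * Ω) * B
        ≤⟨ ℤ.*-monoʳ-≤-nonNeg B {{ℤ.nonNegative 0≤B}} (*-mono-≤ 0≤τΩ 0≤τΩ τΩ≤2a τΩ≤2a) ⟩
      (+ 2 * a) * (+ 2 * a) * B
        ≡⟨ eq₃ a B ⟩
      + 4 * ((a * a) * B)
        ≤⟨ ℤ.*-monoˡ-≤-nonNeg (+ 4) (chebyshev fs (λ e → + Φ k e) H 0≤a) ⟩
      + 4 * ((h * h) * (Ω * (Ω * q - a * a)))
        ≤⟨ ℤ.*-monoˡ-≤-nonNeg (+ 4) (ℤ.*-monoˡ-≤-nonNeg (h * h) {{ℤ.nonNegative (0≤i² h)}} (ℤ.*-monoˡ-≤-nonNeg Ω (Φ-variance N S k))) ⟩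
      + 4 * ((h * h) * (Ω * (W * (Ω * Ω))))
        ≡⟨ eq₄ h Ω W ⟩
      c * (Ω * Ω) * Ω ∎)
    where
    open ℤ.≤-Reasoning
    fs = families N S
    Ω a q B h W c : ℤ
    Ω = + length fs
    a = ∑ fs (λ e → + Φ k e)
    q = ∑ fs (λ e → + Φ k e * + Φ k e)
    B = ∑ fs (λ e → 𝟙 (¬? (concentrated? fs (λ e → + Φ k e) H e)))
    h = + (2 ℕ.* H)
    W = + (N ℕ.* S) * (+ (k ℕ.* 2) * + (k ℕ.* 2))
    c = + 4 * ((h * h) * W)
    0≤a : + 0 ≤ a
    0≤a = 0≤∑ fs (λ e → ℤ.+≤+ ℕ.z≤n)
    0≤B : + 0 ≤ B
    0≤B = 0≤∑ fs (λ e → 0≤𝟙 (¬? (concentrated? fs (λ e → + Φ k e) H e)))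
    0≤τΩ : + 0 ≤ τ * Ω
    0≤τΩ = 0≤* 0≤τ (ℤ.<⇒≤ 0<Ω)
    0<* : ∀ {i j} → + 0 < i → + 0 < j → + 0 < i * j
    0<* {i} {j} 0<i 0<j = subst (_< i * j) (ℤ.*-zeroʳ i) (ℤ.*-monoˡ-<-pos i {{ℤ.positive 0<i}} 0<j)
    0<h : + 0 < h
    0<h = ℤ.+<+ (ℕ.≤-trans 1≤H (ℕ.m≤m+n H _))
    0<k2 : + 0 < + (k ℕ.* 2)
    0<k2 = ℤ.+<+ (ℕ.≤-trans 1≤k (ℕ.m≤m*n k 2))
    0<c : + 0 < c
    0<c = 0<* {+ 4} (ℤ.+<+ (ℕ.s≤s ℕ.z≤n)) (0<* (0<* 0<h 0<h) (0<* (ℤ.+<+ 1≤NS) (0<* 0<k2 0<k2)))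
    eq₁ : ∀ H n k o b → + 4 * ((+ 2 * H) * (+ 2 * H) * (n * ((k * + 2) * (k * + 2)))) * (o * o) * (H * b)
      ≡ + 64 * (n * (k * k)) * (H * H * H) * (o * o * b)
    eq₁ = solve-∀
    eq₂ : ∀ t o b → t * t * (o * o * b) ≡ (t * o) * (t * o) * b
    eq₂ = solve-∀
    eq₃ : ∀ a b → (+ 2 * a) * (+ 2 * a) * b ≡ + 4 * ((a * a) * b)
    eq₃ = solve-∀
    eq₄ : ∀ h o w → + 4 * ((h * h) * (o * (w * (o * o)))) ≡ + 4 * ((h * h) * w) * (o * o) * o
    eq₄ = solve-∀

-- Choice of the block length, the window length and the offsets

module Choice where
  open import Data.Nat.Base using (_+_; _*_; _^_; _≤_; _<_)
  open ℕ-Solver using (solve-∀)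
  open Sums
  open Tails
  open Moments

  length-vecsOver : ∀ {A : Set} (xs : List A) n → length (vecsOver xs n) ≡ length xs ^ n
  length-vecsOver xs zero    = refl
  length-vecsOver xs (suc n) = ℤ.+-injective (trans (length-× Data.Vec.Base._∷_ xs (vecsOver xs n))
    (trans (sym (ℤ.pos-* (length xs) _)) (cong (λ m → + (length xs * m)) (length-vecsOver xs n))))
    where import Data.Vec.Base

  length-families : ∀ N S → length (families N S) ≡ 2 ^ (N * S)
  length-families N S = trans (length-vecsOver _ S) (trans (cong (_^ S) (length-vecsOver signs N)) (ℕ.^-*-assoc 2 N S))

  n<2^n : ∀ n → n < 2 ^ n
  n<2^n zero    = s≤s z≤n
  n<2^n (suc n) = ℕ.≤-trans (ℕ.+-mono-≤ (ℕ.m^n>0 2 n) (n<2^n n)) (ℕ.≤-reflexive (cong (ℕ._+_ (2 ^ n)) (sym (ℕ.+-identityʳ (2 ^ n)))))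

  -- The downward search stops at the largest ℓ with Dℓ² ≤ N; the upper bound is then N < D(ℓ + 1)²
  -- together with ℓ + 1 ≤ 2ℓ.
  approximate-sqrt : ∀ D N → 1 ≤ D → D ≤ N → ∃ λ ℓ → 1 ≤ ℓ × D * (ℓ * ℓ) ≤ N × N ≤ D * (4 * (ℓ * ℓ))
  approximate-sqrt D N 1≤D D≤N = search N (ℕ.<-≤-trans (ℕ.n<1+n N)
      (ℕ.≤-trans (ℕ.m≤m*n (suc N) (suc N)) (ℕ.≤-trans (ℕ.≤-reflexive (sym (ℕ.*-identityˡ _))) (ℕ.*-monoˡ-≤ (suc N * suc N) 1≤D))))
    where
    search : ∀ n → N < D * (suc n * suc n) → ∃ λ ℓ → 1 ≤ ℓ × D * (ℓ * ℓ) ≤ N × N ≤ D * (4 * (ℓ * ℓ))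
    search zero    N< = contradiction D≤N (ℕ.<⇒≱ (subst (N <_) (ℕ.*-identityʳ D) N<))
    search (suc i) N< with D * (suc i * suc i) ℕ.≤? N
    ... | no ≰  = search i (ℕ.≰⇒> ≰)
    ... | yes ≤ = suc i , s≤s z≤n , ≤ , ℕ.≤-trans (ℕ.<⇒≤ N<) (ℕ.*-monoʳ-≤ D
            (ℕ.≤-trans (ℕ.m≤m+n _ (i * (3 * i + 4))) (ℕ.≤-reflexive (eq i))))
      where
      eq : ∀ i → (2 + i) * (2 + i) + i * (3 * i + 4) ≡ 4 * ((1 + i) * (1 + i))
      eq = solve-∀

  module _ (H S : ℕ) (1≤H : 1 ≤ H) where
    -- With T = C k² blocks of length 4ℓ² and 16 T ℓ² ≤ N ≤ 64 T ℓ², the threshold τ = T ℓ satisfies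
    -- τ² ≥ 64 N S k² H³; and R = 2^(8Ck + 1) offsets per interval give R^(k-1) ≥ 2 · 16^T windows.
    C : ℕ
    C = 4096 * (H * H * H) * suc S

    private
      1≤C : 1 ≤ C
      1≤C = ℕ.*-mono-≤ {1} {4096 * (H * H * H)} (ℕ.*-mono-≤ {1} {4096} (s≤s z≤n) (ℕ.*-mono-≤ (ℕ.*-mono-≤ 1≤H 1≤H) 1≤H)) (s≤s z≤n)

    badEvents : ∀ N k → 2 ≤ k → 2 ^ ((8 * C + 2) * k) ≤ N → let fs = families N (suc S) in
      + H ℤ.* ∑ fs (λ e → 𝟙 (¬? (concentrated? fs (λ e → + Φ k e) H e))) ℤ.≤ + length fs
    badEvents N (suc zero) (s≤s ()) large
    badEvents N k@(suc κ@(suc j)) 2≤k large = Φ-concentrated N (suc S) k H τ 0<Ω (ℤ.+≤+ z≤n)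
        (ℕ.*-mono-≤ 1≤N (s≤s z≤n)) (s≤s z≤n) 1≤H (Φ-mean-≥ fits 0<M τ (ℤ.+≤+ z≤n) 2P≤Kg) (ℤ.≤-trans (ℤ.≤-reflexive cast) (ℤ.≤-trans (ℤ.+≤+ τ²-large) (ℤ.≤-reflexive (ℤ.pos-* (T * ℓ) (T * ℓ)))))
      where
      T R : ℕ
      T = C * (k * k)
      R = 2 ^ (8 * C * k + 1)

      1≤T : 1 ≤ T
      1≤T = ℕ.*-mono-≤ {1} {C} {1} {k * k} 1≤C (s≤s z≤n)

      1≤N : 1 ≤ N
      1≤N = ℕ.≤-trans (ℕ.m^n>0 2 ((8 * C + 2) * k)) large

      16T≤N : 16 * T ≤ N
      16T≤N = ℕ.≤-trans (ℕ.*-monoʳ-≤ 16 (ℕ.*-mono-≤ (ℕ.<⇒≤ (n<2^n C)) (ℕ.*-mono-≤ (ℕ.<⇒≤ (n<2^n k)) (ℕ.<⇒≤ (n<2^n k)))))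
        (ℕ.≤-trans (ℕ.≤-reflexive powers) (ℕ.≤-trans (ℕ.^-monoʳ-≤ 2 exponent) large))
        where
        powers : 16 * (2 ^ C * (2 ^ k * 2 ^ k)) ≡ 2 ^ (4 + (C + (k + k)))
        powers = sym (trans (ℕ.^-distribˡ-+-* 2 4 (C + (k + k))) (cong (16 *_)
          (trans (ℕ.^-distribˡ-+-* 2 C (k + k)) (cong (2 ^ C *_) (ℕ.^-distribˡ-+-* 2 k k)))))
        exponent : 4 + (C + (k + k)) ≤ (8 * C + 2) * k
        exponent = ℕ.≤-trans (ℕ.+-monoˡ-≤ (C + (k + k)) (ℕ.*-monoʳ-≤ 4 1≤C)) (ℕ.≤-trans
          (ℕ.m≤m+n (4 * C + (C + (k + k))) (11 * C + 8 * C * j)) (ℕ.≤-reflexive (eq C j)))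
          where
          eq : ∀ C j → 4 * C + (C + ((2 + j) + (2 + j))) + (11 * C + 8 * C * j) ≡ (8 * C + 2) * (2 + j)
          eq = solve-∀

      -- This determines the summand 2 in the exponent (8C + 2)k: one k covers κ ≤ 2^k, and the
      -- other, being at least 2, covers the factor 2 and the extra 1 in the exponent of `R`.
      κR≤N : 2 * (κ * R) ≤ N
      κR≤N = ℕ.≤-trans (ℕ.*-monoʳ-≤ 2 (ℕ.*-monoˡ-≤ R (ℕ.≤-trans (ℕ.n≤1+n κ) (ℕ.<⇒≤ (n<2^n k)))))
        (ℕ.≤-trans (ℕ.≤-reflexive powers) (ℕ.≤-trans (ℕ.^-monoʳ-≤ 2 exponent) large))
        where
        powers : 2 * (2 ^ k * R) ≡ 2 ^ (1 + (k + (8 * C * k + 1)))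
        powers = cong (2 *_) (sym (ℕ.^-distribˡ-+-* 2 k (8 * C * k + 1)))
        exponent : 1 + (k + (8 * C * k + 1)) ≤ (8 * C + 2) * k
        exponent = ℕ.≤-trans (ℕ.m≤m+n _ j) (ℕ.≤-reflexive (eq C j))
          where
          eq : ∀ C j → 1 + ((2 + j) + (8 * C * (2 + j) + 1)) + j ≡ (8 * C + 2) * (2 + j)
          eq = solve-∀

      root = approximate-sqrt (16 * T) N (ℕ.*-mono-≤ {1} {16} (s≤s z≤n) 1≤T) 16T≤N
      ℓ = proj₁ root
      1≤ℓ = proj₁ (proj₂ root)

      M : ℕ
      M = T * (4 * (ℓ * ℓ))

      0<M : 0 < M
      0<M = ℕ.*-mono-≤ 1≤T (ℕ.*-mono-≤ {1} {4} (s≤s z≤n) (ℕ.*-mono-≤ 1≤ℓ 1≤ℓ))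

      -- Since 4M = 16Tℓ² ≤ N, the two stretches of length `M` occupy at most one half of the
      -- sequence, and the intervals for the offsets fit into the other half.
      fits : M + (M + κ * R) ≤ N
      fits = ℕ.*-cancelˡ-≤ 2 (ℕ.≤-trans (ℕ.≤-reflexive (eq T ℓ (κ * R)))
        (ℕ.≤-trans (ℕ.+-mono-≤ (proj₁ (proj₂ (proj₂ root))) κR≤N) (ℕ.≤-reflexive (cong (ℕ._+_ N) (sym (ℕ.+-identityʳ N))))))
        where
        eq : ∀ T l r → 2 * (T * (4 * (l * l)) + (T * (4 * (l * l)) + r)) ≡ 16 * T * (l * l) + 2 * r
        eq = solve-∀

      τ = + (T * ℓ)

      0<Ω : + 0 ℤ.< + length (families N (suc S))
      0<Ω = ℤ.+<+ (subst (0 <_) (sym (length-families N (suc S))) (ℕ.m^n>0 2 (N * suc S)))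

      choices : 2 * 16 ^ T ≤ length (vecsOver (allFin R) κ)
      choices = subst₂ _≤_ (sym lhs) (sym rhs) (ℕ.^-monoʳ-≤ 2 exponent)
        where
        lhs : 2 * 16 ^ T ≡ 2 ^ (1 + 4 * T)
        lhs = cong (2 *_) (ℕ.^-*-assoc 2 4 T)
        rhs : length (vecsOver (allFin R) κ) ≡ 2 ^ ((8 * C * k + 1) * κ)
        rhs = trans (length-vecsOver (allFin R) κ) (trans (cong (_^ κ) (List.length-tabulate {n = R} (λ i → i))) (ℕ.^-*-assoc 2 (8 * C * k + 1) κ))
        -- As k ≥ 2, κ = k - 1 is at least k/2, so 8Ckκ ≥ 4Ck² = 4T; the extra 1 in the exponent of
        -- `R` pays for the factor 2.
        exponent : 1 + 4 * T ≤ (8 * C * k + 1) * κ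
        exponent = ℕ.≤-trans (ℕ.m≤m+n _ (4 * C * j * (2 + j) + j)) (ℕ.≤-reflexive (eq C j))
          where
          eq : ∀ C j → 1 + 4 * (C * ((2 + j) * (2 + j))) + (4 * C * j * (2 + j) + j) ≡ (8 * C * (2 + j) + 1) * (1 + j)
          eq = solve-∀

      2P≤Kg : + 2 ℤ.* #signVecs M ℤ.≤ + length (vecsOver (allFin R) κ) ℤ.* tail M τ
      2P≤Kg = ℤ.≤-trans (ℤ.*-monoˡ-≤-nonNeg (+ 2) (blocks-lowerBound ℓ 1≤ℓ T))
        (ℤ.≤-trans (ℤ.≤-reflexive (trans (sym (ℤ.*-assoc (+ 2) (+ (16 ^ T)) (tail M τ))) (cong (ℤ._* tail M τ) (sym (ℤ.pos-* 2 (16 ^ T))))))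
        (ℤ.*-monoʳ-≤-nonNeg (tail M τ) {{ℤ.nonNegative (0≤tail M τ)}} (ℤ.+≤+ choices)))

      cast : + 64 ℤ.* (+ (N * suc S) ℤ.* (+ k ℤ.* + k)) ℤ.* (+ H ℤ.* + H ℤ.* + H) ≡ + (64 * (N * suc S * (k * k)) * (H * H * H))
      cast = sym (trans (ℤ.pos-* (64 * (N * suc S * (k * k))) (H * H * H)) (cong₂ ℤ._*_
        (trans (ℤ.pos-* 64 (N * suc S * (k * k))) (cong (+ 64 ℤ.*_) (trans (ℤ.pos-* (N * suc S) (k * k)) (cong (+ (N * suc S) ℤ.*_) (ℤ.pos-* k k)))))
        (trans (ℤ.pos-* (H * H) H) (cong (ℤ._* + H) (ℤ.pos-* H H)))))

      -- Inserting N ≤ 64Tℓ² makes both sides equal, which is the origin of 4096 = 64 · 64 in `C`.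
      τ²-large : 64 * (N * suc S * (k * k)) * (H * H * H) ≤ T * ℓ * (T * ℓ)
      τ²-large = ℕ.≤-trans (ℕ.≤-reflexive (eq N (suc S) k (H * H * H))) (ℕ.≤-trans
        (ℕ.*-monoʳ-≤ (64 * suc S * (k * k) * (H * H * H)) (proj₂ (proj₂ (proj₂ root))))
        (ℕ.≤-reflexive (eq′ (suc S) k (H * H * H) ℓ)))
        where
        eq : ∀ N S k h → 64 * (N * S * (k * k)) * h ≡ 64 * S * (k * k) * h * N
        eq = solve-∀
        eq′ : ∀ S k h l → 64 * S * (k * k) * h * (16 * (4096 * h * S * (k * k)) * (4 * (l * l)))
          ≡ 4096 * h * S * (k * k) * l * (4096 * h * S * (k * k) * l)
        eq′ = solve-∀

-- The exponential series at rational arguments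

module Exponential where
  open import Data.Rational.Base using (_+_; _*_; _-_; -_; _≤_; _<_; ↥_)
  open RingSolver using (solve-∀)

  ℚ-ring : AlmostCommutativeRing 0ℓ 0ℓ
  ℚ-ring = fromCommutativeRing ℚ.+-*-commutativeRing (λ x → dec⇒maybe (0ℚ ℚ.≟ x))

  ι : ℕ → ℚ
  ι n = + n ℚ./ 1

  /-toℚᵘ : ∀ i n → toℚᵘ (i ℚ./ suc n) ℚᵘ.≃ mkℚᵘ i n
  /-toℚᵘ i n = ℚ.toℚᵘ-fromℚᵘ (mkℚᵘ i n)

  ι-+ : ∀ m n → ι (m ℕ.+ n) ≡ ι m + ι n
  ι-+ m n = ℚ.toℚᵘ-injective (begin
    toℚᵘ (ι (m ℕ.+ n))                ≈⟨ /-toℚᵘ (+ (m ℕ.+ n)) 0 ⟩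
    mkℚᵘ (+ (m ℕ.+ n)) 0              ≈⟨ *≡* (cong (ℤ._* + 1) (sym (cong₂ ℤ._+_ (ℤ.*-identityʳ (+ m)) (ℤ.*-identityʳ (+ n))))) ⟩
    mkℚᵘ (+ m) 0 ℚᵘ.+ mkℚᵘ (+ n) 0    ≈⟨ ℚᵘ.+-cong (ℚᵘ.≃-sym (/-toℚᵘ (+ m) 0)) (ℚᵘ.≃-sym (/-toℚᵘ (+ n) 0)) ⟩
    toℚᵘ (ι m) ℚᵘ.+ toℚᵘ (ι n)        ≈⟨ ℚᵘ.≃-sym (ℚ.toℚᵘ-homo-+ (ι m) (ι n)) ⟩
    toℚᵘ (ι m + ι n)                   ∎)
    where open ℚᵘ.≃-Reasoning

  ι-* : ∀ m n → ι (m ℕ.* n) ≡ ι m * ι n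
  ι-* m n = ℚ.toℚᵘ-injective (begin
    toℚᵘ (ι (m ℕ.* n))                ≈⟨ /-toℚᵘ (+ (m ℕ.* n)) 0 ⟩
    mkℚᵘ (+ (m ℕ.* n)) 0              ≈⟨ *≡* (cong (ℤ._* + 1) (ℤ.pos-* m n)) ⟩
    mkℚᵘ (+ m) 0 ℚᵘ.* mkℚᵘ (+ n) 0    ≈⟨ ℚᵘ.*-cong (ℚᵘ.≃-sym (/-toℚᵘ (+ m) 0)) (ℚᵘ.≃-sym (/-toℚᵘ (+ n) 0)) ⟩
    toℚᵘ (ι m) ℚᵘ.* toℚᵘ (ι n)        ≈⟨ ℚᵘ.≃-sym (ℚ.toℚᵘ-homo-* (ι m) (ι n)) ⟩
    toℚᵘ (ι m * ι n)                   ∎)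
    where open ℚᵘ.≃-Reasoning

  ι-mono-≤ : ∀ {m n} → m ℕ.≤ n → ι m ≤ ι n
  ι-mono-≤ {m} {n} m≤n = ℚ.toℚᵘ-cancel-≤ (ℚᵘ.≤-respˡ-≃ (ℚᵘ.≃-sym (/-toℚᵘ (+ m) 0)) (ℚᵘ.≤-respʳ-≃ (ℚᵘ.≃-sym (/-toℚᵘ (+ n) 0))
    (*≤* (ℤ.*-monoʳ-≤-nonNeg (+ 1) (ℤ.+≤+ m≤n)))))

  ι-cancel-< : ∀ {m n} → ι m < ι n → m ℕ.< n
  ι-cancel-< {m} {n} ιm<ιn with m ℕ.<? n
  ... | yes m<n = m<n
  ... | no m≮n  = contradiction (ℚ.<-≤-trans ιm<ιn (ι-mono-≤ (ℕ.≮⇒≥ m≮n))) (ℚ.<-irrefl refl)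

  ι-*-/ : ∀ i n → ι (suc n) * (i ℚ./ suc n) ≡ i ℚ./ 1
  ι-*-/ i n = ℚ.toℚᵘ-injective (begin
    toℚᵘ (ι (suc n) * (i ℚ./ suc n))            ≈⟨ ℚ.toℚᵘ-homo-* (ι (suc n)) (i ℚ./ suc n) ⟩
    toℚᵘ (ι (suc n)) ℚᵘ.* toℚᵘ (i ℚ./ suc n)    ≈⟨ ℚᵘ.*-cong (/-toℚᵘ (+ suc n) 0) (/-toℚᵘ i n) ⟩
    mkℚᵘ (+ suc n) 0 ℚᵘ.* mkℚᵘ i n              ≈⟨ *≡* (trans (ℤ.*-identityʳ (+ suc n ℤ.* i)) (trans (ℤ.*-comm (+ suc n) i) (cong (ℤ._*_ i) (sym (ℤ.*-identityˡ (+ suc n)))))) ⟩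
    mkℚᵘ i 0                                    ≈⟨ ℚᵘ.≃-sym (/-toℚᵘ i 0) ⟩
    toℚᵘ (i ℚ./ 1)                              ∎)
    where open ℚᵘ.≃-Reasoning

  0≤ι : ∀ n → 0ℚ ≤ ι n
  0≤ι n = ι-mono-≤ {0} {n} ℕ.z≤n

  0<ι : ∀ n → 0ℚ < ι (suc n)
  0<ι n = ℚ.<-≤-trans (ℚ.*<* (ℤ.+<+ (ℕ.s≤s ℕ.z≤n))) (ι-mono-≤ {1} {suc n} (ℕ.s≤s ℕ.z≤n))

  archimedean : ∀ q → ∃ λ n → q ≤ ι n
  archimedean q@(ℚ.mkℚ _ d _) = ℤ.∣ ↥ q ∣ , ℚ.toℚᵘ-cancel-≤ (ℚᵘ.≤-respʳ-≃ (ℚᵘ.≃-sym (/-toℚᵘ (+ ℤ.∣ ↥ q ∣) 0)) (*≤* (bound (↥ q) d)))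
    where
    bound : ∀ i d → i ℤ.* + 1 ℤ.≤ + ℤ.∣ i ∣ ℤ.* + suc d
    bound (+ n)    d = subst₂ ℤ._≤_ (ℤ.pos-* n 1) (ℤ.pos-* n (suc d)) (ℤ.+≤+ (ℕ.*-monoʳ-≤ n (ℕ.s≤s ℕ.z≤n)))
    bound -[1+ n ] d = ℤ.-≤+

  ≤-by : ∀ {p q} d → 0ℚ ≤ d → p + d ≡ q → p ≤ q
  ≤-by {p} d 0≤d eq = subst₂ _≤_ (ℚ.+-identityʳ p) eq (ℚ.+-monoʳ-≤ p 0≤d)

  0≤q-p : ∀ {p q} → p ≤ q → 0ℚ ≤ q - p
  0≤q-p {p} {q} p≤q = subst (_≤ q - p) (ℚ.+-inverseʳ p) (ℚ.+-monoˡ-≤ (- p) p≤q)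

  *-monoˡ-≤ : ∀ {r p q} → 0ℚ ≤ r → p ≤ q → r * p ≤ r * q
  *-monoˡ-≤ {r} 0≤r p≤q = ℚ.*-monoˡ-≤-nonNeg r {{ℚ.nonNegative 0≤r}} p≤q

  *-monoʳ-≤ : ∀ {r p q} → 0ℚ ≤ r → p ≤ q → p * r ≤ q * r
  *-monoʳ-≤ {r} 0≤r p≤q = ℚ.*-monoʳ-≤-nonNeg r {{ℚ.nonNegative 0≤r}} p≤q

  0≤* : ∀ {p q} → 0ℚ ≤ p → 0ℚ ≤ q → 0ℚ ≤ p * q
  0≤* {p} {q} 0≤p 0≤q = subst (_≤ p * q) (ℚ.*-zeroʳ p) (*-monoˡ-≤ 0≤p 0≤q)

  *-cancelˡ-≤ : ∀ {r p q} → 0ℚ < r → r * p ≤ r * q → p ≤ q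
  *-cancelˡ-≤ {r} 0<r = ℚ.*-cancelˡ-≤-pos r {{ℚ.positive 0<r}}

  *-cancelˡ-≡ : ∀ {r p q} → 0ℚ < r → r * p ≡ r * q → p ≡ q
  *-cancelˡ-≡ 0<r eq = ℚ.≤-antisym (*-cancelˡ-≤ 0<r (ℚ.≤-reflexive eq)) (*-cancelˡ-≤ 0<r (ℚ.≤-reflexive (sym eq)))

  ι-suc-*-expTerm : ∀ q i → ι (suc i) * expTerm q (suc i) ≡ q * expTerm q i
  ι-suc-*-expTerm q i = trans (eq (ι (suc i)) (expTerm q i) q (+ 1 ℚ./ suc i))
    (trans (cong (λ x → q * expTerm q i * x) (ι-*-/ (+ 1) i)) (ℚ.*-identityʳ _))
    where
    eq : ∀ n e q r → n * (e * q * r) ≡ q * e * (n * r)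
    eq = solve-∀ ℚ-ring

  0≤/ : ∀ n → 0ℚ ≤ + 1 ℚ./ suc n
  0≤/ n = *-cancelˡ-≤ (0<ι n) (subst₂ _≤_ (sym (ℚ.*-zeroʳ (ι (suc n)))) (sym (ι-*-/ (+ 1) n)) (0≤ι 1))

  0≤expTerm : ∀ {q} → 0ℚ ≤ q → ∀ i → 0ℚ ≤ expTerm q i
  0≤expTerm 0≤q zero    = 0≤ι 1
  0≤expTerm 0≤q (suc i) = 0≤* (0≤* (0≤expTerm 0≤q i) 0≤q) (0≤/ i)

  p≤p+q : ∀ p {q} → 0ℚ ≤ q → p ≤ p + q
  p≤p+q p {q} 0≤q = ≤-by q 0≤q refl

  expSum-mono : ∀ {q} → 0ℚ ≤ q → ∀ {m n} → m ℕ.≤′ n → expSum q m ≤ expSum q n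
  expSum-mono 0≤q ℕ.≤′-refl       = ℚ.≤-refl
  expSum-mono 0≤q (ℕ.≤′-step {n} m≤n) = ℚ.≤-trans (expSum-mono 0≤q m≤n) (p≤p+q _ (0≤expTerm 0≤q n))

  0≤expSum : ∀ {q} → 0ℚ ≤ q → ∀ n → 0ℚ ≤ expSum q n
  0≤expSum 0≤q n = expSum-mono 0≤q (ℕ.≤⇒≤′ (ℕ.z≤n {n}))

  expTerm≤expSum : ∀ {q} → 0ℚ ≤ q → ∀ {i n} → i ℕ.< n → expTerm q i ≤ expSum q n
  expTerm≤expSum {q} 0≤q {i} i<n = ℚ.≤-trans
    (≤-by (expSum q i) (0≤expSum 0≤q i) (ℚ.+-comm (expTerm q i) (expSum q i))) (expSum-mono 0≤q (ℕ.≤⇒≤′ i<n))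

  -- From the index n₀ on, each term is at most half of its predecessor.
  expSum-bounded : ∀ {q} n₀ → 0ℚ ≤ q → q + q ≤ ι (suc n₀) → ∀ n → expSum q n ≤ expSum q n₀ + (expTerm q n₀ + expTerm q n₀)
  expSum-bounded {q} n₀ 0≤q 2q≤ n with ℕ.≤-total n n₀
  ... | inj₁ n≤n₀ = ℚ.≤-trans (expSum-mono 0≤q (ℕ.≤⇒≤′ n≤n₀)) (p≤p+q _ (ℚ.+-mono-≤ (0≤expTerm 0≤q n₀) (0≤expTerm 0≤q n₀)))
  ... | inj₂ n₀≤n = ℚ.≤-trans (p≤p+q _ (ℚ.+-mono-≤ (0≤expTerm 0≤q n) (0≤expTerm 0≤q n))) (decreasing (ℕ.≤⇒≤′ n₀≤n))
    where
    halving : ∀ {n} → n₀ ℕ.≤ n → expTerm q (suc n) + expTerm q (suc n) ≤ expTerm q n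
    halving {n} n₀≤n = *-cancelˡ-≤ (0<ι n) (begin
      ι (suc n) * (expTerm q (suc n) + expTerm q (suc n))  ≡⟨ ℚ.*-distribˡ-+ (ι (suc n)) _ _ ⟩
      ι (suc n) * expTerm q (suc n) + ι (suc n) * expTerm q (suc n) ≡⟨ cong₂ _+_ (ι-suc-*-expTerm q n) (ι-suc-*-expTerm q n) ⟩
      q * expTerm q n + q * expTerm q n                    ≡⟨ sym (ℚ.*-distribʳ-+ (expTerm q n) q q) ⟩
      (q + q) * expTerm q n                                ≤⟨ *-monoʳ-≤ (0≤expTerm 0≤q n) (ℚ.≤-trans 2q≤ (ι-mono-≤ (ℕ.s≤s n₀≤n))) ⟩
      ι (suc n) * expTerm q n                              ∎)
      where open ℚ.≤-Reasoning
    decreasing : ∀ {n} → n₀ ℕ.≤′ n → expSum q n + (expTerm q n + expTerm q n) ≤ expSum q n₀ + (expTerm q n₀ + expTerm q n₀)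
    decreasing ℕ.≤′-refl = ℚ.≤-refl
    decreasing (ℕ.≤′-step {n} n₀≤n) = ℚ.≤-trans
      (ℚ.≤-trans (ℚ.+-monoʳ-≤ (expSum q n + expTerm q n) (halving (ℕ.≤′⇒≤ n₀≤n))) (ℚ.≤-reflexive (ℚ.+-assoc (expSum q n) (expTerm q n) (expTerm q n))))
      (decreasing n₀≤n)

  abstract
    expSum-bound : ∀ {q} → 0ℚ ≤ q → ∃ λ b → ∀ n → expSum q n ≤ ι b
    expSum-bound {q} 0≤q with archimedean (q + q)
    ... | m , 2q≤m with archimedean (expSum q m + (expTerm q m + expTerm q m))
    ... | b , ≤b = b , λ n → ℚ.≤-trans (expSum-bounded m 0≤q (ℚ.≤-trans 2q≤m (ι-mono-≤ (ℕ.n≤1+n m))) n) ≤b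

    -- By the recursion the left side is q times the preceding term, which is bounded by the partial
    -- sums. Decay of order 1/i is enough for `expSum-limit-≤`.
    expTerm-decay : ∀ {q} → 0ℚ ≤ q → ∃ λ b → ∀ i → ι (suc i) * expTerm q (suc i) ≤ ι b
    expTerm-decay {q} 0≤q with archimedean q | expSum-bound 0≤q
    ... | a , q≤a | b , ≤b = a ℕ.* b , λ i → begin
      ι (suc i) * expTerm q (suc i) ≡⟨ ι-suc-*-expTerm q i ⟩
      q * expTerm q i               ≤⟨ *-monoʳ-≤ (0≤expTerm 0≤q i) q≤a ⟩
      ι a * expTerm q i             ≤⟨ *-monoˡ-≤ (0≤ι a) (ℚ.≤-trans (expTerm≤expSum 0≤q (ℕ.n<1+n i)) (≤b (suc i))) ⟩
      ι a * ι b                     ≡⟨ sym (ι-* a b) ⟩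
      ι (a ℕ.* b)                   ∎
      where open ℚ.≤-Reasoning

  -- The coefficients of the Cauchy product of two power series.
  conv : (ℕ → ℚ) → (ℕ → ℚ) → ℕ → ℚ
  conv f g zero    = f 0 * g 0
  conv f g (suc n) = f 0 * g (suc n) + conv (λ i → f (suc i)) g n

  conv-cong : ∀ {f f′ g g′ : ℕ → ℚ} → (∀ i → f i ≡ f′ i) → (∀ i → g i ≡ g′ i) → ∀ n → conv f g n ≡ conv f′ g′ n
  conv-cong f≡ g≡ zero    = cong₂ _*_ (f≡ 0) (g≡ 0)
  conv-cong f≡ g≡ (suc n) = cong₂ _+_ (cong₂ _*_ (f≡ 0) (g≡ (suc n))) (conv-cong (λ i → f≡ (suc i)) g≡ n)

  conv-+ˡ : ∀ f f′ g n → conv (λ i → f i + f′ i) g n ≡ conv f g n + conv f′ g n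
  conv-+ˡ f f′ g zero    = ℚ.*-distribʳ-+ (g 0) (f 0) (f′ 0)
  conv-+ˡ f f′ g (suc n) = trans (cong (_+_ ((f 0 + f′ 0) * g (suc n))) (conv-+ˡ _ _ g n)) (eq (f 0) (f′ 0) (g (suc n)) _ _)
    where
    eq : ∀ a b c d e → (a + b) * c + (d + e) ≡ (a * c + d) + (b * c + e)
    eq = solve-∀ ℚ-ring

  conv-+ʳ : ∀ f g g′ n → conv f (λ i → g i + g′ i) n ≡ conv f g n + conv f g′ n
  conv-+ʳ f g g′ zero    = ℚ.*-distribˡ-+ (f 0) (g 0) (g′ 0)
  conv-+ʳ f g g′ (suc n) = trans (cong (_+_ (f 0 * (g (suc n) + g′ (suc n)))) (conv-+ʳ _ g g′ n)) (eq (f 0) (g (suc n)) (g′ (suc n)) _ _)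
    where
    eq : ∀ a b c d e → a * (b + c) + (d + e) ≡ (a * b + d) + (a * c + e)
    eq = solve-∀ ℚ-ring

  conv-*ˡ : ∀ x f g n → conv (λ i → x * f i) g n ≡ x * conv f g n
  conv-*ˡ x f g zero    = ℚ.*-assoc x (f 0) (g 0)
  conv-*ˡ x f g (suc n) = trans (cong (_+_ (x * f 0 * g (suc n))) (conv-*ˡ x _ g n)) (eq x (f 0) (g (suc n)) _)
    where
    eq : ∀ x a b c → x * a * b + x * c ≡ x * (a * b + c)
    eq = solve-∀ ℚ-ring

  conv-*ʳ : ∀ x f g n → conv f (λ i → x * g i) n ≡ x * conv f g n
  conv-*ʳ x f g zero    = eq x (f 0) (g 0)
    where
    eq : ∀ x a b → a * (x * b) ≡ x * (a * b)
    eq = solve-∀ ℚ-ring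
  conv-*ʳ x f g (suc n) = trans (cong (_+_ (f 0 * (x * g (suc n)))) (conv-*ʳ x _ g n)) (eq x (f 0) (g (suc n)) _)
    where
    eq : ∀ x a b c → a * (x * b) + x * c ≡ x * (a * b + c)
    eq = solve-∀ ℚ-ring

  conv-0ʳ : ∀ f g → g 0 ≡ 0ℚ → ∀ n → conv f g (suc n) ≡ conv f (λ i → g (suc i)) n
  conv-0ʳ f g g0 zero    = trans (cong (λ x → f 0 * g 1 + f 1 * x) g0) (eq (f 0) (g 1) (f 1))
    where
    eq : ∀ a b c → a * b + c * 0ℚ ≡ a * b
    eq = solve-∀ ℚ-ring
  conv-0ʳ f g g0 (suc n) = cong (_+_ (f 0 * g (2 ℕ.+ n))) (conv-0ʳ (λ i → f (suc i)) g g0 n)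

  conv-0ˡ : ∀ f g → f 0 ≡ 0ℚ → ∀ n → conv f g (suc n) ≡ conv (λ i → f (suc i)) g n
  conv-0ˡ f g f0 n = trans (cong (λ x → x * g (suc n) + conv (λ i → f (suc i)) g n) f0)
    (trans (cong (_+ conv (λ i → f (suc i)) g n) (ℚ.*-zeroˡ (g (suc n)))) (ℚ.+-identityˡ _))

  ι-suc : ∀ n → ι (suc n) ≡ 1ℚ + ι n
  ι-suc n = ι-+ 1 n

  -- The Leibniz rule for the Euler operator z d/dz, which multiplies the coefficient of zⁿ by n.
  conv-Euler : ∀ f g n → ι n * conv f g n ≡ conv (λ i → ι i * f i) g n + conv f (λ i → ι i * g i) n
  conv-Euler f g zero    = eq (f 0) (g 0)
    where
    eq : ∀ a b → 0ℚ * (a * b) ≡ 0ℚ * a * b + a * (0ℚ * b)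
    eq = solve-∀ ℚ-ring
  conv-Euler f g (suc n) = begin
    ι (suc n) * (f 0 * g (suc n) + conv f₁ g n)
      ≡⟨ cong (λ x → x * (f 0 * g (suc n) + conv f₁ g n)) (ι-suc n) ⟩
    (1ℚ + ι n) * (f 0 * g (suc n) + conv f₁ g n)
      ≡⟨ eq₁ (ι n) (f 0) (g (suc n)) (conv f₁ g n) ⟩
    f 0 * ((1ℚ + ι n) * g (suc n)) + (conv f₁ g n + ι n * conv f₁ g n)
      ≡⟨ cong (λ x → f 0 * ((1ℚ + ι n) * g (suc n)) + (conv f₁ g n + x)) (conv-Euler f₁ g n) ⟩
    f 0 * ((1ℚ + ι n) * g (suc n)) + (conv f₁ g n + (conv (λ i → ι i * f₁ i) g n + conv f₁ (λ i → ι i * g i) n))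
      ≡⟨ eq₂ (f 0) (g (suc n)) (ι n) (conv f₁ g n) (conv (λ i → ι i * f₁ i) g n) (conv f₁ (λ i → ι i * g i) n) ⟩
    (0ℚ * f 0 * g (suc n) + (conv f₁ g n + conv (λ i → ι i * f₁ i) g n)) + (f 0 * ((1ℚ + ι n) * g (suc n)) + conv f₁ (λ i → ι i * g i) n)
      ≡⟨ cong₂ (λ x y → (0ℚ * f 0 * g (suc n) + x) + (f 0 * (y * g (suc n)) + conv f₁ (λ i → ι i * g i) n))
           (trans (sym (conv-+ˡ f₁ (λ i → ι i * f₁ i) g n)) (conv-cong {g = g} (λ i → trans (eq₃ (f₁ i) (ι i)) (cong (_* f₁ i) (sym (ι-suc i)))) (λ _ → refl) n)) (sym (ι-suc n)) ⟩
    (0ℚ * f 0 * g (suc n) + conv (λ i → ι (suc i) * f₁ i) g n) + (f 0 * (ι (suc n) * g (suc n)) + conv f₁ (λ i → ι i * g i) n) ∎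
    where
    open ≡-Reasoning
    f₁ : ℕ → ℚ
    f₁ i = f (suc i)
    eq₁ : ∀ n a b c → (1ℚ + n) * (a * b + c) ≡ a * ((1ℚ + n) * b) + (c + n * c)
    eq₁ = solve-∀ ℚ-ring
    eq₂ : ∀ a b n c d e → a * ((1ℚ + n) * b) + (c + (d + e)) ≡ (0ℚ * a * b + (c + d)) + (a * ((1ℚ + n) * b) + e)
    eq₂ = solve-∀ ℚ-ring
    eq₃ : ∀ x n → x + n * x ≡ (1ℚ + n) * x
    eq₃ = solve-∀ ℚ-ring

  -- The binomial theorem, by the Euler operator: both sides c satisfy (n + 1) c (n + 1) = (x + y) c n.
  conv-expTerm : ∀ x y n → conv (expTerm x) (expTerm y) n ≡ expTerm (x + y) n
  conv-expTerm x y zero    = refl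
  conv-expTerm x y (suc n) = *-cancelˡ-≡ (0<ι n) (begin
    ι (suc n) * conv (expTerm x) (expTerm y) (suc n)
      ≡⟨ conv-Euler (expTerm x) (expTerm y) (suc n) ⟩
    conv (λ i → ι i * expTerm x i) (expTerm y) (suc n) + conv (expTerm x) (λ i → ι i * expTerm y i) (suc n)
      ≡⟨ cong₂ _+_
           (trans (conv-0ˡ (λ i → ι i * expTerm x i) (expTerm y) refl n) (trans (conv-cong {g = expTerm y} (ι-suc-*-expTerm x) (λ _ → refl) n) (conv-*ˡ x (expTerm x) (expTerm y) n)))
           (trans (conv-0ʳ (expTerm x) (λ i → ι i * expTerm y i) refl n) (trans (conv-cong {f = expTerm x} (λ _ → refl) (ι-suc-*-expTerm y) n) (conv-*ʳ y (expTerm x) (expTerm y) n))) ⟩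
    x * conv (expTerm x) (expTerm y) n + y * conv (expTerm x) (expTerm y) n
      ≡⟨ sym (ℚ.*-distribʳ-+ (conv (expTerm x) (expTerm y) n) x y) ⟩
    (x + y) * conv (expTerm x) (expTerm y) n
      ≡⟨ cong ((x + y) *_) (conv-expTerm x y n) ⟩
    (x + y) * expTerm (x + y) n
      ≡⟨ sym (ι-suc-*-expTerm (x + y) n) ⟩
    ι (suc n) * expTerm (x + y) (suc n) ∎)
    where open ≡-Reasoning

  -- The generating function of `expSum y` in z is z exp(yz) / (1 - z), and multiplying it by
  -- exp(xz) replaces y by x + y. The functional equation thus holds exactly for partial sums,
  -- without a remainder.
  conv-expSum : ∀ x y n → conv (expTerm x) (expSum y) n ≡ expSum (x + y) n
  conv-expSum x y zero    = refl
  conv-expSum x y (suc n) = trans (conv-0ʳ (expTerm x) (expSum y) refl n)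
    (trans (conv-+ʳ (expTerm x) (expSum y) (expTerm y) n) (cong₂ _+_ (conv-expSum x y n) (conv-expTerm x y n)))

  conv-≥ : ∀ {f g : ℕ → ℚ} {G x} → 0ℚ ≤ G → (∀ i → 0ℚ ≤ f i) → (∀ i → - G ≤ g i) → (∀ i → f i * G ≤ x) →
    ∀ n → - (ι (suc n) * x) ≤ conv f g n
  conv-≥ {f} {g} {G} {x} 0≤G 0≤f -G≤g fG≤x n = ind n f 0≤f fG≤x
    where
    step : ∀ {a b} → 0ℚ ≤ a → - G ≤ b → a * G ≤ x → - x ≤ a * b
    step {a} {b} 0≤a -G≤b aG≤x = ℚ.≤-trans (ℚ.neg-antimono-≤ aG≤x) (subst (_≤ a * b) (sym (ℚ.neg-distribʳ-* a G)) (*-monoˡ-≤ 0≤a -G≤b))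
    ind : ∀ n f → (∀ i → 0ℚ ≤ f i) → (∀ i → f i * G ≤ x) → - (ι (suc n) * x) ≤ conv f g n
    ind zero    f 0≤f fG≤x = subst (_≤ f 0 * g 0) (cong -_ (sym (ℚ.*-identityˡ x))) (step (0≤f 0) (-G≤g 0) (fG≤x 0))
    ind (suc n) f 0≤f fG≤x = ℚ.≤-trans (ℚ.≤-reflexive (trans (cong (λ y → - (y * x)) (ι-suc (suc n))) (eq (ι (suc n)) x)))
      (ℚ.+-mono-≤ (step (0≤f 0) (-G≤g (suc n)) (fG≤x 0)) (ind n (λ i → f (suc i)) (λ i → 0≤f (suc i)) (λ i → fG≤x (suc i))))
      where
      eq : ∀ n x → - ((1ℚ + n) * x) ≡ - x + - (n * x)
      eq = solve-∀ ℚ-ring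

  -- The omitted first j terms involve g only at indices above m, where it is nonnegative.
  conv-drop : ∀ {f g : ℕ → ℚ} {m} → (∀ i → 0ℚ ≤ f i) → (∀ i → m ℕ.≤ i → 0ℚ ≤ g i) →
    ∀ j → conv (λ i → f (j ℕ.+ i)) g m ≤ conv f g (j ℕ.+ m)
  conv-drop         0≤f 0≤g zero    = ℚ.≤-refl
  conv-drop {f} {g} {m} 0≤f 0≤g (suc j) = ℚ.≤-trans (conv-drop (λ i → 0≤f (suc i)) 0≤g j)
    (≤-by (f 0 * g (suc j ℕ.+ m)) (0≤* (0≤f 0) (0≤g _ (ℕ.m≤n+m m (suc j)))) (ℚ.+-comm (conv (λ i → f (suc i)) g (j ℕ.+ m)) _))

  below : ∀ (g : ℕ → ℚ) m → (∀ i → m ℕ.≤ i → 0ℚ ≤ g i) → ∃ λ b → ∀ i → - ι b ≤ g i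
  below g zero    0≤g = 0 , λ i → 0≤g i ℕ.z≤n
  below g (suc m) 0≤g with below (λ i → g (suc i)) m (λ i m≤i → 0≤g (suc i) (ℕ.s≤s m≤i)) | archimedean (- g 0)
  ... | b , b≤ | a , ≤a = a ℕ.+ b , λ
    { zero    → ℚ.≤-trans (ℚ.neg-antimono-≤ (ℚ.≤-trans ≤a (ι-mono-≤ (ℕ.m≤m+n a b)))) (ℚ.≤-reflexive (neg-neg (g 0)))
    ; (suc i) → ℚ.≤-trans (ℚ.neg-antimono-≤ (ι-mono-≤ (ℕ.m≤n+m b a))) (b≤ i)
    }
    where
    neg-neg : ∀ x → - (- x) ≡ x
    neg-neg = solve-∀ ℚ-ring

  -- The partial sums at a very negative q are large before they become small.  Since q ≤ p they are
  -- compared with those at p through exp p = exp (p - q) exp q, where the terms of exp (p - q) are positive.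
  expSum-limit-≤ : ∀ {p q y V} m → q ≤ p → (∀ n → expSum p n ≤ V) → 0ℚ ≤ y → (∀ n → m ℕ.≤ n → y ≤ expSum q n) → y ≤ V + ½
  expSum-limit-≤ {p} {q} {y} {V} m q≤p ≤V 0≤y y≤ = result
    where
    open ℚ.≤-Reasoning
    h : ℚ
    h = p - q
    0≤h : 0ℚ ≤ h
    0≤h = 0≤q-p q≤p
    g c : ℕ → ℚ
    g = expSum q
    c = expTerm h
    0≤g : ∀ i → m ℕ.≤ i → 0ℚ ≤ g i
    0≤g i m≤i = ℚ.≤-trans 0≤y (y≤ i m≤i)
    G D j : ℕ
    G = proj₁ (below g m 0≤g)
    D = proj₁ (expTerm-decay 0≤h)
    -- Since c i ≤ D/i, this makes c i · G at most x = 1/(2(m + 1)) for i > j. The m + 1 terms in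
    -- which `g` may be negative, each at least -G, then lose at most ½ together.
    j = 2 ℕ.* suc m ℕ.* G ℕ.* D
    x : ℚ
    x = ½ * (+ 1 ℚ./ suc m)
    2mx : ι (2 ℕ.* suc m) * x ≡ 1ℚ
    2mx = trans (cong (_* x) (ι-* 2 (suc m))) (trans (eq (ι 2) (ι (suc m)) ½ (+ 1 ℚ./ suc m)) (cong (ι 2 * ½ *_) (ι-*-/ (+ 1) m)))
      where
      eq : ∀ a b c d → a * b * (c * d) ≡ a * c * (b * d)
      eq = solve-∀ ℚ-ring
    small : ∀ i → c (suc (j ℕ.+ i)) * ι G ≤ x
    small i = *-cancelˡ-≤ (0<ι (m ℕ.+ suc (m ℕ.+ 0))) (*-cancelˡ-≤ (0<ι (j ℕ.+ i)) (begin
      ι (suc (j ℕ.+ i)) * (ι (2 ℕ.* suc m) * (c (suc (j ℕ.+ i)) * ι G))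
        ≡⟨ eq (ι (suc (j ℕ.+ i))) (ι (2 ℕ.* suc m)) (c (suc (j ℕ.+ i))) (ι G) ⟩
      ι (2 ℕ.* suc m) * ι G * (ι (suc (j ℕ.+ i)) * c (suc (j ℕ.+ i)))
        ≤⟨ *-monoˡ-≤ (0≤* (0≤ι (2 ℕ.* suc m)) (0≤ι G)) (proj₂ (expTerm-decay 0≤h) (j ℕ.+ i)) ⟩
      ι (2 ℕ.* suc m) * ι G * ι D
        ≡⟨ sym (trans (ι-* (2 ℕ.* suc m ℕ.* G) D) (cong (_* ι D) (ι-* (2 ℕ.* suc m) G))) ⟩
      ι j
        ≤⟨ ι-mono-≤ (ℕ.≤-trans (ℕ.m≤m+n j i) (ℕ.n≤1+n _)) ⟩
      ι (suc (j ℕ.+ i))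
        ≡⟨ sym (trans (cong (ι (suc (j ℕ.+ i)) *_) 2mx) (ℚ.*-identityʳ _)) ⟩
      ι (suc (j ℕ.+ i)) * (ι (2 ℕ.* suc m) * x) ∎))
      where
      eq : ∀ a b c d → a * (b * (c * d)) ≡ b * d * (a * c)
      eq = solve-∀ ℚ-ring
    mx : ι (suc m) * x ≡ ½
    mx = trans (eq (ι (suc m)) ½ (+ 1 ℚ./ suc m)) (trans (cong (½ *_) (ι-*-/ (+ 1) m)) (ℚ.*-identityʳ ½))
      where
      eq : ∀ a b c → a * (b * c) ≡ b * (a * c)
      eq = solve-∀ ℚ-ring
    result : y ≤ V + ½
    result = begin
      y
        ≡⟨ eq y ½ ⟩
      1ℚ * y + - ½ + ½
        -- The convolution consists of the term at 0, which is at least y because c 0 = 1, of j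
        -- nonnegative terms, and of m + 1 terms with sum at least -½.
        ≤⟨ ℚ.+-monoˡ-≤ ½ (ℚ.+-mono-≤ (*-monoˡ-≤ (0≤ι 1) (y≤ (suc j ℕ.+ m) (ℕ.m≤n+m m (suc j))))
             (ℚ.≤-trans (ℚ.≤-reflexive (cong -_ (sym mx))) (ℚ.≤-trans
               (conv-≥ {f = λ i → c (suc (j ℕ.+ i))} {g} {ι G} {x} (0≤ι G) (λ i → 0≤expTerm 0≤h (suc (j ℕ.+ i))) (proj₂ (below g m 0≤g)) small m)
               (conv-drop {f = λ i → c (suc i)} {g} {m} (λ i → 0≤expTerm 0≤h (suc i)) 0≤g j)))) ⟩
      conv c g (suc j ℕ.+ m) + ½
        ≡⟨ cong (_+ ½) (trans (conv-expSum h q (suc j ℕ.+ m)) (cong (λ z → expSum z (suc j ℕ.+ m)) (eq′ p q))) ⟩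
      expSum p (suc j ℕ.+ m) + ½
        ≤⟨ ℚ.+-monoˡ-≤ ½ (≤V (suc j ℕ.+ m)) ⟩
      V + ½ ∎
      where
      eq : ∀ y h → y ≡ 1ℚ * y + - h + h
      eq = solve-∀ ℚ-ring
      eq′ : ∀ p q → (p - q) + q ≡ p
      eq′ = solve-∀ ℚ-ring

  -- Up to the index j each term is at least twice its predecessor, the quotient being u/i ≥ 2j/i.
  expTerm-≥ : ∀ {u} j → ι (2 ℕ.* j) ≤ u → ∀ i → i ℕ.≤ j → ι (2 ℕ.^ i) ≤ expTerm u i
  expTerm-≥ j 2j≤u zero    i≤j = ℚ.≤-refl
  expTerm-≥ {u} j 2j≤u (suc i) i<j = *-cancelˡ-≤ (0<ι i) (begin
    ι (suc i) * ι (2 ℕ.^ suc i)       ≡⟨ sym (ι-* (suc i) (2 ℕ.^ suc i)) ⟩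
    ι (suc i ℕ.* (2 ℕ.* 2 ℕ.^ i))     ≤⟨ ι-mono-≤ (ℕ.≤-trans (ℕ.≤-reflexive (eq (suc i) (2 ℕ.^ i))) (ℕ.*-monoˡ-≤ (2 ℕ.^ i) (ℕ.*-monoʳ-≤ 2 i<j))) ⟩
    ι (2 ℕ.* j ℕ.* 2 ℕ.^ i)           ≡⟨ ι-* (2 ℕ.* j) (2 ℕ.^ i) ⟩
    ι (2 ℕ.* j) * ι (2 ℕ.^ i)         ≤⟨ *-monoˡ-≤ (0≤ι (2 ℕ.* j)) (expTerm-≥ j 2j≤u i (ℕ.<⇒≤ i<j)) ⟩
    ι (2 ℕ.* j) * expTerm u i         ≤⟨ *-monoʳ-≤ (0≤expTerm 0≤u i) 2j≤u ⟩
    u * expTerm u i                   ≡⟨ sym (ι-suc-*-expTerm u i) ⟩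
    ι (suc i) * expTerm u (suc i)     ∎)
    where
    open ℚ.≤-Reasoning
    0≤u : 0ℚ ≤ u
    0≤u = ℚ.≤-trans (0≤ι (2 ℕ.* j)) 2j≤u
    eq : ∀ a b → a ℕ.* (2 ℕ.* b) ≡ 2 ℕ.* a ℕ.* b
    eq a b = trans (sym (ℕ.*-assoc a 2 b)) (cong (ℕ._* b) (ℕ.*-comm a 2))

  ι-+½ : ∀ n → ι n + ½ ≤ ι (1 ℕ.+ n)
  ι-+½ n = subst (ι n + ½ ≤_) (trans (ℚ.+-comm (ι n) 1ℚ) (sym (ι-+ 1 n))) (ℚ.+-monoʳ-≤ (ι n) {½} {1ℚ} (ℚ.*≤* (ℤ.+≤+ (ℕ.s≤s ℕ.z≤n))))

open import Defs
open RingSolver using (solve-∀)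
open Sums using (∑; ∑-sum; signs)
open Tails using (𝟙)
open Moments using (Concentrated; concentrated?; ∑-filter; unique-vecsOver)
open Choice using (badEvents; C; length-families; n<2^n)
open Exponential

-- Bounds for logarithms and the growth of k

abstract
  -- The bound is uniform in t, because it is applied to rationals above a logarithm for which only
  -- an upper bound is at hand.
  exp-bound : ∀ b → ∃ λ c → ∀ {t r} → t ℚ.≤ ι b → L (exp t) r → r ℚ.≤ ι c
  exp-bound b with expSum-bound (0≤ι b)
  ... | B , ≤B = suc B , bound
    where
    bound : ∀ {t r} → t ℚ.≤ ι b → L (exp t) r → r ℚ.≤ ι (suc B)
    bound {t} {r} t≤b (r′ , r<r′ , m , r′≤) with r′ ℚ.≤? 0ℚ
    ... | yes r′≤0 = ℚ.≤-trans (ℚ.<⇒≤ r<r′) (ℚ.≤-trans r′≤0 (0≤ι (suc B)))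
    ... | no r′≰0 = ℚ.≤-trans (ℚ.<⇒≤ r<r′) (ℚ.≤-trans
      (expSum-limit-≤ m t≤b ≤B (ℚ.<⇒≤ (ℚ.≰⇒> r′≰0)) r′≤) (ι-+½ B))

-- The single term of index j in the series at u ≥ 2j already reaches 2^j. The factor 2 lost against
-- the true logarithm is harmless.
exp-<-2^ : ∀ {u N} j → N ℕ.≤ 2 ℕ.^ j → exp u < fromℕ N → u ℚ.< ι (2 ℕ.* j)
exp-<-2^ {u} {N} j N≤2^j (q , (r , r<q , m , ≤r) , q<N) with u ℚ.<? ι (2 ℕ.* j)
... | yes u<2j = u<2j
... | no u≮2j = contradiction (begin-strict
    ι (2 ℕ.^ j)   ≤⟨ expTerm-≥ j 2j≤u j ℕ.≤-refl ⟩
    expTerm u j   ≤⟨ expTerm≤expSum (ℚ.≤-trans (0≤ι (2 ℕ.* j)) 2j≤u) (ℕ.m≤m+n (suc j) m) ⟩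
    expSum u (suc j ℕ.+ m) ≤⟨ ≤r (suc j ℕ.+ m) (ℕ.m≤n+m m (suc j)) ⟩
    r             <⟨ r<q ⟩
    q             <⟨ q<N ⟩
    ι N           ≤⟨ ι-mono-≤ N≤2^j ⟩
    ι (2 ℕ.^ j)   ∎) (ℚ.<-irrefl refl)
  where
  open ℚ.≤-Reasoning
  2j≤u = ℚ.≮⇒≥ u≮2j

-- The partial sums at 1/4 are at most 3/2.
2<exp⇒¼< : ∀ {t} → fromℕ 2 < exp t → ½ ℚ.* ½ ℚ.< t
2<exp⇒¼< {t} (q , 2<q , r , q<r , m , r≤) with ½ ℚ.* ½ ℚ.<? t
... | yes ¼<t = ¼<t
... | no ¼≮t = contradiction (ℚ.<-trans 2<q (ℚ.<-≤-trans q<r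
  (expSum-limit-≤ {V = + 3 ℚ./ 2} m (ℚ.≮⇒≥ ¼≮t) (expSum-bounded 1 (ℚ.*≤* (ℤ.+≤+ ℕ.z≤n)) (ℚ.*≤* (ℤ.+≤+ (ℕ.s≤s ℕ.z≤n))))
    (ℚ.≤-trans (0≤ι 2) (ℚ.<⇒≤ (ℚ.<-trans 2<q q<r))) r≤)))
  (ℚ.<-irrefl refl)

-- Crude estimates suffice, as N₀ may be chosen large: log S ≤ 2S because S ≤ 2^S, and log 2 ≥ 1/4.
log₂-bound : ∀ S {r} → L (log₂ (fromℕ S)) r → r ℚ.≤ ι (8 ℕ.* S)
log₂-bound S {r} (s , t , _ , 2<expt , _ , exprt<S) with r ℚ.≤? 0ℚ
... | yes r≤0 = ℚ.≤-trans r≤0 (0≤ι (8 ℕ.* S))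
... | no r≰0 = Exponential.*-cancelˡ-≤ {½ ℚ.* ½} (ℚ.*<* (ℤ.+<+ (ℕ.s≤s ℕ.z≤n))) (begin
  ½ ℚ.* ½ ℚ.* r           ≡⟨ ℚ.*-comm (½ ℚ.* ½) r ⟩
  r ℚ.* (½ ℚ.* ½)         ≤⟨ Exponential.*-monoˡ-≤ (ℚ.<⇒≤ (ℚ.≰⇒> r≰0)) (ℚ.<⇒≤ (2<exp⇒¼< 2<expt)) ⟩
  r ℚ.* t                 ≤⟨ ℚ.<⇒≤ (exp-<-2^ S (ℕ.<⇒≤ (n<2^n S)) exprt<S) ⟩
  ι (2 ℕ.* S)             ≡⟨ trans (sym (ℚ.*-identityˡ _)) (trans (ℚ.*-assoc (½ ℚ.* ½) (ι 4) (ι (2 ℕ.* S))) (cong (½ ℚ.* ½ ℚ.*_) (trans (sym (ι-* 4 (2 ℕ.* S))) (cong ι (sym (ℕ.*-assoc 4 2 S)))))) ⟩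
  ½ ℚ.* ½ ℚ.* ι (8 ℕ.* S) ∎)
  where open ℚ.≤-Reasoning

·-bound : ∀ n {x b} → (∀ {r} → L x r → r ℚ.≤ ι b) → ∀ {q} → L (n · x) q → q ℚ.≤ ι (n ℕ.* b)
·-bound zero    x≤b q<0 = ℚ.<⇒≤ q<0
·-bound (suc n) {b = b} x≤b (r , s , r<x , s<nx , refl) =
  ℚ.≤-trans (ℚ.+-mono-≤ (x≤b r<x) (·-bound n x≤b s<nx)) (ℚ.≤-reflexive (sym (ι-+ b (n ℕ.* b))))

between-powers-of-2 : ∀ N → ∃ λ i → 2 ℕ.^ i ℕ.≤ suc N × suc N ℕ.≤ 2 ℕ.^ suc i
between-powers-of-2 zero    = 0 , ℕ.≤-refl , ℕ.s≤s ℕ.z≤n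
between-powers-of-2 (suc N) with between-powers-of-2 N
... | i , 2^i≤ , ≤2^ with 2 ℕ.+ N ℕ.≤? 2 ℕ.^ suc i
... | yes ≤ = i , ℕ.≤-trans 2^i≤ (ℕ.n≤1+n (suc N)) , ≤
... | no ≰  = suc i , ℕ.<⇒≤ (ℕ.≰⇒> ≰) , ℕ.≤-trans (ℕ.s≤s ≤2^) (ℕ.≤-trans (ℕ.+-monoˡ-≤ (2 ℕ.^ suc i) (ℕ.m^n>0 2 (suc i)))
        (ℕ.≤-reflexive (cong (ℕ._+_ (2 ℕ.^ suc i)) (sym (ℕ.+-identityʳ (2 ℕ.^ suc i))))))

bitLength : ∀ {N} → 1 ℕ.≤ N → ∃ λ j → N ℕ.≤ 2 ℕ.^ j × (∀ m → m ℕ.< j → 2 ℕ.^ m ℕ.≤ N)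
bitLength {suc N} _ with between-powers-of-2 N
... | i , 2^i≤ , ≤2^ = suc i , ≤2^ , λ m m<suc-i → ℕ.≤-trans (ℕ.^-monoʳ-≤ 2 (ℕ.s≤s⁻¹ m<suc-i)) 2^i≤

-- The hypothesis on k is used only in the form k(N) = o(log N).
order-small : ∀ S B → ∃ λ N₁ → ∀ N k → N₁ ℕ.≤ N → 1 ℕ.≤ k →
  fromℕ k ≤ (log (fromℕ N) + log (fromℕ S)) / log (log (fromℕ N)) → 2 ℕ.^ (B ℕ.* k) ℕ.≤ N
order-small S B = suc (S ℕ.+ F) , conclusion
  where
  F : ℕ
  -- A bound for exp (exp (8B)): log log N exceeds 8B as soon as N > F.
  F = proj₁ (exp-bound (proj₁ (exp-bound (8 ℕ.* B))))
  t-large : ∀ {N t} → F ℕ.< N → log (log (fromℕ N)) .U t → ι (8 ℕ.* B) ℚ.< t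
  t-large {N} {t} F<N (r , (n , N<n , n<expr) , r<expt) with ι (8 ℕ.* B) ℚ.<? t
  ... | yes p = p
  ... | no p  = contradiction F<N (ℕ.<⇒≯ N<F)
    where
    N<F : N ℕ.< F
    N<F = ι-cancel-< (ℚ.<-≤-trans N<n (proj₂ (exp-bound (proj₁ (exp-bound (8 ℕ.* B)))) (proj₂ (exp-bound (8 ℕ.* B)) (ℚ.≮⇒≥ p) r<expt) n<expr))
  sum-small : ∀ {N j q} → S ℕ.≤ N → N ℕ.≤ 2 ℕ.^ j → (log (fromℕ N) + log (fromℕ S)) .L q → q ℚ.< ι (4 ℕ.* j)
  sum-small {N} {j} {q} S≤N N≤2^j (u , v , expu<N , expv<S , refl) = ℚ.<-≤-trans
    (ℚ.+-mono-< (exp-<-2^ j N≤2^j expu<N) (exp-<-2^ j (ℕ.≤-trans S≤N N≤2^j) expv<S))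
    (ℚ.≤-reflexive (trans (sym (ι-+ (2 ℕ.* j) (2 ℕ.* j))) (cong ι (sym (ℕ.*-distribʳ-+ j 2 2)))))
  product : ∀ k {t} → ι (8 ℕ.* B) ℚ.≤ t → ι (4 ℕ.* (B ℕ.* k)) ℚ.≤ ½ ℚ.* ι k ℚ.* t
  product k {t} 8B≤t = begin
    ι (4 ℕ.* (B ℕ.* k))           ≡⟨ trans (ι-* 4 (B ℕ.* k)) (cong (ι 4 ℚ.*_) (ι-* B k)) ⟩
    ι 4 ℚ.* (ι B ℚ.* ι k)         ≡⟨ shuffle ½ (ι 8) (ι B) (ι k) ⟩
    ½ ℚ.* ι k ℚ.* (ι 8 ℚ.* ι B)   ≡⟨ cong (½ ℚ.* ι k ℚ.*_) (sym (ι-* 8 B)) ⟩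
    ½ ℚ.* ι k ℚ.* ι (8 ℕ.* B)     ≤⟨ Exponential.*-monoˡ-≤ (0≤* {½} (ℚ.*≤* (ℤ.+≤+ ℕ.z≤n)) (0≤ι k)) 8B≤t ⟩
    ½ ℚ.* ι k ℚ.* t               ∎
    where
    open ℚ.≤-Reasoning
    shuffle : ∀ a b c d → a ℚ.* b ℚ.* (c ℚ.* d) ≡ a ℚ.* d ℚ.* (b ℚ.* c)
    shuffle = solve-∀ ℚ-ring
  conclusion : ∀ N k → suc (S ℕ.+ F) ℕ.≤ N → 1 ℕ.≤ k →
    fromℕ k ≤ (log (fromℕ N) + log (fromℕ S)) / log (log (fromℕ N)) → 2 ℕ.^ (B ℕ.* k) ℕ.≤ N
  -- A lower cut contains only rationals strictly below k, so the hypothesis is evaluated at k/2.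
  -- With log log N > 8B and log N + log S < 4j, where N ≤ 2^j, this yields 4Bk < 4j.
  conclusion N k large 1≤k k≤ = finish (k≤ (½ ℚ.* ι k) ½k<k) (bitLength (ℕ.≤-trans (ℕ.s≤s ℕ.z≤n) large))
    where
    0<ιk : 0ℚ ℚ.< ι k
    0<ιk = ℚ.<-≤-trans (0<ι 0) (ι-mono-≤ 1≤k)
    ½k<k : ½ ℚ.* ι k ℚ.< ι k
    ½k<k = subst (½ ℚ.* ι k ℚ.<_) (ℚ.*-identityˡ (ι k)) (ℚ.*-monoˡ-<-pos (ι k) {{ℚ.positive 0<ιk}} {½} {1ℚ} (ℚ.*<* (ℤ.+<+ (ℕ.s≤s (ℕ.s≤s ℕ.z≤n)))))
    finish : ((log (fromℕ N) + log (fromℕ S)) / log (log (fromℕ N))) .L (½ ℚ.* ι k) →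
      ∃ (λ j → N ℕ.≤ 2 ℕ.^ j × (∀ m → m ℕ.< j → 2 ℕ.^ m ℕ.≤ N)) → 2 ℕ.^ (B ℕ.* k) ℕ.≤ N
    finish (_ , t , _ , loglogN<t , _ , <sum) (j , N≤2^j , 2^≤N) = 2^≤N (B ℕ.* k) (ℕ.*-cancelˡ-< 4 (B ℕ.* k) j (ι-cancel-< {4 ℕ.* (B ℕ.* k)} {4 ℕ.* j}
      (ℚ.≤-<-trans (product k (ℚ.<⇒≤ (t-large {N} {t} (ℕ.≤-trans (ℕ.s≤s (ℕ.m≤n+m F S)) large) loglogN<t)))
        (sum-small {N} {j} (ℕ.≤-trans (ℕ.m≤m+n S F) (ℕ.<⇒≤ large)) N≤2^j <sum))))

-- From integer counts to quotients and probabilities as cuts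

ι-*-/′ : ∀ n D .{{_ : ℕ.NonZero D}} → ι D ℚ.* (+ n ℚ./ D) ≡ ι n
ι-*-/′ n (suc D) = ι-*-/ (+ n) D

ι-*-mean : ∀ N S n → ι (2 ℕ.^ (N ℕ.* S)) ℚ.* mean N S n ≡ ι n
ι-*-mean N S n = ι-*-/′ n (2 ℕ.^ (N ℕ.* S)) {{ℕ.m^n≢0 2 (N ℕ.* S)}}

ι-mono-< : ∀ {m n} → m ℕ.< n → ι m ℚ.< ι n
ι-mono-< {m} {n} m<n = ℚ.<-≤-trans (subst₂ ℚ._<_ (ℚ.+-identityˡ (ι m)) (sym (ι-suc m)) (ℚ.+-monoˡ-< (ι m) (0<ι 0))) (ι-mono-≤ m<n)

∃-unitFraction : ∀ {q} → 0ℚ ℚ.< q → ∃₂ λ H w → 0 ℕ.< H × ι H ℚ.* w ≡ 1ℚ × w ℚ.< q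
∃-unitFraction {q} 0<q = H , w , ℕ.s≤s ℕ.z≤n , Hw , ℚ.*-cancelˡ-<-nonNeg (ι H) {{ℚ.nonNegative (0≤ι H)}} (begin-strict
  ι H ℚ.* w                       ≡⟨ Hw ⟩
  1ℚ                              ≡⟨ sym (ℚ.*-inverseˡ q) ⟩
  ℚ.1/ q ℚ.* q                    ≤⟨ Exponential.*-monoʳ-≤ (ℚ.<⇒≤ 0<q) (proj₂ bound) ⟩
  ι (proj₁ bound) ℚ.* q           <⟨ ℚ.*-monoˡ-<-pos q (ι-mono-< (ℕ.n<1+n (proj₁ bound))) ⟩
  ι H ℚ.* q                       ∎)
  where
  open ℚ.≤-Reasoning
  instance
    q-pos = ℚ.positive 0<q
    q≢0 = ℚ.pos⇒nonZero q {{ℚ.positive 0<q}}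
  bound = archimedean (ℚ.1/ q)
  H : ℕ
  H = suc (proj₁ bound)
  w : ℚ
  w = + 1 ℚ./ H
  Hw : ι H ℚ.* w ≡ 1ℚ
  Hw = ι-*-/′ 1 H

module _ {x : Cut} (real : IsReal x) where
  open IsReal real

  L-down : ∀ {p q} → p ℚ.< q → L x q → L x p
  L-down {p} {q} p<q q<x = Equivalence.from (roundedˡ p) (q , p<q , q<x)

  L<U : ∀ {p q} → L x p → U x q → p ℚ.< q
  L<U {p} {q} p<x x<q with ℚ.<-cmp p q
  ... | tri< p<q _ _  = p<q
  ... | tri≈ _ refl _ = contradiction (p<x , x<q) (disjoint p)
  ... | tri> _ _ q<p  = contradiction (p<x , Equivalence.from (roundedᵘ p) (q , q<p , x<q)) (disjoint p)

module _ (p : ℕ) (E y : ℚ) (0≤y : 0ℚ ℚ.≤ y) (y≤1 : y ℚ.≤ 1ℚ) where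
  private
    φ = ι p

  -- The quotient needs rationals on both sides of E. As 1 - y ≥ 0, any number below E will do,
  -- while the one above may exceed E by half the gap, because 1 - y ≤ 1.
  ratio-L : (1ℚ ℚ.- y) ℚ.* E ℚ.< φ → L (fromℕ p / fromℚ E) (1ℚ ℚ.- y)
  ratio-L a<φ = E ℚ.- 1ℚ , E ℚ.+ δ , E-1<E , E<E+δ , below₁ , below₂
    where
    a δ : ℚ
    a = (1ℚ ℚ.- y) ℚ.* E
    δ = ½ ℚ.* (φ ℚ.- a)
    0<φ-a : 0ℚ ℚ.< φ ℚ.- a
    0<φ-a = subst (ℚ._< φ ℚ.- a) (ℚ.+-inverseʳ a) (ℚ.+-monoˡ-< (ℚ.- a) a<φ)
    0<δ : 0ℚ ℚ.< δ
    0<δ = subst (ℚ._< δ) (ℚ.*-zeroʳ ½) (ℚ.*-monoʳ-<-pos ½ 0<φ-a)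
    E-1<E : E ℚ.- 1ℚ ℚ.< E
    E-1<E = subst (E ℚ.- 1ℚ ℚ.<_) (ℚ.+-identityʳ E) (ℚ.+-monoʳ-< E (ℚ.*<* ℤ.-<+))
    E<E+δ : E ℚ.< E ℚ.+ δ
    E<E+δ = subst (ℚ._< E ℚ.+ δ) (ℚ.+-identityʳ E) (ℚ.+-monoʳ-< E 0<δ)
    below₁ : (1ℚ ℚ.- y) ℚ.* (E ℚ.- 1ℚ) ℚ.< φ
    below₁ = ℚ.≤-<-trans (Exponential.*-monoˡ-≤ (0≤q-p y≤1) (ℚ.<⇒≤ E-1<E)) a<φ
    below₂ : (1ℚ ℚ.- y) ℚ.* (E ℚ.+ δ) ℚ.< φ
    below₂ = begin-strict
      (1ℚ ℚ.- y) ℚ.* (E ℚ.+ δ)  ≤⟨ ≤-by (y ℚ.* δ) (0≤* 0≤y (ℚ.<⇒≤ 0<δ)) (eq₁ y E δ) ⟩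
      a ℚ.+ δ                   <⟨ ℚ.+-monoʳ-< a (subst (ℚ._< δ ℚ.+ δ) (ℚ.+-identityʳ δ) (ℚ.+-monoʳ-< δ 0<δ)) ⟩
      a ℚ.+ (δ ℚ.+ δ)           ≡⟨ cong (ℚ._+_ a) (trans (sym (ℚ.*-distribʳ-+ (φ ℚ.- a) ½ ½)) (ℚ.*-identityˡ (φ ℚ.- a))) ⟩
      a ℚ.+ (φ ℚ.- a)           ≡⟨ eq₂ a φ ⟩
      φ                         ∎
      where
      open ℚ.≤-Reasoning
      eq₁ : ∀ y e d → (1ℚ ℚ.- y) ℚ.* (e ℚ.+ d) ℚ.+ y ℚ.* d ≡ (1ℚ ℚ.- y) ℚ.* e ℚ.+ d
      eq₁ = solve-∀ ℚ-ring
      eq₂ : ∀ a f → a ℚ.+ (f ℚ.- a) ≡ f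
      eq₂ = solve-∀ ℚ-ring

  -- Now the rational below E is the critical one. The factor 1 + y can be as large as 2, so a
  -- quarter of the gap is subtracted.
  ratio-U : φ ℚ.< (1ℚ ℚ.+ y) ℚ.* E → U (fromℕ p / fromℚ E) (1ℚ ℚ.+ y)
  ratio-U φ<b = E ℚ.- δ , E ℚ.+ 1ℚ , E-δ<E , E<E+1 , above₁ , above₂
    where
    b d δ : ℚ
    b = (1ℚ ℚ.+ y) ℚ.* E
    d = b ℚ.- φ
    δ = ½ ℚ.* ½ ℚ.* d
    0<d : 0ℚ ℚ.< d
    0<d = subst (ℚ._< d) (ℚ.+-inverseʳ φ) (ℚ.+-monoˡ-< (ℚ.- φ) φ<b)
    0<δ : 0ℚ ℚ.< δ
    0<δ = subst (ℚ._< δ) (ℚ.*-zeroʳ (½ ℚ.* ½)) (ℚ.*-monoʳ-<-pos (½ ℚ.* ½) 0<d)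
    E-δ<E : E ℚ.- δ ℚ.< E
    E-δ<E = subst (E ℚ.- δ ℚ.<_) (ℚ.+-identityʳ E) (ℚ.+-monoʳ-< E (ℚ.neg-antimono-< 0<δ))
    E<E+1 : E ℚ.< E ℚ.+ 1ℚ
    E<E+1 = subst (ℚ._< E ℚ.+ 1ℚ) (ℚ.+-identityʳ E) (ℚ.+-monoʳ-< E (0<ι 0))
    above₂ : φ ℚ.< (1ℚ ℚ.+ y) ℚ.* (E ℚ.+ 1ℚ)
    above₂ = ℚ.<-≤-trans φ<b (Exponential.*-monoˡ-≤ (ℚ.+-mono-≤ (0≤ι 1) 0≤y) (ℚ.<⇒≤ E<E+1))
    above₁ : φ ℚ.< (1ℚ ℚ.+ y) ℚ.* (E ℚ.- δ)
    above₁ = begin-strict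
      φ                                ≡⟨ eq₀ φ b ⟩
      b ℚ.- 1ℚ ℚ.* d                   ≡⟨ cong (λ z → b ℚ.- z) (eq₄ d) ⟩
      b ℚ.- ((δ ℚ.+ δ) ℚ.+ (δ ℚ.+ δ))  <⟨ ℚ.+-monoʳ-< b (ℚ.neg-antimono-< (subst (ℚ._< (δ ℚ.+ δ) ℚ.+ (δ ℚ.+ δ)) (ℚ.+-identityʳ (δ ℚ.+ δ)) (ℚ.+-monoʳ-< (δ ℚ.+ δ) (ℚ.+-mono-< 0<δ 0<δ)))) ⟩
      b ℚ.- (δ ℚ.+ δ)                  ≤⟨ ≤-by ((1ℚ ℚ.- y) ℚ.* δ) (0≤* (0≤q-p y≤1) (ℚ.<⇒≤ 0<δ)) (eq₁ y E δ) ⟩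
      (1ℚ ℚ.+ y) ℚ.* (E ℚ.- δ)         ∎
      where
      open ℚ.≤-Reasoning
      eq₀ : ∀ f b → f ≡ b ℚ.- 1ℚ ℚ.* (b ℚ.- f)
      eq₀ = solve-∀ ℚ-ring
      quarter : ∀ q x → (q ℚ.* x ℚ.+ q ℚ.* x) ℚ.+ (q ℚ.* x ℚ.+ q ℚ.* x) ≡ ((q ℚ.+ q) ℚ.+ (q ℚ.+ q)) ℚ.* x
      quarter = solve-∀ ℚ-ring
      eq₄ : ∀ x → 1ℚ ℚ.* x ≡ (½ ℚ.* ½ ℚ.* x ℚ.+ ½ ℚ.* ½ ℚ.* x) ℚ.+ (½ ℚ.* ½ ℚ.* x ℚ.+ ½ ℚ.* ½ ℚ.* x)
      eq₄ x = sym (quarter (½ ℚ.* ½) x)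
      eq₁ : ∀ y e d → (1ℚ ℚ.+ y) ℚ.* e ℚ.- (d ℚ.+ d) ℚ.+ (1ℚ ℚ.- y) ℚ.* d ≡ (1ℚ ℚ.+ y) ℚ.* (e ℚ.- d)
      eq₁ = solve-∀ ℚ-ring

-- Here E = A/D is the mean and y = 1/h.
module _ (D A p h : ℕ) (E y : ℚ) (DE≡A : ι D ℚ.* E ≡ ι A) (xy : ι h ℚ.* y ≡ 1ℚ) where
  private
    x = ι h
    instance
      Dx-nonNeg = ℚ.nonNegative (0≤* (0≤ι D) (0≤ι h))

  relative-> : h ℕ.* A ℕ.< A ℕ.+ h ℕ.* (D ℕ.* p) → (1ℚ ℚ.- y) ℚ.* E ℚ.< ι p
  relative-> lt = ℚ.*-cancelˡ-<-nonNeg (ι D ℚ.* x) (begin-strict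
    ι D ℚ.* x ℚ.* ((1ℚ ℚ.- y) ℚ.* E)              ≡⟨ eq₁ (ι D) x y E ⟩
    x ℚ.* (ι D ℚ.* E) ℚ.- x ℚ.* y ℚ.* (ι D ℚ.* E) ≡⟨ cong₂ (λ a b → x ℚ.* a ℚ.- b ℚ.* a) DE≡A xy ⟩
    x ℚ.* ι A ℚ.- 1ℚ ℚ.* ι A                      ≡⟨ cong₂ ℚ._-_ (sym (ι-* h A)) (ℚ.*-identityˡ (ι A)) ⟩
    ι (h ℕ.* A) ℚ.- ι A                       <⟨ ℚ.+-monoˡ-< (ℚ.- ι A) (ι-mono-< lt) ⟩
    ι (A ℕ.+ h ℕ.* (D ℕ.* p)) ℚ.- ι A         ≡⟨ cong (ℚ._- ι A) (trans (ι-+ A _) (cong (ℚ._+_ (ι A)) (trans (ι-* h (D ℕ.* p)) (cong (x ℚ.*_) (ι-* D p))))) ⟩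
    ι A ℚ.+ x ℚ.* (ι D ℚ.* ι p) ℚ.- ι A           ≡⟨ eq₂ (ι A) x (ι D) (ι p) ⟩
    ι D ℚ.* x ℚ.* ι p                             ∎)
    where
    open ℚ.≤-Reasoning
    eq₁ : ∀ d x y e → d ℚ.* x ℚ.* ((1ℚ ℚ.- y) ℚ.* e) ≡ x ℚ.* (d ℚ.* e) ℚ.- x ℚ.* y ℚ.* (d ℚ.* e)
    eq₁ = solve-∀ ℚ-ring
    eq₂ : ∀ a x d f → a ℚ.+ x ℚ.* (d ℚ.* f) ℚ.- a ≡ d ℚ.* x ℚ.* f
    eq₂ = solve-∀ ℚ-ring

  relative-< : h ℕ.* (D ℕ.* p) ℕ.< A ℕ.+ h ℕ.* A → ι p ℚ.< (1ℚ ℚ.+ y) ℚ.* E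
  relative-< lt = ℚ.*-cancelˡ-<-nonNeg (ι D ℚ.* x) (begin-strict
    ι D ℚ.* x ℚ.* ι p               ≡⟨ eq₁ (ι D) x (ι p) ⟩
    x ℚ.* (ι D ℚ.* ι p)             ≡⟨ sym (trans (ι-* h (D ℕ.* p)) (cong (x ℚ.*_) (ι-* D p))) ⟩
    ι (h ℕ.* (D ℕ.* p))         <⟨ ι-mono-< lt ⟩
    ι (A ℕ.+ h ℕ.* A)           ≡⟨ trans (ι-+ A _) (cong (ℚ._+_ (ι A)) (ι-* h A)) ⟩
    ι A ℚ.+ x ℚ.* ι A               ≡⟨ cong (ℚ._+ x ℚ.* ι A) (sym (ℚ.*-identityˡ (ι A))) ⟩
    1ℚ ℚ.* ι A ℚ.+ x ℚ.* ι A        ≡⟨ sym (cong₂ (λ a b → b ℚ.* a ℚ.+ x ℚ.* a) DE≡A xy) ⟩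
    x ℚ.* y ℚ.* (ι D ℚ.* E) ℚ.+ x ℚ.* (ι D ℚ.* E) ≡⟨ eq₂ (ι D) x y E ⟩
    ι D ℚ.* x ℚ.* ((1ℚ ℚ.+ y) ℚ.* E) ∎)
    where
    open ℚ.≤-Reasoning
    eq₁ : ∀ d x f → d ℚ.* x ℚ.* f ≡ x ℚ.* (d ℚ.* f)
    eq₁ = solve-∀ ℚ-ring
    eq₂ : ∀ d x y e → x ℚ.* y ℚ.* (d ℚ.* e) ℚ.+ x ℚ.* (d ℚ.* e) ≡ d ℚ.* x ℚ.* ((1ℚ ℚ.+ y) ℚ.* e)
    eq₂ = solve-∀ ℚ-ring

mean-≥ : ∀ D H len m w → 0 ℕ.< D → 0 ℕ.< H → ι D ℚ.* m ≡ ι len → ι H ℚ.* w ≡ 1ℚ → H ℕ.* D ℕ.≤ D ℕ.+ H ℕ.* len → 1ℚ ℚ.- w ℚ.≤ m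
mean-≥ D H len m w 0<D 0<H Dm Hw ≤ = Exponential.*-cancelˡ-≤ {ι H ℚ.* ι D} 0<HD (begin
  ι H ℚ.* ι D ℚ.* (1ℚ ℚ.- w)             ≡⟨ eq₁ (ι H) (ι D) w ⟩
  ι H ℚ.* ι D ℚ.- ι H ℚ.* w ℚ.* ι D      ≡⟨ cong₂ (λ a b → a ℚ.- b ℚ.* ι D) (sym (ι-* H D)) Hw ⟩
  ι (H ℕ.* D) ℚ.- 1ℚ ℚ.* ι D             ≤⟨ ℚ.+-monoˡ-≤ (ℚ.- (1ℚ ℚ.* ι D)) (ι-mono-≤ {H ℕ.* D} {D ℕ.+ H ℕ.* len} ≤) ⟩
  ι (D ℕ.+ H ℕ.* len) ℚ.- 1ℚ ℚ.* ι D     ≡⟨ cong (ℚ._- 1ℚ ℚ.* ι D) (trans (ι-+ D (H ℕ.* len)) (cong (ℚ._+_ (ι D)) (trans (ι-* H len) (cong (ι H ℚ.*_) (sym Dm))))) ⟩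
  ι D ℚ.+ ι H ℚ.* (ι D ℚ.* m) ℚ.- 1ℚ ℚ.* ι D ≡⟨ eq₂ (ι D) (ι H) m ⟩
  ι H ℚ.* ι D ℚ.* m                      ∎)
  where
  open ℚ.≤-Reasoning
  0<ι′ : ∀ {n} → 0 ℕ.< n → 0ℚ ℚ.< ι n
  0<ι′ {n} 0<n = ℚ.<-≤-trans (0<ι 0) (ι-mono-≤ {1} {n} 0<n)
  0<HD : 0ℚ ℚ.< ι H ℚ.* ι D
  0<HD = subst (ℚ._< ι H ℚ.* ι D) (ℚ.*-zeroʳ (ι H)) (ℚ.*-monoʳ-<-pos (ι H) {{ℚ.positive (0<ι′ 0<H)}} (0<ι′ 0<D))
  eq₁ : ∀ h d w → h ℚ.* d ℚ.* (1ℚ ℚ.- w) ≡ h ℚ.* d ℚ.- h ℚ.* w ℚ.* d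
  eq₁ = solve-∀ ℚ-ring
  eq₂ : ∀ d h m → d ℚ.+ h ℚ.* (d ℚ.* m) ℚ.- 1ℚ ℚ.* d ≡ h ℚ.* d ℚ.* m
  eq₂ = solve-∀ ℚ-ring

drop-above : ∀ h n p A → + h ℤ.* (+ n ℤ.* + p ℤ.- + A) ℤ.< + A → h ℕ.* (n ℕ.* p) ℕ.< A ℕ.+ h ℕ.* A
drop-above h n p A lt = ℤ.drop‿+<+ (subst₂ ℤ._<_
  (trans (eq (+ h) (+ n ℤ.* + p) (+ A)) (sym (trans (ℤ.pos-* h (n ℕ.* p)) (cong (+ h ℤ.*_) (ℤ.pos-* n p)))))
  (trans (cong (ℤ._+_ (+ A)) (sym (ℤ.pos-* h A))) (sym (ℤ.pos-+ A (h ℕ.* A))))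
  (ℤ.+-monoˡ-< (+ h ℤ.* + A) lt))
  where
  eq : ∀ h x a → h ℤ.* (x ℤ.- a) ℤ.+ h ℤ.* a ≡ h ℤ.* x
  eq = ℤ-Solver.solve-∀

drop-below : ∀ h n p A → + h ℤ.* (+ A ℤ.- + n ℤ.* + p) ℤ.< + A → h ℕ.* A ℕ.< A ℕ.+ h ℕ.* (n ℕ.* p)
drop-below h n p A lt = ℤ.drop‿+<+ (subst₂ ℤ._<_
  (trans (eq (+ h) (+ n ℤ.* + p) (+ A)) (sym (ℤ.pos-* h A)))
  (trans (cong (ℤ._+_ (+ A)) (sym (trans (ℤ.pos-* h (n ℕ.* p)) (cong (+ h ℤ.*_) (ℤ.pos-* n p))))) (sym (ℤ.pos-+ A (h ℕ.* (n ℕ.* p)))))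
  (ℤ.+-monoˡ-< (+ h ℤ.* (+ n ℤ.* + p)) lt))
  where
  eq : ∀ h x a → h ℤ.* (a ℤ.- x) ℤ.+ h ℤ.* x ≡ h ℤ.* a
  eq = ℤ-Solver.solve-∀

drop-bad : ∀ H D len bad → + len ℤ.+ bad ≡ + D → + H ℤ.* bad ℤ.≤ + D → H ℕ.* D ℕ.≤ D ℕ.+ H ℕ.* len
drop-bad H D len bad eq ≤ = ℤ.drop‿+≤+ (subst₂ ℤ._≤_
  (trans (sym (ℤ.*-distribˡ-+ (+ H) bad (+ len))) (trans (cong (+ H ℤ.*_) (trans (ℤ.+-comm bad (+ len)) eq)) (sym (ℤ.pos-* H D))))
  (trans (cong (ℤ._+_ (+ D)) (sym (ℤ.pos-* H len))) (sym (ℤ.pos-+ D (H ℕ.* len))))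
  (ℤ.+-monoˡ-≤ (+ H ℤ.* + len) ≤))

module _ {ε : Cut} (real : IsReal ε) (H : ℕ) (0<H : 0 ℕ.< H) (w : ℚ) (Hw : ι H ℚ.* w ≡ 1ℚ) (w<ε : L ε w) where
  private
    -- The relative deviation 1/(2H) is half of w = 1/H, so that w - y = y > 0 leaves the room that
    -- the strict inequalities in sums of cuts demand: 1 - y = (1 + y) - w with 1 + y > 1, and 1 + y
    -- = (1 - y) + w with 1 - y < 1.
    y : ℚ
    y = ½ ℚ.* w
    y+y≡w : y ℚ.+ y ≡ w
    y+y≡w = trans (sym (ℚ.*-distribʳ-+ w ½ ½)) (ℚ.*-identityˡ w)
    xy : ι (2 ℕ.* H) ℚ.* y ≡ 1ℚ
    xy = trans (cong (ℚ._* y) (ι-* 2 H)) (trans (shuffle (ι 2) (ι H) ½ w) (cong (ι 2 ℚ.* ½ ℚ.*_) Hw))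
      where
      shuffle : ∀ a b c d → a ℚ.* b ℚ.* (c ℚ.* d) ≡ a ℚ.* c ℚ.* (b ℚ.* d)
      shuffle = solve-∀ ℚ-ring
    0<2H : 0ℚ ℚ.< ι (2 ℕ.* H)
    0<2H = ℚ.<-≤-trans (0<ι 0) (ι-mono-≤ {1} {2 ℕ.* H} (ℕ.≤-trans 0<H (ℕ.m≤m+n H (H ℕ.+ 0))))
    0<y : 0ℚ ℚ.< y
    0<y = ℚ.*-cancelˡ-<-nonNeg (ι (2 ℕ.* H)) {{ℚ.nonNegative (ℚ.<⇒≤ 0<2H)}} (subst₂ ℚ._<_ (sym (ℚ.*-zeroʳ (ι (2 ℕ.* H)))) (sym xy) (0<ι 0))
    y≤1 : y ℚ.≤ 1ℚ
    y≤1 = subst₂ ℚ._≤_ (ℚ.*-identityˡ y) xy (Exponential.*-monoʳ-≤ (ℚ.<⇒≤ 0<y) (ι-mono-≤ {1} {2 ℕ.* H} (ℕ.≤-trans 0<H (ℕ.m≤m+n H (H ℕ.+ 0)))))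
    1<1+y : 1ℚ ℚ.< 1ℚ ℚ.+ y
    1<1+y = subst (ℚ._< 1ℚ ℚ.+ y) (ℚ.+-identityʳ 1ℚ) (ℚ.+-monoʳ-< 1ℚ 0<y)
    1-y<1 : 1ℚ ℚ.- y ℚ.< 1ℚ
    1-y<1 = subst (1ℚ ℚ.- y ℚ.<_) (ℚ.+-identityʳ 1ℚ) (ℚ.+-monoʳ-< 1ℚ (ℚ.neg-antimono-< 0<y))

  1-ε<1-y : U (fromℕ 1 - ε) (1ℚ ℚ.- y)
  1-ε<1-y = 1ℚ ℚ.+ y , ℚ.- w , 1<1+y , subst (L ε) (sym (neg-neg w)) w<ε , trans (eq y) (cong (λ z → 1ℚ ℚ.+ y ℚ.- z) y+y≡w)
    where
    neg-neg : ∀ x → ℚ.- (ℚ.- x) ≡ x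
    neg-neg = solve-∀ ℚ-ring
    eq : ∀ y → 1ℚ ℚ.- y ≡ 1ℚ ℚ.+ y ℚ.- (y ℚ.+ y)
    eq = solve-∀ ℚ-ring

  1+y<1+ε : L (fromℕ 1 + ε) (1ℚ ℚ.+ y)
  1+y<1+ε = 1ℚ ℚ.- y , w , 1-y<1 , w<ε , trans (eq y) (cong (ℚ._+_ (1ℚ ℚ.- y)) y+y≡w)
    where
    eq : ∀ y → 1ℚ ℚ.+ y ≡ 1ℚ ℚ.- y ℚ.+ (y ℚ.+ y)
    eq = solve-∀ ℚ-ring

  L<1-w : ∀ {q} → L (fromℕ 1 - ε) q → q ℚ.< 1ℚ ℚ.- w
  L<1-w {q} (r , s , r<1 , ε<-s , refl) = ℚ.+-mono-< r<1 (subst (ℚ._< ℚ.- w) (neg-neg s) (ℚ.neg-antimono-< (L<U real w<ε ε<-s)))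
    where
    neg-neg : ∀ x → ℚ.- (ℚ.- x) ≡ x
    neg-neg = solve-∀ ℚ-ring

  -- The list of all concentrated families serves as witness for every rational below 1 - ε: its
  -- share is at least 1 - w, and w < ε.
  relative-concentration : ∀ N S (X : Family N S → ℕ) → let fs = families N S in
    + H ℤ.* ∑ fs (λ e → 𝟙 (¬? (concentrated? fs (λ e → + X e) H e))) ℤ.≤ + length fs →
    fromℕ 1 - ε ≤ ℙ {N} {S} (λ e → fromℕ 1 - ε < fromℕ (X e) / fromℚ (𝔼 {N} {S} X) × fromℕ (X e) / fromℚ (𝔼 {N} {S} X) < fromℕ 1 + ε)
  relative-concentration N S X few q q<1-ε = good ,
      Unique.filter⁺ conc? (unique-vecsOver (unique-vecsOver unique-signs N) S) ,
      ListAll.map event (ListAll.all-filter conc? fs) ,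
      ℚ.<-≤-trans (L<1-w q<1-ε) (mean-≥ D H (length good) (mean N S (length good)) w (ℕ.m^n>0 2 (N ℕ.* S)) 0<H (ι-*-mean N S (length good)) Hw
        (drop-bad H D (length good) bad (trans (∑-filter conc? fs) (cong +_ (length-families N S))) (subst (+ H ℤ.* bad ℤ.≤_) (cong +_ (length-families N S)) few)))
    where
    fs = families N S
    D = 2 ℕ.^ (N ℕ.* S)
    A = sum (map X fs)
    E = 𝔼 {N} {S} X
    f : Family N S → ℤ
    f e = + X e
    conc? = concentrated? fs f H
    good = filter conc? fs
    bad = ∑ fs (λ e → 𝟙 (¬? (conc? e)))
    unique-signs : Unique signs
    unique-signs = ((λ ()) ∷ []) ∷ [] ∷ []
    event : ∀ {e} → Concentrated fs f H e → fromℕ 1 - ε < fromℕ (X e) / fromℚ E × fromℕ (X e) / fromℚ E < fromℕ 1 + ε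
    event {e} (above , below) =
      (1ℚ ℚ.- y , 1-ε<1-y , ratio-L (X e) E y (ℚ.<⇒≤ 0<y) y≤1 (relative-> D A (X e) (2 ℕ.* H) E y (ι-*-mean N S A) xy
        (drop-below (2 ℕ.* H) D (X e) A (subst₂ (λ a n → + (2 ℕ.* H) ℤ.* (a ℤ.- + n ℤ.* + X e) ℤ.< a) (∑-sum fs X) (length-families N S) below)))) ,
      (1ℚ ℚ.+ y , ratio-U (X e) E y (ℚ.<⇒≤ 0<y) y≤1 (relative-< D A (X e) (2 ℕ.* H) E y (ι-*-mean N S A) xy
        (drop-above (2 ℕ.* H) D (X e) A (subst₂ (λ a n → + (2 ℕ.* H) ℤ.* (+ n ℤ.* + X e ℤ.- a) ℤ.< a) (∑-sum fs X) (length-families N S) above))) , 1+y<1+ε)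

-- The threshold N₀ and the conclusion

abstract
  eventually-few-bad : ∀ H S → 1 ℕ.≤ H → 1 ℕ.≤ S → ∃ λ B → ∀ N k → 2 ℕ.≤ k → 2 ℕ.^ (B ℕ.* k) ℕ.≤ N → let fs = families N S in
    + H ℤ.* ∑ fs (λ e → 𝟙 (¬? (concentrated? fs (λ e → + Φ k e) H e))) ℤ.≤ + length fs
  eventually-few-bad H (suc S) 1≤H _ = 8 ℕ.* C H S 1≤H ℕ.+ 2 , badEvents H S 1≤H

  ∃-threshold : ∀ a b → ∃ λ n → 3 ℕ.≤ n × a ℕ.≤ n × b ℕ.< n
  ∃-threshold a b = 3 ℕ.+ (a ℕ.+ b) , ℕ.m≤m+n 3 (a ℕ.+ b) , ℕ.≤-trans (ℕ.m≤m+n a b) (ℕ.m≤n+m (a ℕ.+ b) 3) ,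
    ℕ.s≤s (ℕ.≤-trans (ℕ.m≤n+m b a) (ℕ.m≤n+m (a ℕ.+ b) 2))

12·log₂-≤ : ∀ S N₀ → 12 ℕ.* (8 ℕ.* S) ℕ.< N₀ → 12 · log₂ (fromℕ S) ≤ fromℕ N₀
12·log₂-≤ S N₀ <N₀ q q<log = ℚ.≤-<-trans (·-bound 12 {log₂ (fromℕ S)} {8 ℕ.* S} (log₂-bound S) q<log) (ι-mono-< <N₀)

theorem2 : (ε : Cut) → IsReal ε → fromℚ 0ℚ < ε →
    (S : ℕ) → 1 ℕ.≤ S →
    (k : ℕ → ℕ) →
    (∀ N → 3 ℕ.≤ N → 2 ℕ.≤ k N ×
    fromℕ (k N) ≤ (log (fromℕ N) + log (fromℕ S)) / log (log (fromℕ N))) →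
    ∃ λ (N₀ : ℕ) → 12 · log₂ (fromℕ S) ≤ fromℕ N₀ ×
    (∀ N → 1 ℕ.≤ N → N₀ ℕ.≤ N →
    let ratio = λ (e : Family N S) → fromℕ (Φ (k N) e) / fromℚ (𝔼 {N} {S} (Φ (k N)))
    in fromℕ 1 - ε ≤ ℙ {N} {S} (λ e → fromℕ 1 - ε < ratio e × ratio e < fromℕ 1 + ε))
theorem2 ε real (q , 0<q , q<ε) S 1≤S k hyp =
  conclude (∃-unitFraction 0<q)
  where
  Conclusion : Set
  Conclusion = ∃ λ (N₀ : ℕ) → 12 · log₂ (fromℕ S) ≤ fromℕ N₀ ×
    (∀ N → 1 ℕ.≤ N → N₀ ℕ.≤ N → fromℕ 1 - ε ≤ ℙ {N} {S} (λ e →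
      fromℕ 1 - ε < fromℕ (Φ (k N) e) / fromℚ (𝔼 {N} {S} (Φ (k N))) × fromℕ (Φ (k N) e) / fromℚ (𝔼 {N} {S} (Φ (k N))) < fromℕ 1 + ε))
  conclude : (∃₂ λ H w → 0 ℕ.< H × ι H ℚ.* w ≡ 1ℚ × w ℚ.< q) → Conclusion
  conclude (H , w , 0<H , Hw , w<q) = N₀ , 12·log₂-≤ S N₀ (proj₂ (proj₂ (proj₂ threshold))) , concentration
    where
    events = eventually-few-bad H S 0<H 1≤S
    order = order-small S (proj₁ events)
    -- N₀ has to meet three demands: at least 3, for the hypothesis on k; large enough for 2^(Bk) ≤
    -- N; and above 96S, which exceeds 12 log₂ S.
    threshold = ∃-threshold (proj₁ order) (12 ℕ.* (8 ℕ.* S))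
    N₀ : ℕ
    N₀ = proj₁ threshold
    concentration : ∀ N → 1 ℕ.≤ N → N₀ ℕ.≤ N → fromℕ 1 - ε ≤ ℙ {N} {S} (λ e →
      fromℕ 1 - ε < fromℕ (Φ (k N) e) / fromℚ (𝔼 {N} {S} (Φ (k N))) × fromℕ (Φ (k N) e) / fromℚ (𝔼 {N} {S} (Φ (k N))) < fromℕ 1 + ε)
    concentration N _ N₀≤N = relative-concentration real H 0<H w Hw (L-down real w<q q<ε) N S (Φ (k N))
      (proj₂ events N (k N) 2≤k (proj₂ order N (k N) (ℕ.≤-trans (proj₁ (proj₂ (proj₂ threshold))) N₀≤N) (ℕ.<⇒≤ 2≤k) (proj₂ (hyp N 3≤N))))
      where
      3≤N : 3 ℕ.≤ N
      3≤N = ℕ.≤-trans (proj₁ (proj₂ threshold)) N₀≤N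
      2≤k : 2 ℕ.≤ k N
      2≤k = proj₁ (hyp N 3≤N)
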